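{- For every tree poset $T$, \[\mathrm{La}^*_R(n,T)=\bigl(|T|-1+o(1)\bigr)\binom{n}{\lfloor n/2\rfloor}\] as $n\to\infty$.
   Context: All posets are finite. $B_n$ is the poset $(2^{[n]},\subseteq)$. A subfamily of a family of sets (or subset of a poset) is a copy of a poset $P$ if, ordered by inclusion (resp. by the induced order), it is isomorphic to $P$. A coloring of a family $\mathcal{F}$ of sets is proper if $F\subsetneq F'$ in $\mathcal{F}$ implies $F$ and $F'$ get different colors; a copy is rainbow if all its members receive distinct colors. $\mathrm{La}^*_R(n,P)$ is the maximum size of a family $\mathcal{F}\subseteq 2^{[n]}$ that admits a proper coloring with no rainbow copy of $P$ (equivalently, the maximum size of a union of antichains $A^1,\dots,A^m$ in $B_n$ with no copy of $P$ whose elements come from pairwise distinct $A^i$). The (unoriented) Hasse diagram of a poset has an edge between $x$ and $y$ whenever one covers the other; a tree poset is a poset whose Hasse diagram is a tree. -}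

module Defs where

open import Data.Nat using (ℕ; suc; _≤_; _<_)
open import Data.Fin using (Fin)
open import Data.Fin.Subset using (Subset; _⊆_; _⊂_)
open import Data.List using (List; []; _∷_; length; head; last)
open import Data.List.Membership.Propositional using (_∈_)
open import Data.List.Relation.Unary.Unique.Propositional using (Unique)
open import Data.List.Relation.Unary.Linked using (Linked)
open import Data.Maybe using (just)
open import Data.Product using (Σ; ∃; _×_; _,_)
open import Data.Sum using (_⊎_)
open import Data.Empty using (⊥)
open import Function.Bundles using (_⇔_)
open import Relation.Nullary using (¬_)
open import Relation.Binary.PropositionalEquality using (_≡_; _≢_)
open import Relation.Binary.Structures using (IsPartialOrder)
open import Level using (0ℓ)

record FinPoset : Set₁ where
  field
    size     : ℕ
    _≼_      : Fin size → Fin size → Set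
    isPartialOrder : IsPartialOrder _≡_ _≼_

∣_∣ₚ : FinPoset → ℕ
∣ P ∣ₚ = FinPoset.size P

module _ (P : FinPoset) where
  open FinPoset P

  _≺_ : Fin size → Fin size → Set
  x ≺ y = x ≼ y × x ≢ y

  Covers : Fin size → Fin size → Set
  Covers y x = x ≺ y × (∀ z → ¬ (x ≺ z × z ≺ y))

  HasseEdge : Fin size → Fin size → Set
  HasseEdge x y = Covers x y ⊎ Covers y x

  Walk : Fin size → Fin size → List (Fin size) → Set
  Walk x y vs = head vs ≡ just x × last vs ≡ just y × Linked HasseEdge vs

  Connected : Set
  Connected = ∀ x y → ∃ λ vs → Walk x y vs

  IsCycle : List (Fin size) → Set
  IsCycle vs = 3 ≤ length vs × Unique vs × Linked HasseEdge vs
               × (∃ λ a → ∃ λ b → head vs ≡ just a × last vs ≡ just b × HasseEdge b a)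

  Acyclic : Set
  Acyclic = ∀ vs → ¬ IsCycle vs

  IsTreePoset : Set
  IsTreePoset = 0 < size × Connected × Acyclic

-- A family is a duplicate-free list of subsets of [n]; its size is its length.
Family : ℕ → Set
Family n = List (Subset n)

Coloring : ℕ → Set
Coloring n = Subset n → ℕ

Proper : ∀ {n} → Family n → Coloring n → Set
Proper 𝓕 c = ∀ {F F'} → F ∈ 𝓕 → F' ∈ 𝓕 → F ⊂ F' → c F ≢ c F'

record Copy (P : FinPoset) {n} (𝓕 : Family n) : Set where
  open FinPoset P
  field
    φ      : Fin size → Subset n
    inside : ∀ x → φ x ∈ 𝓕
    inj    : ∀ x y → φ x ≡ φ y → x ≡ y
    order  : ∀ x y → (x ≼ y) ⇔ (φ x ⊆ φ y)

Rainbow : ∀ {P n} {𝓕 : Family n} → Coloring n → Copy P 𝓕 → Set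
Rainbow {P} c C = ∀ x y → c (φ x) ≡ c (φ y) → x ≡ y
  where open Copy C

Good : (n : ℕ) → FinPoset → Family n → Set
Good n P 𝓕 = Unique 𝓕 × Σ (Coloring n) λ c → Proper 𝓕 c × ((C : Copy P 𝓕) → ¬ Rainbow c C)

IsLaStar : ℕ → FinPoset → ℕ → Set
IsLaStar n P m = (∃ λ 𝓕 → Good n P 𝓕 × length 𝓕 ≡ m)
               × (∀ 𝓕 → Good n P 𝓕 → length 𝓕 ≤ m)

{-# OPTIONS --safe #-}

-- Put t = |T| and M = n C (n / 2).  The t - 1 middle levels, coloured by size, give the lower
-- bound.  For the upper bound let 𝓕 exceed (t - 1 + ε) M.  Only the sets close to the middle
-- level matter, and a random full chain contains X of them, where E[X] ≥ t - 1 + ε/2; hence the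
-- expected number of windows (t consecutive members of 𝓕 on the chain) is at least a constant
-- times E[X].  The colours in a window are distinct.  Merging the colours at random into t
-- classes, the i-th member of a window has class i, for all i, with probability t⁻ᵗ, so some
-- merging π keeps a positive proportion of all windows.  In the windows that are kept, sets at
-- different positions have different colours.
--
-- T arises from a vertex by attaching leaves.  It suffices to embed it so that a vertex goes to
-- a set at the position given by its rank in a fixed linear extension, attaching a leaf above
-- (below) everything so far whenever it lies above (below) its parent.  To attach a leaf to a
-- vertex with image A we need a window through A whose chain avoids the at most t sets already
-- used; A is a bottleneck if this fails for some choice of those sets.  Since all sets are near
-- the middle, a random chain through A meets such obstacles with small probability, so deleting
-- the windows through bottlenecks, once for each leaf, deletes only a small multiple of E[X].
module Submission where

open import Defs
open import Data.Bool as Bool using (Bool; true; false; if_then_else_)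
open import Data.Empty using (⊥; ⊥-elim)
open import Data.Fin.Base as Fin using (Fin; zero; suc; toℕ; inject₁; fromℕ)
open import Data.Fin.Properties as Fin using (toℕ<n; toℕ-injective)
open import Data.Fin.Subset as Sub using (Subset; ∣_∣; _⊆_; _⊂_; _∈_; _∉_; inside; outside)
open import Data.Fin.Subset.Properties as Sub using (_∈?_; _⊆?_; p⊆q⇒∣p∣≤∣q∣; p⊂q⇒∣p∣<∣q∣; ∣p∣≤n)
open import Data.List as List using (List; []; _∷_; _++_; length; map; filter; concatMap; allFin)
open import Data.List.Membership.Propositional using (find; lose) renaming (_∈_ to _∈ˡ_; _∉_ to _∉ˡ_)
open import Data.List.Membership.Propositional.Properties
  using (∈-applyUpTo⁺; ∈-applyUpTo⁻; ∈-map⁺; ∈-map⁻; ∈-++⁺ˡ; ∈-++⁺ʳ; ∈-++⁻; ∈-filter⁺; ∈-filter⁻; ∈-allFin; ∈-lookup; ∈-tabulate⁻)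
open import Data.List.Properties as List using (length-map; map-tabulate)
open import Data.List.Relation.Unary.All as All using (All; []; _∷_)
open import Data.List.Relation.Unary.AllPairs as AllPairs using (AllPairs; []; _∷_)
import Data.List.Relation.Unary.AllPairs.Properties as AllPairs⁺
open import Data.List.Relation.Unary.Any as Any using (here; there)
open import Data.List.Relation.Unary.Linked using (Linked; [-]; _∷_)
open import Data.List.Relation.Unary.Unique.Propositional using (Unique)
import Data.List.Relation.Unary.Unique.Propositional.Properties as Unique
open import Data.Maybe using (just)
open import Data.Nat
open import Data.Nat.Combinatorics using (_C_; k![n∸k]!∣n!; nCk≡nC[n∸k]; nCk+nC[k+1]≡[n+1]C[k+1]; k>n⇒nCk≡0)
open import Data.Nat.Combinatorics.Specification using (nCk≡n!/k![n-k]!)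
open import Data.Nat.DivMod using (m≡m%n+[m/n]*n; m%n<n; m/n*n≤m; m/n*n≡m; m*n/n≡m; /-monoˡ-≤)
open import Data.Nat.Properties
open import Data.Nat.Tactic.RingSolver using (solve-∀)
open import Data.Product using (Σ; ∃; ∃-syntax; _×_; _,_; proj₁; proj₂)
open import Data.Sum using (_⊎_; inj₁; inj₂)
open import Data.Unit using (⊤; tt)
open import Data.Vec as Vec using (Vec; []; _∷_; lookup; tabulate)
open import Data.Vec.Properties as Vec using (lookup∘tabulate; ≡-dec)
open import Function using (_∘_; id)
open import Function.Bundles using (_⇔_; mk⇔; Equivalence)
open import Relation.Binary.Definitions using (tri<; tri≈; tri>)
open import Relation.Binary.PropositionalEquality
open import Relation.Nullary using (¬_; Dec; yes; no; does; contradiction; ¬?)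
open import Relation.Nullary.Decidable using (_×-dec_; _⊎-dec_; _→-dec_; map′; decidable-stable)

-- Vertices of the tree get sets from different windows, and such sets may share a colour. The
-- merging repairs this: position determines class, so distinct ranks give distinct colours whatever
-- windows are used. Deleting windows for one leaf can create bottlenecks for another, so the lists
-- of windows are nested against the order of construction: the last leaf cleans first, and the tree
-- without it is embedded in what this cleaning leaves. A set found in a window of some list is then
-- safe for all later leaves. Losses are measured by `mass`, the number of incidences between chains
-- and members, and add up to less than 2t² / Q times `mass`. Everything is cleared of denominators:
-- ε is 1 / k, a random chain is a sum over all `n !` chains, and a probability of at most 2 / Q
-- becomes an inequality with factor `Q`. Two demands come from the constructive setting: the
-- maximum must be exhibited, so the existence of a good family of given size is decided by search;
-- and the order of T need not be decidable, so T is replaced by a `Tree` with a decidable relation.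

private variable
  𝒜 ℬ 𝒳 𝒫 𝒬 ℛ : Set
  n m t : ℕ

-- Finite sums and indicators

infix 8 ∑

opaque
  ∑ : List 𝒜 → (𝒜 → ℕ) → ℕ
  ∑ []       f = 0
  ∑ (x ∷ xs) f = f x + ∑ xs f


  ⟦_⟧ : Dec 𝒫 → ℕ
  ⟦ d ⟧ = if does d then 1 else 0

  ⟦⟧-yes : (d : Dec 𝒫) → 𝒫 → ⟦ d ⟧ ≡ 1
  ⟦⟧-yes (yes _) _ = refl
  ⟦⟧-yes (no ¬p) p = contradiction p ¬p

  ⟦⟧-no : (d : Dec 𝒫) → ¬ 𝒫 → ⟦ d ⟧ ≡ 0
  ⟦⟧-no (yes p) ¬p = contradiction p ¬p
  ⟦⟧-no (no _)  _  = refl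

  ⟦⟧≤1 : (d : Dec 𝒫) → ⟦ d ⟧ ≤ 1
  ⟦⟧≤1 (yes _) = s≤s z≤n
  ⟦⟧≤1 (no _)  = z≤n

  ⟦⟧-pos : (d : Dec 𝒫) → 0 < ⟦ d ⟧ → 𝒫
  ⟦⟧-pos (yes p) _ = p

  ⟦⟧-mono : (d : Dec 𝒫) (e : Dec 𝒬) → (𝒫 → 𝒬) → ⟦ d ⟧ ≤ ⟦ e ⟧
  ⟦⟧-mono (yes p) e f = ≤-reflexive (sym (⟦⟧-yes e (f p)))
  ⟦⟧-mono (no _)  e f = z≤n

  ⟦⟧-cong : (d : Dec 𝒫) (e : Dec 𝒬) → (𝒫 → 𝒬) → (𝒬 → 𝒫) → ⟦ d ⟧ ≡ ⟦ e ⟧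
  ⟦⟧-cong d e f g = ≤-antisym (⟦⟧-mono d e f) (⟦⟧-mono e d g)

  ⟦⟧-× : (d : Dec 𝒫) (e : Dec 𝒬) (r : Dec ℛ) → (ℛ → 𝒫 × 𝒬) → (𝒫 → 𝒬 → ℛ) → ⟦ r ⟧ ≡ ⟦ d ⟧ * ⟦ e ⟧
  ⟦⟧-× (yes p) (yes q) r f g = ⟦⟧-yes r (g p q)
  ⟦⟧-× (yes p) (no ¬q) r f g = ⟦⟧-no r (¬q ∘ proj₂ ∘ f)
  ⟦⟧-× (no ¬p) e       r f g = ⟦⟧-no r (¬p ∘ proj₁ ∘ f)

  ⟦⟧-⊎ : (r : Dec ℛ) (d : Dec 𝒫) (e : Dec 𝒬) → (ℛ → 𝒫 ⊎ 𝒬) → ⟦ r ⟧ ≤ ⟦ d ⟧ + ⟦ e ⟧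
  ⟦⟧-⊎ (no _)  d e f = z≤n
  ⟦⟧-⊎ (yes r) d e f with f r
  ... | inj₁ p = ≤-trans (≤-reflexive (sym (⟦⟧-yes d p))) (m≤m+n _ _)
  ... | inj₂ q = ≤-trans (≤-reflexive (sym (⟦⟧-yes e q))) (m≤n+m _ _)

  ∑-mono : (xs : List 𝒜) {f g : 𝒜 → ℕ} → (∀ {x} → x ∈ˡ xs → f x ≤ g x) → ∑ xs f ≤ ∑ xs g
  ∑-mono []       h = z≤n
  ∑-mono (x ∷ xs) h = +-mono-≤ (h (here refl)) (∑-mono xs (h ∘ there))

  ∑-cong : (xs : List 𝒜) {f g : 𝒜 → ℕ} → (∀ {x} → x ∈ˡ xs → f x ≡ g x) → ∑ xs f ≡ ∑ xs g
  ∑-cong []       h = refl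
  ∑-cong (x ∷ xs) h = cong₂ _+_ (h (here refl)) (∑-cong xs (h ∘ there))

  ∑-+ : (xs : List 𝒜) (f g : 𝒜 → ℕ) → ∑[ x ← xs ] (f x + g x) ≡ ∑ xs f + ∑ xs g
  ∑-+ []       f g = refl
  ∑-+ (x ∷ xs) f g = trans (cong (f x + g x +_) (∑-+ xs f g)) (lemma (f x) (g x) (∑ xs f) (∑ xs g))
    where lemma : ∀ a b c d → a + b + (c + d) ≡ a + c + (b + d)
          lemma = solve-∀

  ∑-*ˡ : (xs : List 𝒜) (k : ℕ) (f : 𝒜 → ℕ) → ∑[ x ← xs ] (k * f x) ≡ k * ∑ xs f
  ∑-*ˡ []       k f = sym (*-zeroʳ k)
  ∑-*ˡ (x ∷ xs) k f = trans (cong (k * f x +_) (∑-*ˡ xs k f)) (sym (*-distribˡ-+ k (f x) _))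

  ∑-*ʳ : (xs : List 𝒜) (k : ℕ) (f : 𝒜 → ℕ) → ∑[ x ← xs ] (f x * k) ≡ ∑ xs f * k
  ∑-*ʳ []       k f = refl
  ∑-*ʳ (x ∷ xs) k f = trans (cong (f x * k +_) (∑-*ʳ xs k f)) (sym (*-distribʳ-+ k (f x) _))

  ∑-∷ : (x : 𝒜) (xs : List 𝒜) (f : 𝒜 → ℕ) → ∑ (x ∷ xs) f ≡ f x + ∑ xs f
  ∑-∷ x xs f = refl

  ∑-singleton : {f : 𝒜 → ℕ} (x : 𝒜) → ∑ (x ∷ []) f ≡ f x
  ∑-singleton x = +-identityʳ _

  ∑-const : (xs : List 𝒜) (k : ℕ) → ∑[ _ ← xs ] k ≡ length xs * k
  ∑-const []       k = refl
  ∑-const (x ∷ xs) k = cong (k +_) (∑-const xs k)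

  ∑-zero : (xs : List 𝒜) {f : 𝒜 → ℕ} → (∀ {x} → x ∈ˡ xs → f x ≡ 0) → ∑ xs f ≡ 0
  ∑-zero []       h = refl
  ∑-zero (x ∷ xs) h = cong₂ _+_ (h (here refl)) (∑-zero xs (h ∘ there))

  ∑-map : (g : 𝒜 → ℬ) (xs : List 𝒜) (f : ℬ → ℕ) → ∑ (map g xs) f ≡ ∑ xs (f ∘ g)
  ∑-map g []       f = refl
  ∑-map g (x ∷ xs) f = cong (f (g x) +_) (∑-map g xs f)

  ∑-++ : (xs ys : List 𝒜) (f : 𝒜 → ℕ) → ∑ (xs ++ ys) f ≡ ∑ xs f + ∑ ys f
  ∑-++ []       ys f = refl
  ∑-++ (x ∷ xs) ys f = trans (cong (f x +_) (∑-++ xs ys f)) (sym (+-assoc (f x) _ _))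

  ∑-concatMap : (g : 𝒜 → List ℬ) (xs : List 𝒜) (f : ℬ → ℕ) →
    ∑ (concatMap g xs) f ≡ ∑[ x ← xs ] ∑ (g x) f
  ∑-concatMap g []       f = refl
  ∑-concatMap g (x ∷ xs) f =
    trans (∑-++ (g x) (concatMap g xs) f) (cong (∑ (g x) f +_) (∑-concatMap g xs f))

  ∑-swap : (xs : List 𝒜) (ys : List ℬ) (f : 𝒜 → ℬ → ℕ) →
    ∑[ x ← xs ] ∑[ y ← ys ] f x y ≡ ∑[ y ← ys ] ∑[ x ← xs ] f x y
  ∑-swap []       ys f = sym (∑-zero ys (λ _ → refl))
  ∑-swap (x ∷ xs) ys f =
    trans (cong (∑ ys (f x) +_) (∑-swap xs ys f)) (sym (∑-+ ys (f x) (λ y → ∑ xs (λ x → f x y))))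

  ∑-filter : {𝒫 : 𝒜 → Set} (P? : ∀ x → Dec (𝒫 x)) (xs : List 𝒜) (f : 𝒜 → ℕ) →
    ∑ (filter P? xs) f ≡ ∑[ x ← xs ] (⟦ P? x ⟧ * f x)
  ∑-filter P? []       f = refl
  ∑-filter P? (x ∷ xs) f with P? x
  ... | yes _ = cong₂ _+_ (sym (*-identityˡ (f x))) (∑-filter P? xs f)
  ... | no _  = ∑-filter P? xs f

  ∑-length : (xs : List 𝒜) → ∑[ _ ← xs ] 1 ≡ length xs
  ∑-length xs = trans (∑-const xs 1) (*-identityʳ _)

  ∑-∈ : (xs : List 𝒜) {x : 𝒜} (f : 𝒜 → ℕ) → x ∈ˡ xs → f x ≤ ∑ xs f
  ∑-∈ (x ∷ xs) f (here refl) = m≤m+n _ _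
  ∑-∈ (x ∷ xs) f (there p)   = ≤-trans (∑-∈ xs f p) (m≤n+m _ _)

  ∑-pos : (xs : List 𝒜) (f : 𝒜 → ℕ) → 0 < ∑ xs f → ∃[ x ] (x ∈ˡ xs × 0 < f x)
  ∑-pos (x ∷ xs) f h with f x in eq
  ... | suc k = x , here refl , subst (0 <_) (sym eq) (s≤s z≤n)
  ... | zero  with ∑-pos xs f h
  ...   | y , p , q = y , there p , q

  ∑-pigeon : (xs : List 𝒜) (f g : 𝒜 → ℕ) → ∑ xs f ≤ ∑ xs g → 0 < length xs → ∃[ x ] (x ∈ˡ xs × f x ≤ g x)
  ∑-pigeon (x ∷ xs) f g h _ with f x ≤? g x
  ... | yes p = x , here refl , p
  ... | no ¬p with xs in eq
  ...   | []     = contradiction (subst₂ _≤_ (+-identityʳ _) (+-identityʳ _) h) ¬p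
  ...   | y ∷ ys with ∑-pigeon (y ∷ ys) f g
                       (+-cancelˡ-≤ (g x) _ _ (≤-trans (+-monoˡ-≤ _ (<⇒≤ (≰⇒> ¬p))) h)) (s≤s z≤n)
  ...     | z , q , r = z , there q , r

  ∑-allFin-suc : ∀ m (f : Fin (suc m) → ℕ) → ∑ (allFin (suc m)) f ≡ f zero + ∑ (allFin m) (f ∘ suc)
  ∑-allFin-suc m f = cong (f zero +_)
    (trans (cong (λ xs → ∑ xs f) (sym (map-tabulate id suc))) (∑-map suc (allFin m) f))

syntax ∑ xs (λ x → e) = ∑[ x ← xs ] e

module _ (_≟_ : (x y : 𝒜) → Dec (x ≡ y)) where

  open import Data.List.Membership.DecPropositional _≟_ using () renaming (_∈?_ to _∈ˡ?_)

  opaque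
    unfolding ∑

    ∑-≡-unique : {ys : List 𝒜} → Unique ys → ∀ x → ∑[ y ← ys ] ⟦ x ≟ y ⟧ ≡ ⟦ x ∈ˡ? ys ⟧
    ∑-≡-unique {[]} _ x = sym (⟦⟧-no (x ∈ˡ? []) (λ ()))
    ∑-≡-unique {y ∷ ys} (y∉ ∷ u) x = go (x ≟ y)
      where
      go : (d : Dec (x ≡ y)) → ⟦ d ⟧ + ∑[ z ← ys ] ⟦ x ≟ z ⟧ ≡ ⟦ x ∈ˡ? (y ∷ ys) ⟧
      go (yes refl) = trans (cong₂ _+_ (⟦⟧-yes (yes (refl {x = x})) refl) (∑-zero ys (λ {z} z∈ → ⟦⟧-no (x ≟ z) (All.lookup y∉ z∈))))
                            (sym (⟦⟧-yes (x ∈ˡ? (x ∷ ys)) (here refl)))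
      go (no x≢y) = trans (cong₂ _+_ (⟦⟧-no (no x≢y) x≢y) (∑-≡-unique u x))
        (⟦⟧-cong (x ∈ˡ? ys) (x ∈ˡ? (y ∷ ys)) there λ { (here e) → contradiction e x≢y ; (there p) → p })

  -- Both sides sum `f` over the pairs of equal entries; without repetitions each common entry
  -- occurs in exactly one pair. This exchanges the members of a chain for those of a family.
  ∑-∩ : {xs ys : List 𝒜} → Unique xs → Unique ys → (f : 𝒜 → ℕ) →
    ∑[ x ← xs ] (⟦ x ∈ˡ? ys ⟧ * f x) ≡ ∑[ y ← ys ] (⟦ y ∈ˡ? xs ⟧ * f y)
  ∑-∩ {xs} {ys} uxs uys f = begin
    ∑[ x ← xs ] (⟦ x ∈ˡ? ys ⟧ * f x)
      ≡⟨ ∑-cong xs (λ {x} _ → trans (cong (_* f x) (sym (∑-≡-unique uys x))) (sym (∑-*ʳ ys (f x) _))) ⟩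
    ∑[ x ← xs ] ∑[ y ← ys ] (⟦ x ≟ y ⟧ * f x)
      ≡⟨ ∑-swap xs ys _ ⟩
    ∑[ y ← ys ] ∑[ x ← xs ] (⟦ x ≟ y ⟧ * f x)
      ≡⟨ ∑-cong ys (λ {y} _ → ∑-cong xs (λ {x} _ → flip x y)) ⟩
    ∑[ y ← ys ] ∑[ x ← xs ] (⟦ y ≟ x ⟧ * f y)
      ≡⟨ ∑-cong ys (λ {y} _ → trans (∑-*ʳ xs (f y) _) (cong (_* f y) (∑-≡-unique uxs y))) ⟩
    ∑[ y ← ys ] (⟦ y ∈ˡ? xs ⟧ * f y) ∎
    where
    open ≡-Reasoning
    flip : ∀ x y → ⟦ x ≟ y ⟧ * f x ≡ ⟦ y ≟ x ⟧ * f y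
    flip x y with x ≟ y
    ... | yes refl = cong (_* f x) (trans (⟦⟧-yes (yes refl) refl) (sym (⟦⟧-yes (x ≟ x) refl)))
    ... | no x≢y   = trans (cong (_* f x) (⟦⟧-no (no x≢y) x≢y)) (cong (_* f y) (sym (⟦⟧-no (y ≟ x) (x≢y ∘ sym))))

-- Full chains

-- A full chain ∅ = C₀ ⊂ C₁ ⊂ ⋯ ⊂ Cₙ of Bₙ arises from one of Bₙ₋₁ by choosing at
-- which of the n positions the new element is added.
data Chain : ℕ → Set where
  []  : Chain 0
  _∷_ : Fin (suc n) → Chain n → Chain (suc n)

-- From level i + 1 on, the new element is present and accounts for one of the k elements, hence
-- `pred k`. Every level beyond n is the full set, so `lvl-mono` needs no bound.
lvl : Chain n → ℕ → Subset n
lvl []      k = []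
lvl (i ∷ c) k with k ≤? toℕ i
... | yes _ = outside ∷ lvl c k
... | no _  = inside ∷ lvl c (pred k)

chains : ∀ n → List (Chain n)
chains zero    = [] ∷ []
chains (suc n) = concatMap (λ i → map (i ∷_) (chains n)) (allFin (suc n))

∑-chains-suc : ∀ n (f : Chain (suc n) → ℕ) →
  ∑ (chains (suc n)) f ≡ ∑[ i ← allFin (suc n) ] ∑[ c ← chains n ] f (i ∷ c)
∑-chains-suc n f = trans (∑-concatMap (λ i → map (i ∷_) (chains n)) (allFin (suc n)) f)
  (∑-cong (allFin (suc n)) (λ {i} _ → ∑-map (i ∷_) (chains n) f))

length-chains : ∀ n → length (chains n) ≡ n !
length-chains zero    = refl
length-chains (suc n) = begin
  length (chains (suc n))                                   ≡⟨ ∑-length (chains (suc n)) ⟨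
  ∑[ _ ← chains (suc n) ] 1                                 ≡⟨ ∑-chains-suc n _ ⟩
  ∑[ i ← allFin (suc n) ] ∑[ c ← chains n ] 1               ≡⟨ ∑-const (allFin (suc n)) _ ⟩
  length (allFin (suc n)) * (∑[ c ← chains n ] 1)           ≡⟨ cong₂ _*_ (List.length-tabulate {n = suc n} id) (trans (∑-length (chains n)) (length-chains n)) ⟩
  suc n * n !                                               ∎
  where open ≡-Reasoning

lvl-≤ : (i : Fin (suc n)) (c : Chain n) → ∀ {k} → k ≤ toℕ i → lvl (i ∷ c) k ≡ outside ∷ lvl c k
lvl-≤ i c {k} k≤i with k ≤? toℕ i
... | yes _  = refl
... | no k≰i = contradiction k≤i k≰i

lvl-> : (i : Fin (suc n)) (c : Chain n) → ∀ {k} → toℕ i < k → lvl (i ∷ c) k ≡ inside ∷ lvl c (pred k)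
lvl-> i c {k} i<k with k ≤? toℕ i
... | yes k≤i = contradiction i<k (≤⇒≯ k≤i)
... | no _    = refl

lvl-size : (c : Chain n) → ∀ {k} → k ≤ n → ∣ lvl c k ∣ ≡ k
lvl-size []      {zero} _ = refl
lvl-size (i ∷ c) {k} k≤ with k ≤? toℕ i
... | yes k≤i = lvl-size c (≤-trans k≤i (s≤s⁻¹ (toℕ<n i)))
lvl-size (i ∷ c) {zero}  k≤ | no k≰i = contradiction z≤n k≰i
lvl-size (i ∷ c) {suc k} k≤ | no k≰i = cong suc (lvl-size c (s≤s⁻¹ k≤))

lvl-mono : (c : Chain n) → ∀ {j k} → j ≤ k → lvl c j ⊆ lvl c k
lvl-mono []      j≤k ()
lvl-mono (i ∷ c) {j} {k} j≤k with j ≤? toℕ i | k ≤? toℕ i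
... | yes _   | yes _   = Sub.s⊆s (lvl-mono c j≤k)
... | no _    | no _    = Sub.s⊆s (lvl-mono c (pred-mono-≤ j≤k))
... | no j≰i  | yes k≤i = contradiction (≤-trans j≤k k≤i) j≰i
... | yes j≤i | no k≰i  = Sub.out⊆ (lvl-mono c (≤-trans j≤i (pred-mono-≤ (≰⇒> k≰i))))

_≟ˢ_ : (A B : Subset n) → Dec (A ≡ B)
_≟ˢ_ = ≡-dec Bool._≟_

-- Level k of a chain has size k, so A can occur on c at level `∣ A ∣` only, and incidence is a
-- single decidable equation.
through : Subset n → Chain n → ℕ
through A c = ⟦ lvl c ∣ A ∣ ≟ˢ A ⟧

#through : Subset n → ℕ
#through A = ∑ (chains _) (through A)

private
  -- With i the step at which the new element enters a chain, `below k i` says that level k does not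
  -- contain it yet, and `above k i` that it does.
  below : ℕ → Fin n → ℕ
  below k i = ⟦ k ≤? toℕ i ⟧

  above : ℕ → Fin n → ℕ
  above k i = ⟦ suc (toℕ i) ≤? k ⟧

  ∑-above : ∀ m k → k ≤ m → ∑ (allFin m) (above k) ≡ k
  ∑-above m       zero    _ = ∑-zero (allFin m) (λ {i} _ → ⟦⟧-no (suc (toℕ i) ≤? 0) (λ ()))
  ∑-above (suc m) (suc k) (s≤s k≤m) = trans (∑-allFin-suc m _)
    (cong₂ _+_ (⟦⟧-yes (1 ≤? suc k) (s≤s z≤n)) (trans (∑-cong (allFin m) (λ {i} _ → ⟦⟧-cong (suc (suc (toℕ i)) ≤? suc k) (suc (toℕ i) ≤? k) s≤s⁻¹ s≤s)) (∑-above m k k≤m)))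

  ∑-between : ∀ m a b → a ≤ b → b ≤ m → ∑[ i ← allFin m ] (below a i * above b i) ≡ b ∸ a
  ∑-between m a zero z≤n _ = ∑-zero (allFin m) (λ {i} _ →
    trans (cong (below 0 i *_) (⟦⟧-no (suc (toℕ i) ≤? 0) (λ ()))) (*-zeroʳ (below 0 i)))
  ∑-between (suc m) zero (suc b) a≤b b≤m =
    trans (∑-cong (allFin (suc m)) (λ {i} _ → trans (cong (_* above (suc b) i) (⟦⟧-yes (0 ≤? toℕ i) z≤n)) (*-identityˡ _))) (∑-above (suc m) (suc b) b≤m)
  ∑-between (suc m) (suc a) (suc b) (s≤s a≤b) (s≤s b≤m) = trans (∑-allFin-suc m _)
    (cong₂ _+_ (cong (_* above (suc b) (zero {m})) (⟦⟧-no (suc a ≤? 0) (λ ()))) (trans (∑-cong (allFin m) (λ {i} _ → cong₂ _*_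
        (⟦⟧-cong (suc a ≤? suc (toℕ i)) (a ≤? toℕ i) s≤s⁻¹ s≤s)
        (⟦⟧-cong (suc (suc (toℕ i)) ≤? suc b) (suc (toℕ i) ≤? b) s≤s⁻¹ s≤s)))
      (∑-between m a b a≤b b≤m)))

  ∑-below : ∀ m a → a ≤ m → ∑ (allFin m) (below a) ≡ m ∸ a
  ∑-below m a a≤m = trans
    (∑-cong (allFin m) (λ {i} _ → trans (sym (*-identityʳ _)) (cong (below a i *_) (sym (⟦⟧-yes (_ ≤? _) (toℕ<n i))))))
    (∑-between m a m a≤m ≤-refl)

  ⟦⟧*-yes : {P : Set} (d : Dec P) → P → ∀ m → m ≡ ⟦ d ⟧ * m
  ⟦⟧*-yes d p m = trans (sym (*-identityˡ m)) (cong (_* m) (sym (⟦⟧-yes d p)))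

  ⟦⟧*-no : {P : Set} (d : Dec P) → ¬ P → ∀ m → 0 ≡ ⟦ d ⟧ * m
  ⟦⟧*-no d ¬p m = cong (_* m) (sym (⟦⟧-no d ¬p))

  through-outside : (A : Subset n) (i : Fin (suc n)) (c : Chain n) →
    through (outside ∷ A) (i ∷ c) ≡ below ∣ A ∣ i * through A c
  through-outside A i c with ≤-<-connex ∣ A ∣ (toℕ i)
  ... | inj₁ a≤i = trans
    (⟦⟧-cong (lvl (i ∷ c) ∣ A ∣ ≟ˢ (outside ∷ A)) (lvl c ∣ A ∣ ≟ˢ A)
      (λ e → Vec.∷-injectiveʳ (trans (sym (lvl-≤ i c a≤i)) e)) (λ e → trans (lvl-≤ i c a≤i) (cong (outside ∷_) e)))
    (⟦⟧*-yes (∣ A ∣ ≤? toℕ i) a≤i _)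
  ... | inj₂ i<a = trans
    (⟦⟧-no (lvl (i ∷ c) ∣ A ∣ ≟ˢ (outside ∷ A)) (λ e → contradiction (Vec.∷-injectiveˡ (trans (sym (lvl-> i c i<a)) e)) λ ()))
    (⟦⟧*-no (∣ A ∣ ≤? toℕ i) (<⇒≱ i<a) _)

  through-inside : (A : Subset n) (i : Fin (suc n)) (c : Chain n) →
    through (inside ∷ A) (i ∷ c) ≡ above (suc ∣ A ∣) i * through A c
  through-inside A i c with ≤-<-connex (suc ∣ A ∣) (toℕ i)
  ... | inj₁ a<i = trans
    (⟦⟧-no (lvl (i ∷ c) (suc ∣ A ∣) ≟ˢ (inside ∷ A)) (λ e → contradiction (Vec.∷-injectiveˡ (trans (sym (lvl-≤ i c a<i)) e)) λ ()))
    (⟦⟧*-no (suc (toℕ i) ≤? suc ∣ A ∣) (<⇒≱ (s≤s a<i)) _)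
  ... | inj₂ i≤a = trans
    (⟦⟧-cong (lvl (i ∷ c) (suc ∣ A ∣) ≟ˢ (inside ∷ A)) (lvl c ∣ A ∣ ≟ˢ A)
      (λ e → Vec.∷-injectiveʳ (trans (sym (lvl-> i c i≤a)) e)) (λ e → trans (lvl-> i c i≤a) (cong (inside ∷_) e)))
    (⟦⟧*-yes (suc (toℕ i) ≤? suc ∣ A ∣) i≤a _)

  #through-outside : (A : Subset n) → #through (outside ∷ A) ≡ (suc n ∸ ∣ A ∣) * #through A
  #through-outside {n} A = begin
    ∑ (chains (suc n)) (through (outside ∷ A))                       ≡⟨ ∑-chains-suc n _ ⟩
    ∑[ i ← allFin (suc n) ] ∑[ c ← chains n ] through (outside ∷ A) (i ∷ c)
      ≡⟨ ∑-cong (allFin (suc n)) (λ {i} _ → trans (∑-cong (chains n) (λ {c} _ → through-outside A i c)) (∑-*ˡ (chains n) (below ∣ A ∣ i) (through A))) ⟩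
    ∑[ i ← allFin (suc n) ] (below ∣ A ∣ i * #through A)             ≡⟨ ∑-*ʳ (allFin (suc n)) _ _ ⟩
    ∑ (allFin (suc n)) (below ∣ A ∣) * #through A                    ≡⟨ cong (_* #through A) (∑-below (suc n) ∣ A ∣ (m≤n⇒m≤1+n (∣p∣≤n A))) ⟩
    (suc n ∸ ∣ A ∣) * #through A                                     ∎
    where open ≡-Reasoning

  #through-inside : (A : Subset n) → #through (inside ∷ A) ≡ suc ∣ A ∣ * #through A
  #through-inside {n} A = begin
    ∑ (chains (suc n)) (through (inside ∷ A))                        ≡⟨ ∑-chains-suc n _ ⟩
    ∑[ i ← allFin (suc n) ] ∑[ c ← chains n ] through (inside ∷ A) (i ∷ c)
      ≡⟨ ∑-cong (allFin (suc n)) (λ {i} _ → trans (∑-cong (chains n) (λ {c} _ → through-inside A i c)) (∑-*ˡ (chains n) (above (suc ∣ A ∣) i) (through A))) ⟩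
    ∑[ i ← allFin (suc n) ] (above (suc ∣ A ∣) i * #through A)       ≡⟨ ∑-*ʳ (allFin (suc n)) _ _ ⟩
    ∑ (allFin (suc n)) (above (suc ∣ A ∣)) * #through A              ≡⟨ cong (_* #through A) (∑-above (suc n) (suc ∣ A ∣) (s≤s (∣p∣≤n A))) ⟩
    suc ∣ A ∣ * #through A                                           ∎
    where open ≡-Reasoning

-- A chain through A is an ordering of A followed by an ordering of its complement.
#through-! : (A : Subset n) → #through A ≡ ∣ A ∣ ! * (n ∸ ∣ A ∣) !
#through-! []            = trans (∑-singleton []) (⟦⟧-yes ([] ≟ˢ []) refl)
#through-! {suc n} (false ∷ A) = begin
  #through (outside ∷ A)                            ≡⟨ #through-outside A ⟩
  (suc n ∸ a) * #through A                          ≡⟨ cong₂ _*_ (+-∸-assoc 1 (∣p∣≤n A)) (#through-! A) ⟩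
  suc (n ∸ a) * (a ! * (n ∸ a) !)                   ≡⟨ lemma (suc (n ∸ a)) (a !) ((n ∸ a) !) ⟩
  a ! * (suc (n ∸ a) * (n ∸ a) !)                   ≡⟨ cong (λ m → a ! * m !) (sym (+-∸-assoc 1 (∣p∣≤n A))) ⟩
  a ! * (suc n ∸ a) !                               ∎
  where
  open ≡-Reasoning
  a = ∣ A ∣
  lemma : ∀ x y z → x * (y * z) ≡ y * (x * z)
  lemma = solve-∀
#through-! {suc n} (true ∷ A) = trans (#through-inside A)
  (trans (cong (suc ∣ A ∣ *_) (#through-! A)) (sym (*-assoc (suc ∣ A ∣) (∣ A ∣ !) _)))

-- Chains through a set that contain or miss a point at a given level

#hit #miss : Subset n → Fin n → ℕ → ℕ
#hit  A x h = ∑[ c ← chains _ ] (through A c * ⟦ x ∈? lvl c h ⟧)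
#miss A x h = ∑[ c ← chains _ ] (through A c * ⟦ ¬? (x ∈? lvl c h) ⟧)

private
  -- The instances are `_∈_` and `_∉_`. The recursion on chains uses only that a new first element
  -- does not affect R for the old ones, which is `R-∷`.
  module _ (R : ∀ {n : ℕ} → Fin n → Subset n → Set) (R? : ∀ {n : ℕ} (x : Fin n) (A : Subset n) → Dec (R x A))
    (R-∷ : ∀ {n} {x : Fin n} {A : Subset n} b → R x A ⇔ R (suc x) (b ∷ A)) where

    ⟦R⟧-≤ : (i : Fin (suc n)) (c : Chain n) (x : Fin n) → ∀ {h} → h ≤ toℕ i →
      ⟦ R? (suc x) (lvl (i ∷ c) h) ⟧ ≡ ⟦ R? x (lvl c h) ⟧
    ⟦R⟧-≤ i c x {h} h≤i = ⟦⟧-cong (R? (suc x) (lvl (i ∷ c) h)) (R? x (lvl c h))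
      (λ r → Equivalence.from (R-∷ outside) (subst (R (suc x)) (lvl-≤ i c h≤i) r))
      (λ r → subst (R (suc x)) (sym (lvl-≤ i c h≤i)) (Equivalence.to (R-∷ outside) r))

    ⟦R⟧-> : (i : Fin (suc n)) (c : Chain n) (x : Fin n) → ∀ {h} → toℕ i < h →
      ⟦ R? (suc x) (lvl (i ∷ c) h) ⟧ ≡ ⟦ R? x (lvl c (pred h)) ⟧
    ⟦R⟧-> i c x {h} i<h = ⟦⟧-cong (R? (suc x) (lvl (i ∷ c) h)) (R? x (lvl c (pred h)))
      (λ r → Equivalence.from (R-∷ inside) (subst (R (suc x)) (lvl-> i c i<h) r))
      (λ r → subst (R (suc x)) (sym (lvl-> i c i<h)) (Equivalence.to (R-∷ inside) r))

    -- Without the new element, level h of the longer chain is level h or h - 1 of the shorter one,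
    -- according to whether that element enters after or before; exactly one summand survives.
    ⟦R⟧-split : (i : Fin (suc n)) (c : Chain n) (x : Fin n) (h : ℕ) →
      ⟦ R? (suc x) (lvl (i ∷ c) h) ⟧ ≡ below h i * ⟦ R? x (lvl c h) ⟧ + above h i * ⟦ R? x (lvl c (pred h)) ⟧
    ⟦R⟧-split i c x h with ≤-<-connex h (toℕ i)
    ... | inj₁ h≤i = trans (⟦R⟧-≤ i c x h≤i) (trans (sym (+-identityʳ _))
            (cong₂ _+_ (⟦⟧*-yes (h ≤? toℕ i) h≤i _) (⟦⟧*-no (suc (toℕ i) ≤? h) (≤⇒≯ h≤i) _)))
    ... | inj₂ i<h = trans (⟦R⟧-> i c x i<h)
            (cong₂ _+_ (⟦⟧*-no (h ≤? toℕ i) (<⇒≱ i<h) _) (⟦⟧*-yes (suc (toℕ i) ≤? h) i<h _))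

    #R : Subset n → Fin n → ℕ → ℕ
    #R A x h = ∑[ c ← chains _ ] (through A c * ⟦ R? x (lvl c h) ⟧)

    module _ (b : Bool) (coeff : ℕ → Fin (suc n) → ℕ) (A : Subset n) (x : Fin n) (h : ℕ)
      (through-b : ∀ i c → through (b ∷ A) (i ∷ c) ≡ coeff ∣ A ∣ i * through A c) where

      #R-suc : #R (b ∷ A) (suc x) h ≡
        (∑[ i ← allFin (suc n) ] (coeff ∣ A ∣ i * below h i)) * #R A x h +
        (∑[ i ← allFin (suc n) ] (coeff ∣ A ∣ i * above h i)) * #R A x (pred h)
      #R-suc = begin
        #R (b ∷ A) (suc x) h
          ≡⟨ ∑-chains-suc n _ ⟩
        ∑[ i ← Is ] ∑[ c ← chains n ] (through (b ∷ A) (i ∷ c) * ⟦ R? (suc x) (lvl (i ∷ c) h) ⟧)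
          ≡⟨ ∑-cong Is (λ {i} _ → ∑-cong (chains n) (λ {c} _ →
               trans (cong₂ _*_ (through-b i c) (⟦R⟧-split i c x h))
                     (lemma (coeff a i) (through A c) (below h i) (above h i) _ _))) ⟩
        ∑[ i ← Is ] ∑[ c ← chains n ] (coeff a i * below h i * f h c + coeff a i * above h i * f (pred h) c)
          ≡⟨ ∑-cong Is (λ {i} _ → trans (∑-+ (chains n) _ _)
               (cong₂ _+_ (∑-*ˡ (chains n) (coeff a i * below h i) (f h))
                          (∑-*ˡ (chains n) (coeff a i * above h i) (f (pred h))))) ⟩
        ∑[ i ← Is ] (coeff a i * below h i * #R A x h + coeff a i * above h i * #R A x (pred h))
          ≡⟨ ∑-+ Is _ _ ⟩
        ∑[ i ← Is ] (coeff a i * below h i * #R A x h) + ∑[ i ← Is ] (coeff a i * above h i * #R A x (pred h))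
          ≡⟨ cong₂ _+_ (∑-*ʳ Is (#R A x h) (λ i → coeff a i * below h i))
                       (∑-*ʳ Is (#R A x (pred h)) (λ i → coeff a i * above h i)) ⟩
        ∑[ i ← Is ] (coeff a i * below h i) * #R A x h + ∑[ i ← Is ] (coeff a i * above h i) * #R A x (pred h) ∎
        where
        open ≡-Reasoning
        a = ∣ A ∣
        Is = allFin (suc n)
        f : ℕ → Chain n → ℕ
        f k c = through A c * ⟦ R? x (lvl c k) ⟧
        lemma : ∀ u v y z r s → u * v * (y * r + z * s) ≡ u * y * (v * r) + u * z * (v * s)
        lemma = solve-∀

  below*below : ∀ m a h → a ≤ h → h ≤ m → ∑[ i ← allFin m ] (below a i * below h i) ≡ m ∸ h
  below*below m a h a≤h h≤m = trans (∑-cong (allFin m) (λ {i} _ →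
    sym (⟦⟧-× (a ≤? toℕ i) (h ≤? toℕ i) (h ≤? toℕ i) (λ h≤i → ≤-trans a≤h h≤i , h≤i) (λ _ q → q)))) (∑-below m h h≤m)

  above*above : ∀ m a h → h ≤ a → h ≤ m → ∑[ i ← allFin m ] (above a i * above h i) ≡ h
  above*above m a h h≤a h≤m = trans (∑-cong (allFin m) (λ {i} _ →
    sym (⟦⟧-× (suc (toℕ i) ≤? a) (suc (toℕ i) ≤? h) (suc (toℕ i) ≤? h) (λ i<h → ≤-trans i<h h≤a , i<h) (λ _ q → q)))) (∑-above m h h≤m)

  below*above≡0 : ∀ m a h → h ≤ a → ∑[ i ← allFin m ] (below a i * above h i) ≡ 0
  below*above≡0 m a h h≤a = ∑-zero (allFin m) (λ {i} _ →
    trans (sym (⟦⟧-× (a ≤? toℕ i) (suc (toℕ i) ≤? h) (no (λ (x : ⊥) → x)) ⊥-elim (λ p q → <⇒≱ q (≤-trans h≤a p))))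
          (⟦⟧-no (no (λ (x : ⊥) → x)) id))

  ∑-*-comm : ∀ {A : Set} (xs : List A) (f g : A → ℕ) → ∑[ x ← xs ] (f x * g x) ≡ ∑[ x ← xs ] (g x * f x)
  ∑-*-comm xs f g = ∑-cong xs (λ {x} _ → *-comm (f x) (g x))

  zero∈lvl : (i : Fin (suc n)) (c : Chain n) (h : ℕ) → ⟦ zero ∈? lvl (i ∷ c) h ⟧ ≡ above h i
  zero∈lvl i c h = ⟦⟧-cong (zero ∈? lvl (i ∷ c) h) (suc (toℕ i) ≤? h) to from
    where
    to : zero ∈ lvl (i ∷ c) h → toℕ i < h
    to z with ≤-<-connex h (toℕ i)
    ... | inj₁ h≤i = contradiction (subst (zero ∈_) (lvl-≤ i c h≤i) z) λ ()
    ... | inj₂ i<h = i<h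
    from : toℕ i < h → zero ∈ lvl (i ∷ c) h
    from i<h = subst (zero ∈_) (sym (lvl-> i c i<h)) Vec.here

  zero∉lvl : (i : Fin (suc n)) (c : Chain n) (h : ℕ) → ⟦ ¬? (zero ∈? lvl (i ∷ c) h) ⟧ ≡ below h i
  zero∉lvl i c h = ⟦⟧-cong (¬? (zero ∈? lvl (i ∷ c) h)) (h ≤? toℕ i) to from
    where
    to : zero ∉ lvl (i ∷ c) h → h ≤ toℕ i
    to z with ≤-<-connex h (toℕ i)
    ... | inj₁ h≤i = h≤i
    ... | inj₂ i<h = contradiction (subst (zero ∈_) (sym (lvl-> i c i<h)) Vec.here) z
    from : h ≤ toℕ i → zero ∉ lvl (i ∷ c) h
    from h≤i z = contradiction (subst (zero ∈_) (lvl-≤ i c h≤i) z) λ ()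

  ∑-through-* : (b : Bool) (A : Subset n) (u : Fin (suc n) → ℕ) (v : Fin (suc n) → ℕ) (g : Chain (suc n) → ℕ) →
    (∀ i c → through (b ∷ A) (i ∷ c) ≡ u i * through A c) → (∀ i c → g (i ∷ c) ≡ v i) →
    ∑[ c ← chains (suc n) ] (through (b ∷ A) c * g c) ≡ ∑[ i ← allFin (suc n) ] (u i * v i) * #through A
  ∑-through-* {n} b A u v g hu hv = begin
    ∑[ c ← chains (suc n) ] (through (b ∷ A) c * g c)
      ≡⟨ ∑-chains-suc n _ ⟩
    ∑[ i ← allFin (suc n) ] ∑[ c ← chains n ] (through (b ∷ A) (i ∷ c) * g (i ∷ c))
      ≡⟨ ∑-cong (allFin (suc n)) (λ {i} _ → trans (∑-cong (chains n) (λ {c} _ →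
           trans (cong₂ _*_ (hu i c) (hv i c)) (lemma (u i) (through A c) (v i)))) (∑-*ˡ (chains n) (u i * v i) (through A))) ⟩
    ∑[ i ← allFin (suc n) ] (u i * v i * #through A)
      ≡⟨ ∑-*ʳ (allFin (suc n)) (#through A) (λ i → u i * v i) ⟩
    ∑[ i ← allFin (suc n) ] (u i * v i) * #through A ∎
    where
    open ≡-Reasoning
    lemma : ∀ x y z → x * y * z ≡ x * z * y
    lemma = solve-∀

  x∉p⇒∣p∣<n : {x : Fin n} {A : Subset n} → x ∉ A → ∣ A ∣ < n
  x∉p⇒∣p∣<n {x = x} {A} x∉A = ≤∧≢⇒< (∣p∣≤n A) (λ e → x∉A (subst (x ∈_) (sym (Sub.∣p∣≡n⇒p≡⊤ e)) Sub.∈⊤))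

  x∈p⇒0<∣p∣ : {x : Fin n} {A : Subset n} → x ∈ A → 0 < ∣ A ∣
  x∈p⇒0<∣p∣ Vec.here = s≤s z≤n
  x∈p⇒0<∣p∣ {A = false ∷ A} (Vec.there p) = x∈p⇒0<∣p∣ p
  x∈p⇒0<∣p∣ {A = true ∷ A}  (Vec.there p) = s≤s z≤n

  hit-outside : ∀ n a h q q' N → a ≤ h → a < n → (h ≤ n → (n ∸ a) * q ≡ (h ∸ a) * N) →
    (a < h → (n ∸ a) * q' ≡ (pred h ∸ a) * N) → h ≤ suc n →
    (suc n ∸ a) * ((suc n ∸ h) * q + (h ∸ a) * q') ≡ (h ∸ a) * ((suc n ∸ a) * N)
  hit-outside n a h q q' N a≤h a<n ih ih' h≤ = begin
    (suc n ∸ a) * ((suc n ∸ h) * q + (h ∸ a) * q') ≡⟨ cong ((suc n ∸ a) *_) inner ⟩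
    (suc n ∸ a) * ((h ∸ a) * N)                     ≡⟨ x∙yz (suc n ∸ a) (h ∸ a) N ⟩
    (h ∸ a) * ((suc n ∸ a) * N)                     ∎
    where
    open ≡-Reasoning
    x∙yz : ∀ x y z → x * (y * z) ≡ y * (x * z)
    x∙yz = solve-∀
    instance _ = >-nonZero (m<n⇒0<n∸m a<n)
    e₁ : (n ∸ a) * ((suc n ∸ h) * q) ≡ (suc n ∸ h) * ((h ∸ a) * N)
    e₁ with h ≤? n
    ... | yes h≤n = trans (x∙yz (n ∸ a) (suc n ∸ h) q) (cong ((suc n ∸ h) *_) (ih h≤n))
    ... | no h≰n  = trans (cong (λ z → (n ∸ a) * (z * q)) z) (trans (*-zeroʳ (n ∸ a)) (cong (_* ((h ∸ a) * N)) (sym z)))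
      where z : suc n ∸ h ≡ 0
            z = m≤n⇒m∸n≡0 (≰⇒> h≰n)
    e₂ : (n ∸ a) * ((h ∸ a) * q') ≡ (h ∸ a) * ((pred h ∸ a) * N)
    e₂ with a <? h
    ... | yes a<h = trans (x∙yz (n ∸ a) (h ∸ a) q') (cong ((h ∸ a) *_) (ih' a<h))
    ... | no a≮h  = trans (cong (λ z → (n ∸ a) * (z * q')) z) (trans (*-zeroʳ (n ∸ a)) (cong (_* ((pred h ∸ a) * N)) (sym z)))
      where z : h ∸ a ≡ 0
            z = m≤n⇒m∸n≡0 (≮⇒≥ a≮h)
    e₃ : ∀ p p' → (p ≡ 0 ⊎ (suc n ∸ h) + p' ≡ n ∸ a) → (suc n ∸ h) * (p * N) + p * (p' * N) ≡ (n ∸ a) * (p * N)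
    e₃ p p' (inj₁ refl) = trans (cong (_+ 0) (*-zeroʳ (suc n ∸ h))) (sym (*-zeroʳ (n ∸ a)))
    e₃ p p' (inj₂ e)    = trans (lemma (suc n ∸ h) p p' N) (cong (_* (p * N)) e)
      where lemma : ∀ x p p' N → x * (p * N) + p * (p' * N) ≡ (x + p') * (p * N)
            lemma = solve-∀
    split : h ∸ a ≡ 0 ⊎ (suc n ∸ h) + (pred h ∸ a) ≡ n ∸ a
    split with a <? h
    ... | no a≮h = inj₁ (m≤n⇒m∸n≡0 (≮⇒≥ a≮h))
    ... | yes (s≤s {n = h'} a≤h') = inj₂ (trans (sym (+-∸-assoc (n ∸ h') a≤h')) (cong (_∸ a) (m∸n+n≡m (s≤s⁻¹ h≤))))
    inner : (suc n ∸ h) * q + (h ∸ a) * q' ≡ (h ∸ a) * N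
    inner = *-cancelˡ-≡ _ _ (n ∸ a) (trans (*-distribˡ-+ (n ∸ a) _ _) (trans (cong₂ _+_ e₁ e₂) (e₃ (h ∸ a) (pred h ∸ a) split)))

∈-∷ : {x : Fin n} {A : Subset n} → ∀ b → (x ∈ A) ⇔ (suc x ∈ (b ∷ A))
∈-∷ b = mk⇔ Vec.there (λ { (Vec.there p) → p })

∉-∷ : {x : Fin n} {A : Subset n} → ∀ b → (x ∉ A) ⇔ (suc x ∉ (b ∷ A))
∉-∷ b = mk⇔ (λ { f (Vec.there p) → f p }) (λ f p → f (Vec.there p))

_∉?_ : (x : Fin n) (A : Subset n) → Dec (x ∉ A)
x ∉? A = ¬? (x ∈? A)

-- On a random chain through A, level h is a uniformly random superset of A of size h, so it
-- contains x with probability (h - ∣A∣) / (n - ∣A∣).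
#hit-∉ : (A : Subset n) (x : Fin n) → ∀ {h} → x ∉ A → ∣ A ∣ ≤ h → h ≤ n →
  (n ∸ ∣ A ∣) * #hit A x h ≡ (h ∸ ∣ A ∣) * #through A
#hit-∉ (true ∷ A) zero x∉A = contradiction Vec.here x∉A
#hit-∉ {suc n} (false ∷ A) zero {h} x∉A a≤h h≤n = begin
  (suc n ∸ a) * #hit (false ∷ A) zero h  ≡⟨ cong ((suc n ∸ a) *_) (trans
       (∑-through-* false A (below a) (above h) _ (through-outside A) (λ i c → zero∈lvl i c h))
       (cong (_* #through A) (∑-between (suc n) a h a≤h h≤n))) ⟩
  (suc n ∸ a) * ((h ∸ a) * #through A)   ≡⟨ lemma (suc n ∸ a) (h ∸ a) (#through A) ⟩
  (h ∸ a) * ((suc n ∸ a) * #through A)   ≡⟨ cong ((h ∸ a) *_) (#through-outside A) ⟨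
  (h ∸ a) * #through (false ∷ A)         ∎
  where
  open ≡-Reasoning
  a = ∣ A ∣
  lemma : ∀ x y z → x * (y * z) ≡ y * (x * z)
  lemma = solve-∀
#hit-∉ {suc n} (false ∷ A) (suc x) {h} x∉A a≤h h≤n = begin
  (suc n ∸ a) * #hit (false ∷ A) (suc x) h
    ≡⟨ cong ((suc n ∸ a) *_) (trans (#R-suc _∈_ _∈?_ ∈-∷ false below A x h (through-outside A))
         (cong₂ _+_ (cong (_* #hit A x h) (below*below (suc n) a h a≤h h≤n))
                    (cong (_* #hit A x (pred h)) (∑-between (suc n) a h a≤h h≤n)))) ⟩
  (suc n ∸ a) * ((suc n ∸ h) * #hit A x h + (h ∸ a) * #hit A x (pred h))
    ≡⟨ hit-outside n a h _ _ _ a≤h (x∉p⇒∣p∣<n x∉A')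
         (λ h≤ → #hit-∉ A x x∉A' a≤h h≤) (λ a<h → #hit-∉ A x x∉A' (pred-mono-≤ a<h) (pred-mono-≤ h≤n)) h≤n ⟩
  (h ∸ a) * ((suc n ∸ a) * #through A)   ≡⟨ cong ((h ∸ a) *_) (#through-outside A) ⟨
  (h ∸ a) * #through (false ∷ A)         ∎
  where
  open ≡-Reasoning
  a = ∣ A ∣
  x∉A' = λ p → x∉A (Vec.there p)
#hit-∉ {suc n} (true ∷ A) (suc x) {suc h} x∉A (s≤s a≤h) (s≤s h≤n) = begin
  (n ∸ a) * #hit (true ∷ A) (suc x) (suc h)
    ≡⟨ cong ((n ∸ a) *_) (trans (#R-suc _∈_ _∈?_ ∈-∷ true (above ∘ suc) A x (suc h) (through-inside A))
         (cong₂ _+_ (cong (_* #hit A x (suc h)) (trans (∑-*-comm Is (above (suc a)) (below (suc h))) (below*above≡0 (suc n) (suc h) (suc a) (s≤s a≤h))))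
                    (cong (_* #hit A x h) (trans (∑-*-comm Is (above (suc a)) (above (suc h))) (above*above (suc n) (suc h) (suc a) (s≤s a≤h) (s≤s (∣p∣≤n A))))))) ⟩
  (n ∸ a) * (suc a * #hit A x h)         ≡⟨ lemma (n ∸ a) (suc a) _ ⟩
  suc a * ((n ∸ a) * #hit A x h)         ≡⟨ cong (suc a *_) (#hit-∉ A x (λ p → x∉A (Vec.there p)) a≤h h≤n) ⟩
  suc a * ((h ∸ a) * #through A)         ≡⟨ lemma (suc a) (h ∸ a) _ ⟩
  (h ∸ a) * (suc a * #through A)         ≡⟨ cong ((h ∸ a) *_) (#through-inside A) ⟨
  (h ∸ a) * #through (true ∷ A)          ∎
  where
  open ≡-Reasoning
  a = ∣ A ∣
  Is = allFin (suc n)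
  lemma : ∀ x y z → x * (y * z) ≡ y * (x * z)
  lemma = solve-∀

private
  -- Mirror image of `hit-outside`: the coefficient of `q` vanishes for h = a + 1, that of `q'` for
  -- h = 0.
  miss-inside : ∀ a h q q' N → h ≤ suc a → 0 < a → (h ≤ a → a * q ≡ (a ∸ h) * N) → a * q' ≡ (a ∸ pred h) * N →
    suc a * ((suc a ∸ h) * q + h * q') ≡ (suc a ∸ h) * (suc a * N)
  miss-inside a h q q' N h≤ 0<a ih ih' = begin
    suc a * ((suc a ∸ h) * q + h * q') ≡⟨ cong (suc a *_) (*-cancelˡ-≡ _ _ a inner) ⟩
    suc a * ((suc a ∸ h) * N)          ≡⟨ x∙yz (suc a) (suc a ∸ h) N ⟩
    (suc a ∸ h) * (suc a * N)          ∎
    where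
    open ≡-Reasoning
    x∙yz : ∀ x y z → x * (y * z) ≡ y * (x * z)
    x∙yz = solve-∀
    instance _ = >-nonZero 0<a
    lemma : ∀ x y u v → x * (u * y + v * y) ≡ y * (u * x + v * x)
    lemma = solve-∀
    inner : a * ((suc a ∸ h) * q + h * q') ≡ a * ((suc a ∸ h) * N)
    inner with h ≤? a
    ... | no h≰a = begin
      a * ((suc a ∸ h) * q + h * q') ≡⟨ cong (λ z → a * (z * q + h * q')) z ⟩
      a * (h * q')                   ≡⟨ x∙yz a h q' ⟩
      h * (a * q')                   ≡⟨ cong (h *_) (trans ih' (cong (_* N) (m≤n⇒m∸n≡0 (pred-mono-≤ (≰⇒> h≰a))))) ⟩
      h * 0                          ≡⟨ *-zeroʳ h ⟩
      0                              ≡⟨ *-zeroʳ a ⟨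
      a * 0                          ≡⟨ cong (λ z → a * (z * N)) z ⟨
      a * ((suc a ∸ h) * N)          ∎
      where z : suc a ∸ h ≡ 0
            z = m≤n⇒m∸n≡0 (≰⇒> h≰a)
    ... | yes h≤a = begin
      a * ((suc a ∸ h) * q + h * q')                         ≡⟨ *-distribˡ-+ a _ _ ⟩
      a * ((suc a ∸ h) * q) + a * (h * q')                   ≡⟨ cong₂ _+_ (x∙yz a (suc a ∸ h) q) (x∙yz a h q') ⟩
      (suc a ∸ h) * (a * q) + h * (a * q')                   ≡⟨ cong₂ (λ u v → (suc a ∸ h) * u + h * v) (ih h≤a) ih' ⟩
      (suc a ∸ h) * ((a ∸ h) * N) + h * ((a ∸ pred h) * N)   ≡⟨ fin h h≤a ⟩
      a * ((suc a ∸ h) * N)                                  ∎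
      where
      fin : ∀ h → h ≤ a → (suc a ∸ h) * ((a ∸ h) * N) + h * ((a ∸ pred h) * N) ≡ a * ((suc a ∸ h) * N)
      fin zero _ = trans (+-identityʳ _) (x∙yz (suc a) a N)
      fin (suc h) h<a = trans (l₂ (a ∸ h) (a ∸ suc h) (suc h) N) (cong (_* ((a ∸ h) * N)) (m∸n+n≡m h<a))
        where l₂ : ∀ x y z N → x * (y * N) + z * (x * N) ≡ (y + z) * (x * N)
              l₂ = solve-∀

-- On a random chain through A, level h is a uniformly random subset of A of size h, so it misses x
-- with probability (∣A∣ - h) / ∣A∣.
#miss-∈ : (A : Subset n) (x : Fin n) → ∀ {h} → x ∈ A → h ≤ ∣ A ∣ →
  ∣ A ∣ * #miss A x h ≡ (∣ A ∣ ∸ h) * #through A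
#miss-∈ {suc n} (true ∷ A) zero {h} x∈A h≤a = begin
  suc a * #miss (true ∷ A) zero h        ≡⟨ cong (suc a *_) (trans
       (∑-through-* true A (above (suc a)) (below h) _ (through-inside A) (λ i c → zero∉lvl i c h))
       (cong (_* #through A) (trans (∑-*-comm (allFin (suc n)) (above (suc a)) (below h)) (∑-between (suc n) h (suc a) h≤a (s≤s (∣p∣≤n A)))))) ⟩
  suc a * ((suc a ∸ h) * #through A)     ≡⟨ lemma (suc a) (suc a ∸ h) (#through A) ⟩
  (suc a ∸ h) * (suc a * #through A)     ≡⟨ cong ((suc a ∸ h) *_) (#through-inside A) ⟨
  (suc a ∸ h) * #through (true ∷ A)      ∎
  where
  open ≡-Reasoning
  a = ∣ A ∣
  lemma : ∀ x y z → x * (y * z) ≡ y * (x * z)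
  lemma = solve-∀
#miss-∈ {suc n} (true ∷ A) (suc x) {h} (Vec.there x∈A) h≤a = begin
  suc a * #miss (true ∷ A) (suc x) h
    ≡⟨ cong (suc a *_) (trans (#R-suc _∉_ _∉?_ ∉-∷ true (above ∘ suc) A x h (through-inside A))
         (cong₂ _+_ (cong (_* #miss A x h) (trans (∑-*-comm Is (above (suc a)) (below h)) (∑-between (suc n) h (suc a) h≤a (s≤s (∣p∣≤n A)))))
                    (cong (_* #miss A x (pred h)) (above*above (suc n) (suc a) h h≤a (≤-trans h≤a (s≤s (∣p∣≤n A))))))) ⟩
  suc a * ((suc a ∸ h) * #miss A x h + h * #miss A x (pred h))
    ≡⟨ miss-inside a h _ _ _ h≤a (x∈p⇒0<∣p∣ x∈A) (λ h≤ → #miss-∈ A x x∈A h≤) (#miss-∈ A x x∈A (pred-mono-≤ h≤a)) ⟩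
  (suc a ∸ h) * (suc a * #through A)     ≡⟨ cong ((suc a ∸ h) *_) (#through-inside A) ⟨
  (suc a ∸ h) * #through (true ∷ A)      ∎
  where
  open ≡-Reasoning
  a = ∣ A ∣
  Is = allFin (suc n)
#miss-∈ {suc n} (false ∷ A) (suc x) {h} (Vec.there x∈A) h≤a = begin
  a * #miss (false ∷ A) (suc x) h
    ≡⟨ cong (a *_) (trans (#R-suc _∉_ _∉?_ ∉-∷ false below A x h (through-outside A))
         (trans (cong₂ _+_ (cong (_* #miss A x h) (trans (∑-*-comm Is (below a) (below h)) (below*below (suc n) h a h≤a a≤1+n)))
                    (cong (_* #miss A x (pred h)) (below*above≡0 (suc n) a h h≤a))) (+-identityʳ _))) ⟩
  a * ((suc n ∸ a) * #miss A x h)        ≡⟨ lemma a (suc n ∸ a) _ ⟩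
  (suc n ∸ a) * (a * #miss A x h)        ≡⟨ cong ((suc n ∸ a) *_) (#miss-∈ A x x∈A h≤a) ⟩
  (suc n ∸ a) * ((a ∸ h) * #through A)   ≡⟨ lemma (suc n ∸ a) (a ∸ h) _ ⟩
  (a ∸ h) * ((suc n ∸ a) * #through A)   ≡⟨ cong ((a ∸ h) *_) (#through-outside A) ⟨
  (a ∸ h) * #through (false ∷ A)         ∎
  where
  open ≡-Reasoning
  a = ∣ A ∣
  Is = allFin (suc n)
  a≤1+n : ∣ A ∣ ≤ suc n
  a≤1+n = m≤n⇒m≤1+n (∣p∣≤n A)
  lemma : ∀ x y z → x * (y * z) ≡ y * (x * z)
  lemma = solve-∀

-- Binomial coefficients

nCk*k!*[n∸k]!≡n! : ∀ {n k} → k ≤ n → (n C k) * (k ! * (n ∸ k) !) ≡ n !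
nCk*k!*[n∸k]!≡n! {n} {k} k≤n =
  trans (cong (_* (k ! * (n ∸ k) !)) (nCk≡n!/k![n-k]! k≤n)) (m/n*n≡m (k![n∸k]!∣n! k≤n))
  where instance _ = k !* (n ∸ k) !≢0

[1+k]*nC[1+k]≡[n∸k]*nCk : ∀ n k → suc k * (n C suc k) ≡ (n ∸ k) * (n C k)
[1+k]*nC[1+k]≡[n∸k]*nCk n k with k <? n
... | no k≮n = trans (cong (suc k *_) (k>n⇒nCk≡0 (s≤s (≮⇒≥ k≮n))))
                 (trans (*-zeroʳ (suc k)) (cong (_* (n C k)) (sym (m≤n⇒m∸n≡0 (≮⇒≥ k≮n)))))
... | yes k<n = *-cancelʳ-≡ _ _ (k ! * (n ∸ suc k) !) (begin
  suc k * (n C suc k) * (k ! * (n ∸ suc k) !)   ≡⟨ l₁ (suc k) (n C suc k) (k !) ((n ∸ suc k) !) ⟩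
  (n C suc k) * (suc k ! * (n ∸ suc k) !)       ≡⟨ nCk*k!*[n∸k]!≡n! k<n ⟩
  n !                                           ≡⟨ nCk*k!*[n∸k]!≡n! (<⇒≤ k<n) ⟨
  (n C k) * (k ! * (n ∸ k) !)                   ≡⟨ cong (λ m → (n C k) * (k ! * m !)) e ⟩
  (n C k) * (k ! * (suc (n ∸ suc k) * (n ∸ suc k) !)) ≡⟨ l₂ (n C k) (k !) (suc (n ∸ suc k)) _ ⟩
  suc (n ∸ suc k) * (n C k) * (k ! * (n ∸ suc k) !)   ≡⟨ cong (λ m → m * (n C k) * (k ! * (n ∸ suc k) !)) e ⟨
  (n ∸ k) * (n C k) * (k ! * (n ∸ suc k) !)     ∎)
  where
  open ≡-Reasoning
  instance _ = k !* (n ∸ suc k) !≢0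
  e : n ∸ k ≡ suc (n ∸ suc k)
  e = +-∸-assoc 1 k<n
  l₁ : ∀ x y z w → x * y * (z * w) ≡ y * (x * z * w)
  l₁ = solve-∀
  l₂ : ∀ x y z w → x * (y * (z * w)) ≡ z * x * (y * w)
  l₂ = solve-∀

2*[n/2]≤n : ∀ n → 2 * (n / 2) ≤ n
2*[n/2]≤n n = subst (_≤ n) (*-comm (n / 2) 2) (m/n*n≤m n 2)

n≤1+2*[n/2] : ∀ n → n ≤ suc (2 * (n / 2))
n≤1+2*[n/2] n = begin
  n                     ≡⟨ m≡m%n+[m/n]*n n 2 ⟩
  n % 2 + n / 2 * 2     ≤⟨ +-mono-≤ (s≤s⁻¹ (m%n<n n 2)) (≤-reflexive (*-comm (n / 2) 2)) ⟩
  suc (2 * (n / 2))     ∎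
  where open ≤-Reasoning

nCk-step : ∀ n k → k < n / 2 → n C k ≤ n C suc k
nCk-step n k k<h = *-cancelˡ-≤ (suc k) (begin
  suc k * (n C k)       ≤⟨ *-monoˡ-≤ (n C k) (m+n≤o⇒m≤o∸n (suc k) le) ⟩
  (n ∸ k) * (n C k)     ≡⟨ [1+k]*nC[1+k]≡[n∸k]*nCk n k ⟨
  suc k * (n C suc k)   ∎)
  where
  open ≤-Reasoning
  le : suc k + k ≤ n
  le = ≤-trans (+-mono-≤ k<h (<⇒≤ k<h)) (subst (_≤ n) (cong (n / 2 +_) (+-identityʳ (n / 2))) (2*[n/2]≤n n))

nCk-mono : ∀ n {j k} → j ≤ k → k ≤ n / 2 → n C j ≤ n C k
nCk-mono n {j} {k} j≤k k≤h with m≤n⇒m<n∨m≡n j≤k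
... | inj₂ refl = ≤-refl
... | inj₁ (s≤s {n = k'} j≤k') = ≤-trans (nCk-mono n j≤k' (<⇒≤ k≤h)) (nCk-step n k' k≤h)

nCk≤nC[n/2] : ∀ n k → n C k ≤ n C (n / 2)
nCk≤nC[n/2] n k with k ≤? n / 2
... | yes k≤h = nCk-mono n k≤h ≤-refl
... | no k≰h with k ≤? n
...   | no k≰n  = subst (_≤ n C (n / 2)) (sym (k>n⇒nCk≡0 (≰⇒> k≰n))) z≤n
...   | yes k≤n = subst (_≤ n C (n / 2)) (sym (nCk≡nC[n∸k] k≤n)) (nCk-mono n le ≤-refl)
  where
  le : n ∸ k ≤ n / 2
  le = ≤-trans (∸-mono (n≤1+2*[n/2] n) (≰⇒> k≰h))
         (≤-reflexive (trans (cong (λ m → n / 2 + m ∸ n / 2) (+-identityʳ (n / 2))) (m+n∸n≡m (n / 2) (n / 2))))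

-- The sets of the same size as A share the `n !` chains equally, and the middle level has the most
-- sets.
#through-lower : (A : Subset n) → n ! ≤ (n C (n / 2)) * #through A
#through-lower {n} A = begin
  n !                                         ≡⟨ nCk*k!*[n∸k]!≡n! (∣p∣≤n A) ⟨
  (n C ∣ A ∣) * (∣ A ∣ ! * (n ∸ ∣ A ∣) !)     ≡⟨ cong ((n C ∣ A ∣) *_) (#through-! A) ⟨
  (n C ∣ A ∣) * #through A                    ≤⟨ *-monoˡ-≤ (#through A) (nCk≤nC[n/2] n ∣ A ∣) ⟩
  (n C (n / 2)) * #through A                  ∎
  where open ≤-Reasoning

-- Binomial coefficients: small tails and flatness near the centre

∑C< : ℕ → ℕ → ℕ
∑C< n zero    = 0
∑C< n (suc j) = ∑C< n j + n C j

-- Put d = n - 2l. Below level l, consecutive coefficients grow by a factor of at least (l + d) / l,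
-- so the sum is dominated by a geometric series of total l / d.
∑C<-geometric : ∀ n l → 2 * l ≤ n → ∀ j → j ≤ l → (n ∸ 2 * l) * ∑C< n j ≤ l * (n C j)
∑C<-geometric n l _    zero    _   = ≤-trans (≤-reflexive (*-zeroʳ (n ∸ 2 * l))) z≤n
∑C<-geometric n l 2l≤n (suc j) j<l = begin
  d * (∑C< n j + n C j)              ≡⟨ *-distribˡ-+ d _ _ ⟩
  d * ∑C< n j + d * (n C j)          ≤⟨ +-monoˡ-≤ _ (∑C<-geometric n l 2l≤n j (<⇒≤ j<l)) ⟩
  l * (n C j) + d * (n C j)          ≡⟨ *-distribʳ-+ (n C j) l d ⟨
  (l + d) * (n C j)                  ≤⟨ *-monoˡ-≤ (n C j) l+d≤ ⟩
  (n ∸ j) * (n C j)                  ≡⟨ [1+k]*nC[1+k]≡[n∸k]*nCk n j ⟨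
  suc j * (n C suc j)                ≤⟨ *-monoˡ-≤ (n C suc j) j<l ⟩
  l * (n C suc j)                    ∎
  where
  open ≤-Reasoning
  d = n ∸ 2 * l
  l+d≤ : l + d ≤ n ∸ j
  l+d≤ = m+n≤o⇒m≤o∸n (l + d) (begin
    l + d + j     ≤⟨ +-monoʳ-≤ (l + d) (<⇒≤ j<l) ⟩
    l + d + l     ≡⟨ lemma l d ⟩
    d + 2 * l     ≡⟨ m∸n+n≡m 2l≤n ⟩
    n             ∎)
    where lemma : ∀ l d → l + d + l ≡ d + 2 * l
          lemma = solve-∀

∑C<-grow : ∀ n l m → l + m ≤ n / 2 → m * (n C l) ≤ ∑C< n (l + m)
∑C<-grow n l zero    _ = z≤n
∑C<-grow n l (suc m) l+m≤ rewrite +-suc l m = begin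
  n C l + m * (n C l)             ≡⟨ +-comm (n C l) _ ⟩
  m * (n C l) + n C l             ≤⟨ +-mono-≤ (∑C<-grow n l m (<⇒≤ l+m≤)) (nCk-mono n (m≤m+n l m) (<⇒≤ l+m≤)) ⟩
  ∑C< n (l + m) + n C (l + m)     ∎
  where open ≤-Reasoning

-- The geometric decay below level l bounds ∑C< n (h ∸ g) by c times the central coefficient
-- although it has g terms of size at least n C (h ∸ 2 * g), so that coefficient is small.
∑C<-tail : ∀ n g c e → 1 ≤ g → 2 * g ≤ n / 2 → n / 2 ≤ 2 * (c * g) → e * (c * c) ≤ g →
  e * ∑C< n (n / 2 ∸ 2 * g) ≤ n C (n / 2)
∑C<-tail n g c e 1≤g 2g≤h h≤2cg ecc≤g = *-cancelˡ-≤ g (begin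
  g * (e * S)                ≡⟨ l₁ g e S ⟩
  e * (g * S)                ≤⟨ *-monoʳ-≤ e (*-monoʳ-≤ g S≤) ⟩
  e * (g * (c * (n C lo)))   ≡⟨ l₂ e g c (n C lo) ⟩
  e * (c * (g * (n C lo)))   ≤⟨ *-monoʳ-≤ e (*-monoʳ-≤ c (≤-trans gC≤ S'≤)) ⟩
  e * (c * (c * M))          ≡⟨ l₃ e c M ⟩
  e * (c * c) * M            ≤⟨ *-monoˡ-≤ M ecc≤g ⟩
  g * M                      ∎)
  where
  open ≤-Reasoning
  h  = n / 2
  M  = n C h
  lo = h ∸ 2 * g
  lo' = lo + g
  S  = ∑C< n lo
  instance
    _ = >-nonZero 1≤g
    _ = >-nonZero (≤-trans 1≤g (m≤n*m g 2))
  l₁ : ∀ g e S → g * (e * S) ≡ e * (g * S)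
  l₁ = solve-∀
  l₂ : ∀ e g c x → e * (g * (c * x)) ≡ e * (c * (g * x))
  l₂ = solve-∀
  l₃ : ∀ e c x → e * (c * (c * x)) ≡ e * (c * c) * x
  l₃ = solve-∀
  lo+2g : lo + 2 * g ≡ h
  lo+2g = m∸n+n≡m 2g≤h
  lo'≤h : lo' ≤ h
  lo'≤h = ≤-trans (+-monoʳ-≤ lo (m≤n*m g 2)) (≤-reflexive lo+2g)
  gap : 2 * g + 2 * lo' ≤ n
  gap = begin
    2 * g + 2 * (lo + g)   ≡⟨ l g lo ⟩
    2 * (lo + 2 * g)       ≡⟨ cong (2 *_) lo+2g ⟩
    2 * h                  ≤⟨ 2*[n/2]≤n n ⟩
    n                      ∎
    where l : ∀ g x → 2 * g + 2 * (x + g) ≡ 2 * (x + 2 * g)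
          l = solve-∀
  -- Up to `lo'` the gap n - 2l is at least 2g, while l ≤ h ≤ 2cg; so the geometric series has total
  -- at most c.
  bound : ∀ l → l ≤ lo' → ∑C< n l ≤ c * (n C l)
  bound l l≤lo' = *-cancelˡ-≤ (2 * g) (begin
    2 * g * ∑C< n l               ≤⟨ *-monoˡ-≤ (∑C< n l) (m+n≤o⇒m≤o∸n (2 * g) gap') ⟩
    (n ∸ 2 * l) * ∑C< n l         ≤⟨ ∑C<-geometric n l (≤-trans (m≤n+m _ (2 * g)) gap') l ≤-refl ⟩
    l * (n C l)                   ≤⟨ *-monoˡ-≤ (n C l) (≤-trans l≤lo' (≤-trans lo'≤h h≤2cg)) ⟩
    2 * (c * g) * (n C l)         ≡⟨ k c g (n C l) ⟩
    2 * g * (c * (n C l))         ∎)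
    where
    gap' : 2 * g + 2 * l ≤ n
    gap' = ≤-trans (+-monoʳ-≤ (2 * g) (*-monoʳ-≤ 2 l≤lo')) gap
    k : ∀ c g x → 2 * (c * g) * x ≡ 2 * g * (c * x)
    k = solve-∀
  S≤ : S ≤ c * (n C lo)
  S≤ = bound lo (m≤m+n lo g)
  S'≤ : ∑C< n lo' ≤ c * M
  S'≤ = ≤-trans (bound lo' ≤-refl) (*-monoʳ-≤ c (nCk≤nC[n/2] n lo'))
  gC≤ : g * (n C lo) ≤ ∑C< n lo'
  gC≤ = ∑C<-grow n lo g lo'≤h

-- The ratio of the two coefficients is (n - h - j) / (h + j + 1), at least (h - j) / (h + j + 1).
-- Measured in units of 1 / h, the step loses at most j + (j + 1) central coefficients.
central-step : ∀ n j → let h = n / 2 in h * (n C (h + j)) ≤ h * (n C suc (h + j)) + (2 * j + 1) * (n C h)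
central-step n j = begin
  h * X                                   ≤⟨ *-monoˡ-≤ X (m≤n+m∸n h j) ⟩
  (j + (h ∸ j)) * X                       ≡⟨ *-distribʳ-+ X j (h ∸ j) ⟩
  j * X + (h ∸ j) * X                     ≤⟨ +-monoʳ-≤ (j * X) (*-monoˡ-≤ X le) ⟩
  j * X + (n ∸ (h + j)) * X               ≡⟨ cong (j * X +_) ([1+k]*nC[1+k]≡[n∸k]*nCk n (h + j)) ⟨
  j * X + suc (h + j) * Y                 ≡⟨ l₁ j X h Y ⟩
  h * Y + (j * X + suc j * Y)             ≤⟨ +-monoʳ-≤ (h * Y) (+-mono-≤ (*-monoʳ-≤ j (nCk≤nC[n/2] n (h + j))) (*-monoʳ-≤ (suc j) (nCk≤nC[n/2] n (suc (h + j))))) ⟩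
  h * Y + (j * (n C h) + suc j * (n C h)) ≡⟨ l₂ (h * Y) j (n C h) ⟩
  h * Y + (2 * j + 1) * (n C h)           ∎
  where
  open ≤-Reasoning
  h = n / 2
  X = n C (h + j)
  Y = n C suc (h + j)
  le : h ∸ j ≤ n ∸ (h + j)
  le = ≤-trans (∸-monoˡ-≤ j (m+n≤o⇒m≤o∸n h (subst (_≤ n) (cong (h +_) (+-identityʳ h)) (2*[n/2]≤n n))))
         (≤-reflexive (∸-+-assoc n h j))
  l₁ : ∀ j X h Y → j * X + suc (h + j) * Y ≡ h * Y + (j * X + suc j * Y)
  l₁ = solve-∀
  l₂ : ∀ a j M → a + (j * M + suc j * M) ≡ a + (2 * j + 1) * M
  l₂ = solve-∀

-- The losses 1, 3, 5, ... of the single steps add up to j².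
central-near : ∀ n j → let h = n / 2 in h * (n C h) ≤ h * (n C (h + j)) + j * j * (n C h)
central-near n zero = ≤-reflexive (trans (cong (λ k → h * (n C k)) (sym (+-identityʳ h))) (sym (+-identityʳ _)))
  where h = n / 2
central-near n (suc j) = begin
  h * M                                                       ≤⟨ central-near n j ⟩
  h * (n C (h + j)) + j * j * M                               ≤⟨ +-monoˡ-≤ (j * j * M) (central-step n j) ⟩
  h * (n C suc (h + j)) + (2 * j + 1) * M + j * j * M         ≡⟨ lemma (h * (n C suc (h + j))) j M ⟩
  h * (n C suc (h + j)) + suc j * suc j * M                   ≡⟨ cong (λ k → h * (n C k) + suc j * suc j * M) (+-suc h j) ⟨
  h * (n C (h + suc j)) + suc j * suc j * M                   ∎
  where
  open ≤-Reasoning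
  h = n / 2
  M = n C h
  lemma : ∀ a j M → a + (2 * j + 1) * M + j * j * M ≡ a + suc j * suc j * M
  lemma = solve-∀

central-flat : ∀ n q j → 1 ≤ n / 2 → q * (j * j) ≤ n / 2 →
  q * (n C (n / 2)) ≤ q * (n C (n / 2 + j)) + n C (n / 2)
central-flat n q j 1≤h qjj≤h = *-cancelˡ-≤ h (begin
  h * (q * M)                          ≡⟨ l₁ h q M ⟩
  q * (h * M)                          ≤⟨ *-monoʳ-≤ q (central-near n j) ⟩
  q * (h * X + j * j * M)              ≡⟨ l₂ q h X (j * j) M ⟩
  h * (q * X) + q * (j * j) * M        ≤⟨ +-monoʳ-≤ (h * (q * X)) (*-monoˡ-≤ M qjj≤h) ⟩
  h * (q * X) + h * M                  ≡⟨ *-distribˡ-+ h (q * X) M ⟨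
  h * (q * X + M)                      ∎)
  where
  open ≤-Reasoning
  h = n / 2
  M = n C h
  X = n C (h + j)
  instance _ = >-nonZero 1≤h
  l₁ : ∀ h q M → h * (q * M) ≡ q * (h * M)
  l₁ = solve-∀
  l₂ : ∀ q h X jj M → q * (h * X + jj * M) ≡ h * (q * X) + q * jj * M
  l₂ = solve-∀

-- Counting subsets by size

subsets : ∀ n → List (Subset n)
subsets zero    = [] ∷ []
subsets (suc n) = map (outside ∷_) (subsets n) ++ map (inside ∷_) (subsets n)

∈-subsets : (A : Subset n) → A ∈ˡ subsets n
∈-subsets []          = here refl
∈-subsets (false ∷ A) = ∈-++⁺ˡ (∈-map⁺ (outside ∷_) (∈-subsets A))
∈-subsets {suc n} (true ∷ A)  = ∈-++⁺ʳ (map (outside ∷_) (subsets n)) (∈-map⁺ (inside ∷_) (∈-subsets A))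

subsets-unique : ∀ n → Unique (subsets n)
subsets-unique zero    = [] ∷ []
subsets-unique (suc n) = Unique.++⁺ (Unique.map⁺ Vec.∷-injectiveʳ (subsets-unique n)) (Unique.map⁺ Vec.∷-injectiveʳ (subsets-unique n)) disjoint
  where
  disjoint : ∀ {A} → ¬ (A ∈ˡ map (outside ∷_) (subsets n) × A ∈ˡ map (inside ∷_) (subsets n))
  disjoint (p , q) with ∈-map⁻ (outside ∷_) p | ∈-map⁻ (inside ∷_) q
  ... | _ , _ , refl | _ , _ , ()

#size≡ : ∀ n k → ∑[ A ← subsets n ] ⟦ ∣ A ∣ ≟ k ⟧ ≡ n C k
#size≡ zero zero    = trans (∑-singleton []) (⟦⟧-yes (0 ≟ 0) refl)
#size≡ zero (suc k) = trans (∑-singleton []) (⟦⟧-no (0 ≟ suc k) (λ ()))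
#size≡ (suc n) k = trans (∑-++ (map (outside ∷_) (subsets n)) _ _)
  (trans (cong₂ _+_ (trans (∑-map (outside ∷_) (subsets n) _) (#size≡ n k)) (∑-map (inside ∷_) (subsets n) _)) (pascal k))
  where
  pascal : ∀ k → n C k + ∑[ A ← subsets n ] ⟦ suc ∣ A ∣ ≟ k ⟧ ≡ suc n C k
  pascal zero = cong₂ _+_ (refl {x = n C 0}) (∑-zero (subsets n) (λ {A} _ → ⟦⟧-no (suc ∣ A ∣ ≟ 0) (λ ())))
  pascal (suc k) = trans (cong (n C suc k +_) (trans (∑-cong (subsets n) (λ {A} _ →
                       ⟦⟧-cong (suc ∣ A ∣ ≟ suc k) (∣ A ∣ ≟ k) suc-injective (cong suc))) (#size≡ n k)))
                     (trans (+-comm (n C suc k) (n C k)) (nCk+nC[k+1]≡[n+1]C[k+1] n k))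

#size< : ∀ n j → ∑[ A ← subsets n ] ⟦ ∣ A ∣ <? j ⟧ ≡ ∑C< n j
#size< n zero    = ∑-zero (subsets n) (λ {A} _ → ⟦⟧-no (∣ A ∣ <? 0) (λ ()))
#size< n (suc j) = trans (∑-cong (subsets n) (λ {A} _ → split A))
  (trans (∑-+ (subsets n) _ _) (cong₂ _+_ (#size< n j) (#size≡ n j)))
  where
  split : ∀ A → ⟦ ∣ A ∣ <? suc j ⟧ ≡ ⟦ ∣ A ∣ <? j ⟧ + ⟦ ∣ A ∣ ≟ j ⟧
  split A with <-cmp ∣ A ∣ j
  ... | tri< a<j a≢j _ = trans (⟦⟧-yes (_ <? _) (m<n⇒m<1+n a<j)) (sym (cong₂ _+_ (⟦⟧-yes (_ <? _) a<j) (⟦⟧-no (_ ≟ _) a≢j)))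
  ... | tri≈ a≮j a≡j _ = trans (⟦⟧-yes (_ <? _) (s≤s (≤-reflexive a≡j))) (sym (cong₂ _+_ (⟦⟧-no (_ <? _) a≮j) (⟦⟧-yes (_ ≟ _) a≡j)))
  ... | tri> a≮j a≢j a>j = trans (⟦⟧-no (_ <? _) (≤⇒≯ a>j)) (sym (cong₂ _+_ (⟦⟧-no (_ <? _) a≮j) (⟦⟧-no (_ ≟ _) a≢j)))

#size> : ∀ n j → j ≤ n → ∑[ A ← subsets n ] ⟦ n ∸ j <? ∣ A ∣ ⟧ ≡ ∑C< n j
#size> n zero _ = ∑-zero (subsets n) (λ {A} _ → ⟦⟧-no (n <? ∣ A ∣) (≤⇒≯ (∣p∣≤n A)))
#size> n (suc j) j<n = trans (∑-cong (subsets n) (λ {A} _ → split A))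
  (trans (∑-+ (subsets n) _ _) (cong₂ _+_ (#size> n j (<⇒≤ j<n)) (trans (#size≡ n (n ∸ j)) (sym (nCk≡nC[n∸k] (<⇒≤ j<n))))))
  where
  e : suc (n ∸ suc j) ≡ n ∸ j
  e = sym (+-∸-assoc 1 j<n)
  split : ∀ A → ⟦ n ∸ suc j <? ∣ A ∣ ⟧ ≡ ⟦ n ∸ j <? ∣ A ∣ ⟧ + ⟦ ∣ A ∣ ≟ n ∸ j ⟧
  split A with <-cmp ∣ A ∣ (n ∸ j)
  ... | tri< a<k a≢k a≯k = trans (⟦⟧-no (_ <? _) (λ lt → <⇒≱ a<k (subst (_≤ ∣ A ∣) e lt))) (sym (cong₂ _+_ (⟦⟧-no (_ <? _) a≯k) (⟦⟧-no (_ ≟ _) a≢k)))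
  ... | tri≈ _ a≡k a≯k = trans (⟦⟧-yes (_ <? _) (≤-reflexive (trans e (sym a≡k)))) (sym (cong₂ _+_ (⟦⟧-no (_ <? _) a≯k) (⟦⟧-yes (_ ≟ _) a≡k)))
  ... | tri> _ a≢k a>k = trans (⟦⟧-yes (_ <? _) (subst (_≤ ∣ A ∣) (sym e) (<⇒≤ a>k))) (sym (cong₂ _+_ (⟦⟧-yes (_ <? _) a>k) (⟦⟧-no (_ ≟ _) a≢k)))

-- Windows

-- A list with at most one element: it is empty when xs has fewer than t entries.
prefix : ∀ t → List 𝒜 → List (Vec 𝒜 t)
prefix zero    xs       = [] ∷ []
prefix (suc t) []       = []
prefix (suc t) (x ∷ xs) = map (x ∷_) (prefix t xs)

windows : ∀ t → List 𝒜 → List (Vec 𝒜 t)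
windows t []       = []
windows t (x ∷ xs) = prefix t (x ∷ xs) ++ windows t xs

length-prefix : ∀ t (xs : List 𝒜) → t ≤ length xs → length (prefix t xs) ≡ 1
length-prefix zero    xs       _       = refl
length-prefix (suc t) (x ∷ xs) (s≤s p) = trans (length-map (x ∷_) (prefix t xs)) (length-prefix t xs p)

-- A list with X ≥ t entries has X - t windows of length t + 1; the additive t also covers shorter
-- lists, which have none.
length-windows : ∀ t (xs : List 𝒜) → length xs ≤ length (windows (suc t) xs) + t
length-windows t []       = z≤n
length-windows t (x ∷ xs) with t ≤? length xs
... | no t≰  = ≤-trans (≰⇒> t≰) (m≤n+m t _)
... | yes t≤ = ≤-trans (s≤s (length-windows t xs)) (≤-reflexive (cong (_+ t) (sym (trans
    (List.length-++ (prefix (suc t) (x ∷ xs))) (cong (_+ length (windows (suc t) xs)) (length-prefix (suc t) (x ∷ xs) (s≤s t≤)))))))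

∈-prefix : (xs : List 𝒜) {w : Vec 𝒜 t} → w ∈ˡ prefix t xs → ∀ i → lookup w i ∈ˡ xs
∈-prefix {t = suc t} (x ∷ xs) w∈ i with ∈-map⁻ (x ∷_) w∈
∈-prefix {t = suc t} (x ∷ xs) w∈ zero    | w , w∈' , refl = here refl
∈-prefix {t = suc t} (x ∷ xs) w∈ (suc i) | w , w∈' , refl = there (∈-prefix xs w∈' i)

∈-windows : (xs : List 𝒜) {w : Vec 𝒜 t} → w ∈ˡ windows t xs → ∀ i → lookup w i ∈ˡ xs
∈-windows {t = t} (x ∷ xs) w∈ i with ∈-++⁻ (prefix t (x ∷ xs)) w∈
... | inj₁ p = ∈-prefix (x ∷ xs) p i
... | inj₂ q = there (∈-windows xs q i)

prefix-ordered : {R : 𝒜 → 𝒜 → Set} {xs : List 𝒜} {w : Vec 𝒜 t} → AllPairs R xs → w ∈ˡ prefix t xs →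
  ∀ i j → toℕ i < toℕ j → R (lookup w i) (lookup w j)
prefix-ordered {t = suc t} {xs = x ∷ xs} (r ∷ rs) w∈ i j i<j with ∈-map⁻ (x ∷_) w∈
prefix-ordered {t = suc t} {xs = x ∷ xs} (r ∷ rs) w∈ zero    (suc j) i<j       | w , w∈' , refl = All.lookup r (∈-prefix xs w∈' j)
prefix-ordered {t = suc t} {xs = x ∷ xs} (r ∷ rs) w∈ (suc i) (suc j) (s≤s i<j) | w , w∈' , refl = prefix-ordered rs w∈' i j i<j

windows-ordered : {R : 𝒜 → 𝒜 → Set} {xs : List 𝒜} {w : Vec 𝒜 t} → AllPairs R xs → w ∈ˡ windows t xs →
  ∀ i j → toℕ i < toℕ j → R (lookup w i) (lookup w j)
windows-ordered {t = t} {xs = x ∷ xs} (r ∷ rs) w∈ with ∈-++⁻ (prefix t (x ∷ xs)) w∈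
... | inj₁ p = prefix-ordered (r ∷ rs) p
... | inj₂ q = windows-ordered rs q

∑-drop≤ : ∀ k (xs : List 𝒜) (f : 𝒜 → ℕ) → ∑ (List.drop k xs) f ≤ ∑ xs f
∑-drop≤ k xs f = ≤-trans (m≤n+m _ (∑ (List.take k xs) f))
  (≤-reflexive (trans (sym (∑-++ (List.take k xs) (List.drop k xs) f)) (cong (λ ys → ∑ ys f) (List.take++drop≡id k xs))))

-- The window in `prefix t xs`, if there is one, has the head of `drop r xs` as its r-th member.
-- Adding the rest of that list on the left makes the bounds for all suffixes telescope.
∑-prefix : (xs : List 𝒜) (f : 𝒜 → ℕ) (r : Fin t) →
  ∑[ w ← prefix t xs ] f (lookup w r) + ∑ (List.drop (suc (toℕ r)) xs) f ≤ ∑ (List.drop (toℕ r) xs) f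
∑-prefix {t = suc t} [] f zero    = ≤-reflexive (trans (cong (_+ ∑ [] f) (∑-zero [] λ ())) refl)
∑-prefix {t = suc t} [] f (suc r) = ≤-reflexive (trans (cong (_+ ∑ [] f) (∑-zero [] λ ())) refl)
∑-prefix {t = suc t} (x ∷ xs) f zero = begin
  ∑[ w ← map (x ∷_) (prefix t xs) ] f (lookup w zero) + ∑ xs f
    ≡⟨ cong (_+ ∑ xs f) (trans (∑-map (x ∷_) (prefix t xs) (λ w → f (lookup w zero))) (∑-const (prefix t xs) (f x))) ⟩
  length (prefix t xs) * f x + ∑ xs f   ≤⟨ +-monoˡ-≤ (∑ xs f) (*-monoˡ-≤ (f x) (length-prefix≤1 t xs)) ⟩
  1 * f x + ∑ xs f                      ≡⟨ cong (_+ ∑ xs f) (*-identityˡ (f x)) ⟩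
  f x + ∑ xs f                          ≡⟨ ∑-∷ x xs f ⟨
  ∑ (x ∷ xs) f                          ∎
  where
  open ≤-Reasoning
  length-prefix≤1 : ∀ t (xs : List 𝒜) → length (prefix t xs) ≤ 1
  length-prefix≤1 zero    xs       = ≤-refl
  length-prefix≤1 (suc t) []       = z≤n
  length-prefix≤1 (suc t) (x ∷ xs) = ≤-trans (≤-reflexive (length-map (x ∷_) (prefix t xs))) (length-prefix≤1 t xs)
∑-prefix {t = suc t} (x ∷ xs) f (suc r) = ≤-trans
  (≤-reflexive (cong (_+ ∑ (List.drop (suc (toℕ r)) xs) f) (∑-map (x ∷_) (prefix t xs) (λ w → f (lookup w (suc r))))))
  (∑-prefix xs f r)

-- Two windows have different r-th members.
∑-windows : (xs : List 𝒜) (f : 𝒜 → ℕ) (r : Fin t) → ∑[ w ← windows t xs ] f (lookup w r) ≤ ∑ xs f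
∑-windows {t = t} xs f r = ≤-trans (go xs) (∑-drop≤ (toℕ r) xs f)
  where
  open ≤-Reasoning
  go : ∀ xs → ∑[ w ← windows t xs ] f (lookup w r) ≤ ∑ (List.drop (toℕ r) xs) f
  go []       = ≤-trans (≤-reflexive (∑-zero [] λ ())) z≤n
  go (x ∷ xs) = begin
    ∑[ w ← prefix t (x ∷ xs) ++ windows t xs ] f (lookup w r)
      ≡⟨ ∑-++ (prefix t (x ∷ xs)) (windows t xs) _ ⟩
    ∑[ w ← prefix t (x ∷ xs) ] f (lookup w r) + ∑[ w ← windows t xs ] f (lookup w r)
      ≤⟨ +-monoʳ-≤ _ (go xs) ⟩
    ∑[ w ← prefix t (x ∷ xs) ] f (lookup w r) + ∑ (List.drop (toℕ r) xs) f
      ≤⟨ ∑-prefix (x ∷ xs) f r ⟩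
    ∑ (List.drop (toℕ r) (x ∷ xs)) f ∎

-- Merging colours into t classes

-- The method of conditional expectations: when the classes of the colours < j have been
-- chosen by π, the weight is t ^ t times the probability that all constraints
-- (colour , class) hold when the remaining colours are put into random classes.
module _ (t : ℕ) (0<t : 0 < t) where

  -- t times the conditional probability of a constraint: a decided colour meets it with probability
  -- 1 or 0, an undecided one with probability 1 / t.
  factor : ℕ → (ℕ → Fin t) → ℕ × Fin t → ℕ
  factor j π (c , q) with c <? j
  ... | yes _ = t * ⟦ π c Fin.≟ q ⟧
  ... | no _  = 1

  weight : ℕ → (ℕ → Fin t) → List (ℕ × Fin t) → ℕ
  weight j π []       = 1
  weight j π (e ∷ es) = factor j π e * weight j π es

  _[_≔_] : (ℕ → Fin t) → ℕ → Fin t → ℕ → Fin t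
  (π [ j ≔ p ]) c with c ≟ j
  ... | yes _ = p
  ... | no _  = π c

  update-≡ : ∀ π j p → (π [ j ≔ p ]) j ≡ p
  update-≡ π j p with j ≟ j
  ... | yes _  = refl
  ... | no j≢j = contradiction refl j≢j

  update-≢ : ∀ π j p {c} → c ≢ j → (π [ j ≔ p ]) c ≡ π c
  update-≢ π j p {c} c≢j with c ≟ j
  ... | yes c≡j = contradiction c≡j c≢j
  ... | no _    = refl

  factor-≢ : ∀ π j p c q → c ≢ j → factor (suc j) (π [ j ≔ p ]) (c , q) ≡ factor j π (c , q)
  factor-≢ π j p c q c≢j with c <? suc j | c <? j
  ... | yes _     | yes _   = cong (λ b → t * ⟦ b Fin.≟ q ⟧) (update-≢ π j p c≢j)
  ... | no _      | no _    = refl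
  ... | yes c<1+j | no c≮j  = contradiction (≤∧≢⇒< (s≤s⁻¹ c<1+j) c≢j) c≮j
  ... | no c≮1+j  | yes c<j = contradiction (m<n⇒m<1+n c<j) c≮1+j

  factor-≡-new : ∀ π j p q → factor (suc j) (π [ j ≔ p ]) (j , q) ≡ t * ⟦ p Fin.≟ q ⟧
  factor-≡-new π j p q with j <? suc j
  ... | yes _    = cong (λ b → t * ⟦ b Fin.≟ q ⟧) (update-≡ π j p)
  ... | no j≮1+j = contradiction (n<1+n j) j≮1+j

  factor-≡-old : ∀ π j q → factor j π (j , q) ≡ 1
  factor-≡-old π j q with j <? j
  ... | yes j<j = contradiction j<j (n≮n j)
  ... | no _    = refl

  weight-∉ : ∀ π j p es → j ∉ˡ map proj₁ es → weight (suc j) (π [ j ≔ p ]) es ≡ weight j π es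
  weight-∉ π j p []             j∉ = refl
  weight-∉ π j p ((c , q) ∷ es) j∉ =
    cong₂ _*_ (factor-≢ π j p c q (λ c≡j → j∉ (here (sym c≡j)))) (weight-∉ π j p es (j∉ ∘ there))

  -- Only a constraint on colour j changes when j gets its class, and by uniqueness there is at most
  -- one. Just one of the t classes satisfies it, turning its factor from 1 into t, so the average
  -- is unchanged.
  weight-average : ∀ π j es → Unique (map proj₁ es) →
    ∑[ p ← allFin t ] weight (suc j) (π [ j ≔ p ]) es ≡ t * weight j π es
  weight-average π j [] _ = trans (∑-const (allFin t) 1) (cong (_* 1) (List.length-tabulate {n = t} id))
  weight-average π j ((c , q) ∷ es) (c∉ ∷ u) with c ≟ j
  ... | yes refl = begin
    ∑[ p ← allFin t ] (factor (suc j) (π [ j ≔ p ]) (j , q) * weight (suc j) (π [ j ≔ p ]) es)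
      ≡⟨ ∑-cong (allFin t) (λ {p} _ → trans (cong₂ _*_ (factor-≡-new π j p q) (weight-∉ π j p es (λ j∈ → All.lookup c∉ j∈ refl)))
                                            (lemma t _ _)) ⟩
    ∑[ p ← allFin t ] (⟦ p Fin.≟ q ⟧ * (t * W))   ≡⟨ ∑-*ʳ (allFin t) (t * W) _ ⟩
    ∑[ p ← allFin t ] ⟦ p Fin.≟ q ⟧ * (t * W)     ≡⟨ cong (_* (t * W)) (trans (∑-cong (allFin t) (λ {p} _ → ⟦⟧-cong (p Fin.≟ q) (q Fin.≟ p) sym sym))
                                                     (trans (∑-≡-unique Fin._≟_ (Unique.allFin⁺ t) q) (⟦⟧-yes _ (∈-allFin q)))) ⟩
    1 * (t * W)                                   ≡⟨ *-identityˡ (t * W) ⟩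
    t * W                                         ≡⟨ cong (t *_) (trans (cong (_* W) (factor-≡-old π j q)) (*-identityˡ W)) ⟨
    t * (factor j π (j , q) * W)                  ∎
    where
    open ≡-Reasoning
    W = weight j π es
    lemma : ∀ t i w → t * i * w ≡ i * (t * w)
    lemma = solve-∀
  ... | no c≢j = begin
    ∑[ p ← allFin t ] (factor (suc j) (π [ j ≔ p ]) (c , q) * weight (suc j) (π [ j ≔ p ]) es)
      ≡⟨ ∑-cong (allFin t) (λ {p} _ → cong (_* weight (suc j) (π [ j ≔ p ]) es) (factor-≢ π j p c q c≢j)) ⟩
    ∑[ p ← allFin t ] (φ * weight (suc j) (π [ j ≔ p ]) es)   ≡⟨ ∑-*ˡ (allFin t) φ _ ⟩
    φ * (∑[ p ← allFin t ] weight (suc j) (π [ j ≔ p ]) es)   ≡⟨ cong (φ *_) (weight-average π j es u) ⟩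
    φ * (t * weight j π es)                                   ≡⟨ lemma φ t _ ⟩
    t * (φ * weight j π es)                                   ∎
    where
    open ≡-Reasoning
    φ = factor j π (c , q)
    lemma : ∀ x y z → x * (y * z) ≡ y * (x * z)
    lemma = solve-∀

  weight-pos : ∀ m π es → All (λ e → proj₁ e < m) es → 0 < weight m π es → All (λ (c , q) → π c ≡ q) es
  weight-pos m π [] _ _ = []
  weight-pos m π ((c , q) ∷ es) (c<m ∷ es<m) pos with c <? m
  ... | no c≮m = contradiction c<m c≮m
  ... | yes _  = ⟦⟧-pos (π c Fin.≟ q) (n≢0⇒n>0 (λ z → n≮0 (subst (0 <_) (trans (cong (_* W) (trans (cong (t *_) z) (*-zeroʳ t))) refl) pos)))
               ∷ weight-pos m π es es<m (n≢0⇒n>0 (λ z → n≮0 (subst (0 <_) (trans (cong (t * ⟦ π c Fin.≟ q ⟧ *_) z) (*-zeroʳ (t * ⟦ π c Fin.≟ q ⟧))) pos)))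
    where W = weight m π es

  factor≤t : ∀ j π e → factor j π e ≤ t
  factor≤t j π (c , q) with c <? j
  ... | yes _ = ≤-trans (*-monoʳ-≤ t (⟦⟧≤1 (π c Fin.≟ q))) (≤-reflexive (*-identityʳ t))
  ... | no _  = 0<t

  weight≤t^ : ∀ j π es → weight j π es ≤ t ^ length es
  weight≤t^ j π []       = ≤-refl
  weight≤t^ j π (e ∷ es) = *-mono-≤ (factor≤t j π e) (weight≤t^ j π es)

  weight-zero : ∀ π es → weight 0 π es ≡ 1
  weight-zero π []             = refl
  weight-zero π ((c , q) ∷ es) with c <? 0
  ... | no _ = trans (*-identityˡ _) (weight-zero π es)

  -- At the start every weight is 1. Since weights keep their average, each further colour can be
  -- given a class that does not lower the total.
  good-classes : (xs : List 𝒳) (con : 𝒳 → List (ℕ × Fin t)) → (∀ {x} → x ∈ˡ xs → Unique (map proj₁ (con x))) →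
    ∀ m → ∃[ π ] length xs ≤ ∑[ x ← xs ] weight m π (con x)
  good-classes xs con u zero = (λ _ → Fin.fromℕ< 0<t) ,
    ≤-reflexive (sym (trans (∑-cong xs (λ {x} _ → weight-zero _ (con x))) (∑-length xs)))
  good-classes xs con u (suc m) with good-classes xs con u m
  ... | π , le = π [ m ≔ proj₁ best ] , proj₂ (proj₂ best)
    where
    open ≤-Reasoning
    best : ∃[ p ] (p ∈ˡ allFin t × length xs ≤ ∑[ x ← xs ] weight (suc m) (π [ m ≔ p ]) (con x))
    best = ∑-pigeon (allFin t) (λ _ → length xs) _ (begin
      ∑[ _ ← allFin t ] length xs                    ≡⟨ trans (∑-const (allFin t) (length xs)) (cong (_* length xs) (List.length-tabulate {n = t} id)) ⟩
      t * length xs                                  ≤⟨ *-monoʳ-≤ t le ⟩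
      t * (∑[ x ← xs ] weight m π (con x))           ≡⟨ ∑-*ˡ xs t _ ⟨
      ∑[ x ← xs ] (t * weight m π (con x))           ≡⟨ ∑-cong xs (λ {x} x∈ → weight-average π m (con x) (u x∈)) ⟨
      ∑[ x ← xs ] ∑[ p ← allFin t ] weight (suc m) (π [ m ≔ p ]) (con x)   ≡⟨ ∑-swap xs (allFin t) _ ⟩
      ∑[ p ← allFin t ] ∑[ x ← xs ] weight (suc m) (π [ m ≔ p ]) (con x)   ∎)
      (subst (0 <_) (sym (List.length-tabulate {n = t} id)) 0<t)

  -- Once all colours are decided, a weight is at most t ^ t and is positive only if all constraints
  -- of x hold.
  classes : (xs : List 𝒳) (col : 𝒳 → Fin t → ℕ) (m : ℕ) →
    (∀ {x} → x ∈ˡ xs → ∀ i j → col x i ≡ col x j → i ≡ j) → (∀ {x} → x ∈ˡ xs → ∀ i → col x i < m) →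
    ∃[ π ] length xs ≤ t ^ t * (∑[ x ← xs ] ⟦ Fin.all? (λ i → π (col x i) Fin.≟ i) ⟧)
  classes {𝒳 = 𝒳} xs col m inj col<m =
    proj₁ merge , ≤-trans (proj₂ merge) (≤-trans (∑-mono xs bound) (≤-reflexive (∑-*ˡ xs (t ^ t) _)))
    where
    con : 𝒳 → List (ℕ × Fin t)
    con x = map (λ i → col x i , i) (allFin t)
    unique : ∀ {x} → x ∈ˡ xs → Unique (map proj₁ (con x))
    unique {x} x∈ = subst Unique (List.map-∘ (allFin t)) (Unique.map⁺ (λ {i} {j} → inj x∈ i j) (Unique.allFin⁺ t))
    merge = good-classes xs con unique m
    π = proj₁ merge
    bound : ∀ {x} → x ∈ˡ xs → weight m π (con x) ≤ t ^ t * ⟦ Fin.all? (λ i → π (col x i) Fin.≟ i) ⟧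
    bound {x} x∈ with weight m π (con x) in eq
    ... | zero  = z≤n
    ... | suc w = begin
      suc w                ≡⟨ eq ⟨
      weight m π (con x)   ≤⟨ weight≤t^ m π (con x) ⟩
      t ^ length (con x)   ≡⟨ cong (t ^_) (trans (length-map _ (allFin t)) (List.length-tabulate {n = t} id)) ⟩
      t ^ t                ≡⟨ *-identityʳ (t ^ t) ⟨
      t ^ t * 1            ≡⟨ cong (t ^ t *_) (⟦⟧-yes (Fin.all? (λ i → π (col x i) Fin.≟ i)) sat) ⟨
      t ^ t * ⟦ Fin.all? (λ i → π (col x i) Fin.≟ i) ⟧ ∎
      where
      open ≤-Reasoning
      bounded : All (λ e → proj₁ e < m) (con x)
      bounded = All.tabulate (λ e∈ → let (i , _ , e) = ∈-map⁻ (λ i → col x i , i) e∈ in subst (λ e → proj₁ e < m) (sym e) (col<m x∈ i))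
      sat : ∀ i → π (col x i) ≡ i
      sat i = All.lookup (weight-pos m π (con x) bounded (subst (0 <_) (sym eq) (s≤s z≤n))) (∈-map⁺ (λ i → col x i , i) (∈-allFin i))

-- Obstacles to attaching a leaf

⊈-witness : {A W : Subset n} → ¬ (W ⊆ A) → ∃[ x ] (x ∈ W × x ∉ A)
⊈-witness {A = A} {W} W⊈A with Fin.any? (λ x → (x ∈? W) ×-dec ¬? (x ∈? A))
... | yes w = w
... | no ¬w = contradiction (λ {x} x∈W → decidable-stable (x ∈? A) (λ x∉A → ¬w (x , x∈W , x∉A))) W⊈A

#diff : (A W : Subset n) → A ⊆ W → ∑[ x ← allFin n ] ⟦ (x ∈? W) ×-dec ¬? (x ∈? A) ⟧ + ∣ A ∣ ≡ ∣ W ∣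
#diff [] [] _ = trans (+-identityʳ _) (∑-zero (allFin 0) λ ())
#diff {suc n} (a ∷ A) (b ∷ W) A⊆W = trans (cong (_+ ∣ a ∷ A ∣) (trans (∑-allFin-suc n _) (cong (⟦ (zero ∈? (b ∷ W)) ×-dec ¬? (zero ∈? (a ∷ A)) ⟧ +_)
    (∑-cong (allFin n) (λ {x} _ → ⟦⟧-cong ((suc x ∈? (b ∷ W)) ×-dec ¬? (suc x ∈? (a ∷ A))) ((x ∈? W) ×-dec ¬? (x ∈? A))
      (λ { (Vec.there p , q) → p , q ∘ Vec.there }) (λ { (p , q) → Vec.there p , λ { (Vec.there r) → q r } }))))))
  (head a b A⊆W)
  where
  IH : ∑[ x ← allFin n ] ⟦ (x ∈? W) ×-dec ¬? (x ∈? A) ⟧ + ∣ A ∣ ≡ ∣ W ∣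
  IH = #diff A W (Sub.drop-∷-⊆ A⊆W)
  S = ∑[ x ← allFin n ] ⟦ (x ∈? W) ×-dec ¬? (x ∈? A) ⟧
  head : ∀ a b → a ∷ A ⊆ b ∷ W → ⟦ (zero ∈? (b ∷ W)) ×-dec ¬? (zero ∈? (a ∷ A)) ⟧ + S + ∣ a ∷ A ∣ ≡ ∣ b ∷ W ∣
  head true  false A⊆W = contradiction (A⊆W Vec.here) λ ()
  head false false A⊆W = trans (cong (λ z → z + S + ∣ A ∣) (⟦⟧-no ((zero ∈? (false ∷ W)) ×-dec ¬? (zero ∈? (false ∷ A))) (λ ()))) IH
  head false true  A⊆W = trans (cong (λ z → z + S + ∣ A ∣) (⟦⟧-yes ((zero ∈? (true ∷ W)) ×-dec ¬? (zero ∈? (false ∷ A))) (Vec.here , λ ()))) (cong suc IH)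
  head true  true  A⊆W = trans (cong (λ z → z + S + suc ∣ A ∣) (⟦⟧-no ((zero ∈? (true ∷ W)) ×-dec ¬? (zero ∈? (true ∷ A))) (λ (_ , q) → q Vec.here)))
                           (trans (+-suc S ∣ A ∣) (cong suc IH))

-- Let B be a later member of a chain c through A, at level at most hi. Unless W clashes,
-- W ⊆ B implies W ⊆ A, and B ⊆ W is impossible. Dually for earlier members at level ≥ lo.
Clash↑ Clash↓ : ℕ → Subset n → Subset n → Chain n → Set
Clash↑ hi A W c = (¬ (W ⊆ A) × W ⊆ lvl c hi) ⊎ (A ⊆ W × lvl c (suc ∣ A ∣) ⊆ W)
Clash↓ lo A W c = (¬ (A ⊆ W) × lvl c lo ⊆ W) ⊎ (W ⊆ A × W ⊆ lvl c (pred ∣ A ∣))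

clash↑? : ∀ hi (A W : Subset n) c → Dec (Clash↑ hi A W c)
clash↑? hi A W c = (¬? (W ⊆? A) ×-dec (W ⊆? lvl c hi)) ⊎-dec ((A ⊆? W) ×-dec (lvl c (suc ∣ A ∣) ⊆? W))

clash↓? : ∀ lo (A W : Subset n) c → Dec (Clash↓ lo A W c)
clash↓? lo A W c = (¬? (A ⊆? W) ×-dec (lvl c lo ⊆? W)) ⊎-dec ((W ⊆? A) ×-dec (W ⊆? lvl c (pred ∣ A ∣)))

∑-⊎ : ∀ {X : Set} (xs : List X) (u : X → ℕ) {P Q : X → Set} (P? : ∀ x → Dec (P x)) (Q? : ∀ x → Dec (Q x)) →
  ∑[ x ← xs ] (u x * ⟦ P? x ⊎-dec Q? x ⟧) ≤ ∑[ x ← xs ] (u x * ⟦ P? x ⟧) + ∑[ x ← xs ] (u x * ⟦ Q? x ⟧)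
∑-⊎ xs u P? Q? = ≤-trans (∑-mono xs (λ {x} _ → ≤-trans (*-monoʳ-≤ (u x) (⟦⟧-⊎ (P? x ⊎-dec Q? x) (P? x) (Q? x) id))
                   (≤-reflexive (*-distribˡ-+ (u x) _ _)))) (≤-reflexive (∑-+ xs _ _))

through*-mono : (A : Subset n) (c : Chain n) {x y : ℕ} → (lvl c ∣ A ∣ ≡ A → x ≤ y) → through A c * x ≤ through A c * y
through*-mono A c h with lvl c ∣ A ∣ ≟ˢ A
... | yes e = *-monoʳ-≤ ⟦ yes e ⟧ (h e)
... | no ¬e = ≤-trans (≤-reflexive (cong (_* _) (⟦⟧-no (no ¬e) ¬e))) z≤n

module _ {n : ℕ} (A W : Subset n) where

  private
    -- Union bound, given that the chain passes through A: E forces `R x` for one of at most e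
    -- points x with `P x`, and each such `R x` has probability at most 1 / d.
    union : (d e : ℕ) {P : Fin n → Set} (P? : ∀ x → Dec (P x)) (E : Chain n → ℕ) {R : Fin n → Chain n → Set} (R? : ∀ x c → Dec (R x c)) →
      (∀ x → P x → d * (∑[ c ← chains n ] (through A c * ⟦ R? x c ⟧)) ≤ #through A) →
      (∑[ x ← allFin n ] ⟦ P? x ⟧ ≤ e) →
      (∀ c → lvl c ∣ A ∣ ≡ A → 0 < E c → E c ≤ 1 × ∃[ x ] (P x × R x c)) →
      d * (∑[ c ← chains n ] (through A c * E c)) ≤ e * #through A
    union d e P? E R? hit count cover = begin
      d * (∑[ c ← chains n ] (through A c * E c))
        ≤⟨ *-monoʳ-≤ d (∑-mono (chains n) (λ {c} _ → through*-mono A c (pointwise c))) ⟩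
      d * (∑[ c ← chains n ] (through A c * (∑[ x ← allFin n ] (⟦ P? x ⟧ * ⟦ R? x c ⟧))))
        ≡⟨ cong (d *_) (trans (∑-cong (chains n) (λ {c} _ → sym (∑-*ˡ (allFin n) (through A c) _))) (∑-swap (chains n) (allFin n) _)) ⟩
      d * (∑[ x ← allFin n ] ∑[ c ← chains n ] (through A c * (⟦ P? x ⟧ * ⟦ R? x c ⟧)))
        ≡⟨ cong (d *_) (∑-cong (allFin n) (λ {x} _ → trans (∑-cong (chains n) (λ {c} _ → xyz (through A c) ⟦ P? x ⟧ ⟦ R? x c ⟧)) (∑-*ˡ (chains n) ⟦ P? x ⟧ _))) ⟩
      d * (∑[ x ← allFin n ] (⟦ P? x ⟧ * (∑[ c ← chains n ] (through A c * ⟦ R? x c ⟧))))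
        ≡⟨ ∑-*ˡ (allFin n) d _ ⟨
      ∑[ x ← allFin n ] (d * (⟦ P? x ⟧ * (∑[ c ← chains n ] (through A c * ⟦ R? x c ⟧))))
        ≤⟨ ∑-mono (allFin n) (λ {x} _ → hitting x) ⟩
      ∑[ x ← allFin n ] (⟦ P? x ⟧ * #through A)
        ≡⟨ ∑-*ʳ (allFin n) (#through A) _ ⟩
      ∑[ x ← allFin n ] ⟦ P? x ⟧ * #through A
        ≤⟨ *-monoˡ-≤ (#through A) count ⟩
      e * #through A ∎
      where
      open ≤-Reasoning
      xyz : ∀ x y z → x * (y * z) ≡ y * (x * z)
      xyz = solve-∀
      pointwise : ∀ c → lvl c ∣ A ∣ ≡ A → E c ≤ ∑[ x ← allFin n ] (⟦ P? x ⟧ * ⟦ R? x c ⟧)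
      pointwise c thr with 0 <? E c
      ... | no ¬0<  = ≤-trans (≮⇒≥ ¬0<) z≤n
      ... | yes 0<E with cover c thr 0<E
      ...   | E≤1 , x , p , r = ≤-trans E≤1 (≤-trans (≤-reflexive (sym (cong₂ _*_ (⟦⟧-yes (P? x) p) (⟦⟧-yes (R? x c) r))))
                                  (∑-∈ (allFin n) (λ x → ⟦ P? x ⟧ * ⟦ R? x c ⟧) (∈-allFin x)))
      hitting : ∀ x → d * (⟦ P? x ⟧ * (∑[ c ← chains n ] (through A c * ⟦ R? x c ⟧))) ≤ ⟦ P? x ⟧ * #through A
      hitting x with P? x
      ... | yes p = begin
        d * (⟦ yes p ⟧ * S)      ≡⟨ xyz d ⟦ yes p ⟧ S ⟩
        ⟦ yes p ⟧ * (d * S)      ≤⟨ *-monoʳ-≤ ⟦ yes p ⟧ (hit x p) ⟩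
        ⟦ yes p ⟧ * #through A   ∎
        where S = ∑[ c ← chains n ] (through A c * ⟦ R? x c ⟧)
      ... | no ¬p = ≤-trans (≤-reflexive (trans (cong (λ z → d * (z * S)) (⟦⟧-no (no ¬p) ¬p)) (*-zeroʳ d))) z≤n
        where S = ∑[ c ← chains n ] (through A c * ⟦ R? x c ⟧)

  module _ {hi : ℕ} (a≤hi : ∣ A ∣ ≤ hi) (w≤hi : ∣ W ∣ ≤ hi) (hi<n : hi < n) where

    -- Each part of a clash has probability at most (hi - ∣A∣) / (n - ∣A∣). In the first, level hi
    -- contains a fixed point of W outside A. In the second, the point added next to A is one of the
    -- at most hi - ∣A∣ points of W outside A.
    #clash↑ : (n ∸ ∣ A ∣) * (∑[ c ← chains n ] (through A c * ⟦ clash↑? hi A W c ⟧)) ≤ 2 * ((hi ∸ ∣ A ∣) * #through A)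
    #clash↑ = begin
      (n ∸ ∣ A ∣) * (∑[ c ← chains n ] (through A c * ⟦ clash↑? hi A W c ⟧))
        ≤⟨ *-monoʳ-≤ (n ∸ ∣ A ∣) (∑-⊎ (chains n) (through A) E₁ E₂) ⟩
      (n ∸ ∣ A ∣) * (∑[ c ← chains n ] (through A c * ⟦ E₁ c ⟧) + ∑[ c ← chains n ] (through A c * ⟦ E₂ c ⟧))
        ≡⟨ *-distribˡ-+ (n ∸ ∣ A ∣) _ _ ⟩
      (n ∸ ∣ A ∣) * (∑[ c ← chains n ] (through A c * ⟦ E₁ c ⟧)) + (n ∸ ∣ A ∣) * (∑[ c ← chains n ] (through A c * ⟦ E₂ c ⟧))
        ≤⟨ +-mono-≤ part₁ part₂ ⟩
      (hi ∸ ∣ A ∣) * #through A + (hi ∸ ∣ A ∣) * #through A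
        ≡⟨ cong ((hi ∸ ∣ A ∣) * #through A +_) (+-identityʳ _) ⟨
      2 * ((hi ∸ ∣ A ∣) * #through A) ∎
      where
      open ≤-Reasoning
      E₁ : ∀ c → Dec (¬ (W ⊆ A) × W ⊆ lvl c hi)
      E₁ c = ¬? (W ⊆? A) ×-dec (W ⊆? lvl c hi)
      E₂ : ∀ c → Dec (A ⊆ W × lvl c (suc ∣ A ∣) ⊆ W)
      E₂ c = (A ⊆? W) ×-dec (lvl c (suc ∣ A ∣) ⊆? W)
      part₁ : (n ∸ ∣ A ∣) * (∑[ c ← chains n ] (through A c * ⟦ E₁ c ⟧)) ≤ (hi ∸ ∣ A ∣) * #through A
      part₁ = go (W ⊆? A)
        where
        go : Dec (W ⊆ A) → (n ∸ ∣ A ∣) * (∑[ c ← chains n ] (through A c * ⟦ E₁ c ⟧)) ≤ (hi ∸ ∣ A ∣) * #through A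
        go (yes W⊆A) = ≤-trans (≤-reflexive (trans (cong ((n ∸ ∣ A ∣) *_) (∑-zero (chains n) (λ {c} _ →
                        trans (cong (through A c *_) (⟦⟧-no (E₁ c) (λ (p , _) → p W⊆A))) (*-zeroʳ (through A c)))))
                        (*-zeroʳ (n ∸ ∣ A ∣)))) z≤n
        go (no W⊈A) = let (x , x∈W , x∉A) = ⊈-witness {A = A} {W = W} W⊈A in ≤-trans
                       (*-monoʳ-≤ (n ∸ ∣ A ∣) (∑-mono (chains n) (λ {c} _ → *-monoʳ-≤ (through A c)
                         (⟦⟧-mono (E₁ c) (x ∈? lvl c hi) (λ (_ , W⊆) → W⊆ x∈W)))))
                       (≤-reflexive (#hit-∉ A x x∉A a≤hi (<⇒≤ hi<n)))
      part₂ : (n ∸ ∣ A ∣) * (∑[ c ← chains n ] (through A c * ⟦ E₂ c ⟧)) ≤ (hi ∸ ∣ A ∣) * #through A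
      part₂ = go (A ⊆? W)
        where
        a<n = ≤-<-trans a≤hi hi<n
        cover : ∀ c → lvl c (suc ∣ A ∣) ⊆ W → ∃[ x ] ((x ∈ W × x ∉ A) × x ∈ lvl c (suc ∣ A ∣))
        cover c sub with ⊈-witness {A = A} {W = lvl c (suc ∣ A ∣)} (λ s → <⇒≱ (n<1+n ∣ A ∣) (subst (_≤ ∣ A ∣) (lvl-size c a<n) (p⊆q⇒∣p∣≤∣q∣ s)))
        ... | x , x∈lvl , x∉A = x , (sub x∈lvl , x∉A) , x∈lvl
        go : Dec (A ⊆ W) → (n ∸ ∣ A ∣) * (∑[ c ← chains n ] (through A c * ⟦ E₂ c ⟧)) ≤ (hi ∸ ∣ A ∣) * #through A
        go (no A⊈W) = ≤-trans (≤-reflexive (trans (cong ((n ∸ ∣ A ∣) *_) (∑-zero (chains n) (λ {c} _ →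
                        trans (cong (through A c *_) (⟦⟧-no (E₂ c) (λ (p , _) → A⊈W p))) (*-zeroʳ (through A c)))))
                        (*-zeroʳ (n ∸ ∣ A ∣)))) z≤n
        go (yes A⊆W) = ≤-trans (union (n ∸ ∣ A ∣) (∣ W ∣ ∸ ∣ A ∣) (λ x → (x ∈? W) ×-dec ¬? (x ∈? A))
             (λ c → ⟦ E₂ c ⟧) (λ x c → x ∈? lvl c (suc ∣ A ∣))
             (λ x (x∈W , x∉A) → ≤-reflexive (trans (#hit-∉ A x x∉A (n≤1+n _) a<n)
                 (trans (cong (_* #through A) (m+n∸n≡m 1 ∣ A ∣)) (*-identityˡ _))))
             (m+n≤o⇒m≤o∸n _ (≤-reflexive (#diff A W A⊆W)))
             (λ c thr pos → ⟦⟧≤1 _ , cover c (proj₂ (⟦⟧-pos (E₂ c) pos))))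
             (*-monoˡ-≤ (#through A) (∸-monoˡ-≤ ∣ A ∣ w≤hi))

  module _ {lo : ℕ} (lo≤a : lo ≤ ∣ A ∣) (lo≤w : lo ≤ ∣ W ∣) (0<lo : 0 < lo) where

    -- Dually, either level lo misses a fixed point of A outside W, or the point removed from A is
    -- one of the at most ∣A∣ - lo points of A outside W.
    #clash↓ : ∣ A ∣ * (∑[ c ← chains n ] (through A c * ⟦ clash↓? lo A W c ⟧)) ≤ 2 * ((∣ A ∣ ∸ lo) * #through A)
    #clash↓ = begin
      ∣ A ∣ * (∑[ c ← chains n ] (through A c * ⟦ clash↓? lo A W c ⟧))
        ≤⟨ *-monoʳ-≤ ∣ A ∣ (∑-⊎ (chains n) (through A) E₁ E₂) ⟩
      ∣ A ∣ * (∑[ c ← chains n ] (through A c * ⟦ E₁ c ⟧) + ∑[ c ← chains n ] (through A c * ⟦ E₂ c ⟧))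
        ≡⟨ *-distribˡ-+ ∣ A ∣ _ _ ⟩
      ∣ A ∣ * (∑[ c ← chains n ] (through A c * ⟦ E₁ c ⟧)) + ∣ A ∣ * (∑[ c ← chains n ] (through A c * ⟦ E₂ c ⟧))
        ≤⟨ +-mono-≤ part₁ part₂ ⟩
      (∣ A ∣ ∸ lo) * #through A + (∣ A ∣ ∸ lo) * #through A
        ≡⟨ cong ((∣ A ∣ ∸ lo) * #through A +_) (+-identityʳ _) ⟨
      2 * ((∣ A ∣ ∸ lo) * #through A) ∎
      where
      open ≤-Reasoning
      0<a = ≤-trans 0<lo lo≤a
      E₁ : ∀ c → Dec (¬ (A ⊆ W) × lvl c lo ⊆ W)
      E₁ c = ¬? (A ⊆? W) ×-dec (lvl c lo ⊆? W)
      E₂ : ∀ c → Dec (W ⊆ A × W ⊆ lvl c (pred ∣ A ∣))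
      E₂ c = (W ⊆? A) ×-dec (W ⊆? lvl c (pred ∣ A ∣))
      part₁ : ∣ A ∣ * (∑[ c ← chains n ] (through A c * ⟦ E₁ c ⟧)) ≤ (∣ A ∣ ∸ lo) * #through A
      part₁ = go (A ⊆? W)
        where
        go : Dec (A ⊆ W) → ∣ A ∣ * (∑[ c ← chains n ] (through A c * ⟦ E₁ c ⟧)) ≤ (∣ A ∣ ∸ lo) * #through A
        go (yes A⊆W) = ≤-trans (≤-reflexive (trans (cong (∣ A ∣ *_) (∑-zero (chains n) (λ {c} _ →
                        trans (cong (through A c *_) (⟦⟧-no (E₁ c) (λ (p , _) → p A⊆W))) (*-zeroʳ (through A c)))))
                        (*-zeroʳ ∣ A ∣))) z≤n
        go (no A⊈W) = let (x , x∈A , x∉W) = ⊈-witness {A = W} {W = A} A⊈W in ≤-trans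
                       (*-monoʳ-≤ ∣ A ∣ (∑-mono (chains n) (λ {c} _ → *-monoʳ-≤ (through A c)
                         (⟦⟧-mono (E₁ c) (¬? (x ∈? lvl c lo)) (λ (_ , ⊆W) x∈ → x∉W (⊆W x∈))))))
                       (≤-reflexive (#miss-∈ A x x∈A lo≤a))
      part₂ : ∣ A ∣ * (∑[ c ← chains n ] (through A c * ⟦ E₂ c ⟧)) ≤ (∣ A ∣ ∸ lo) * #through A
      part₂ = go (W ⊆? A)
        where
        a∸pred : ∀ {a} → 0 < a → a ∸ pred a ≡ 1
        a∸pred {suc a} _ = m+n∸n≡m 1 a
        pred< : ∀ {a} → 0 < a → pred a < a
        pred< {suc a} _ = ≤-refl
        cover : ∀ c → W ⊆ lvl c (pred ∣ A ∣) → ∃[ x ] ((x ∈ A × x ∉ W) × x ∉ lvl c (pred ∣ A ∣))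
        cover c sub with ⊈-witness {A = lvl c (pred ∣ A ∣)} {W = A} (λ s → <⇒≱ (pred< 0<a) (subst (∣ A ∣ ≤_) (lvl-size c (≤-trans pred[n]≤n (∣p∣≤n A))) (p⊆q⇒∣p∣≤∣q∣ s)))
        ... | x , x∈A , x∉lvl = x , (x∈A , (λ x∈W → x∉lvl (sub x∈W))) , x∉lvl
        go : Dec (W ⊆ A) → ∣ A ∣ * (∑[ c ← chains n ] (through A c * ⟦ E₂ c ⟧)) ≤ (∣ A ∣ ∸ lo) * #through A
        go (no W⊈A) = ≤-trans (≤-reflexive (trans (cong (∣ A ∣ *_) (∑-zero (chains n) (λ {c} _ →
                        trans (cong (through A c *_) (⟦⟧-no (E₂ c) (λ (p , _) → W⊈A p))) (*-zeroʳ (through A c)))))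
                        (*-zeroʳ ∣ A ∣))) z≤n
        go (yes W⊆A) = ≤-trans (union ∣ A ∣ (∣ A ∣ ∸ ∣ W ∣) (λ x → (x ∈? A) ×-dec ¬? (x ∈? W))
             (λ c → ⟦ E₂ c ⟧) (λ x c → ¬? (x ∈? lvl c (pred ∣ A ∣)))
             (λ x (x∈A , x∉W) → ≤-reflexive (trans (#miss-∈ A x x∈A pred[n]≤n) (trans (cong (_* #through A) (a∸pred 0<a)) (*-identityˡ _))))
             (m+n≤o⇒m≤o∸n _ (≤-reflexive (#diff W A W⊆A)))
             (λ c thr pos → ⟦⟧≤1 _ , cover c (proj₂ (⟦⟧-pos (E₂ c) pos))))
             (*-monoˡ-≤ (#through A) (∸-monoʳ-≤ ∣ A ∣ lo≤w))

any-∑ : {P : Fin m → Set} (P? : ∀ i → Dec (P i)) → ⟦ Fin.any? P? ⟧ ≤ ∑[ i ← allFin m ] ⟦ P? i ⟧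
any-∑ {m} P? = go (Fin.any? P?)
  where
  go : (d : Dec _) → ⟦ d ⟧ ≤ ∑[ i ← allFin m ] ⟦ P? i ⟧
  go (yes (i , p)) = ≤-trans (⟦⟧≤1 (yes (i , p))) (≤-trans (≤-reflexive (sym (⟦⟧-yes (P? i) p))) (∑-∈ (allFin m) _ (∈-allFin i)))
  go (no ¬p)       = ≤-trans (≤-reflexive (⟦⟧-no (no ¬p) ¬p)) z≤n

anyVec? : {A : Set} → (∀ {P : A → Set} → (∀ a → Dec (P a)) → Dec (∃ P)) →
  ∀ {m} {P : Vec A m → Set} → (∀ v → Dec (P v)) → Dec (∃ P)
anyVec? any? {zero}  P? = map′ (λ p → [] , p) (λ { ([] , p) → p }) (P? [])
anyVec? any? {suc m} P? = map′ (λ (a , v , p) → a ∷ v , p) (λ { (a ∷ v , p) → a , v , p })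
  (any? (λ a → anyVec? any? (λ v → P? (a ∷ v))))

-- Trees built by adding leaves

-- up τ u and dn τ u attach a new leaf, numbered zero, above, respectively below, vertex u of τ.
data Tree : ℕ → Set where
  •     : Tree 1
  up dn : Tree m → Fin m → Tree (suc m)

-- The leaf is joined to the rest by one Hasse edge, so all its relations pass through its parent u.
Rel : Tree m → Fin m → Fin m → Set
Rel •        _       _       = ⊤
Rel (up τ u) zero    zero    = ⊤
Rel (up τ u) zero    (suc y) = ⊥
Rel (up τ u) (suc x) zero    = Rel τ x u
Rel (up τ u) (suc x) (suc y) = Rel τ x y
Rel (dn τ u) zero    zero    = ⊤
Rel (dn τ u) zero    (suc y) = Rel τ u y
Rel (dn τ u) (suc x) zero    = ⊥
Rel (dn τ u) (suc x) (suc y) = Rel τ x y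

rel? : (τ : Tree m) (x y : Fin m) → Dec (Rel τ x y)
rel? •        _       _       = yes tt
rel? (up τ u) zero    zero    = yes tt
rel? (up τ u) zero    (suc y) = no id
rel? (up τ u) (suc x) zero    = rel? τ x u
rel? (up τ u) (suc x) (suc y) = rel? τ x y
rel? (dn τ u) zero    zero    = yes tt
rel? (dn τ u) zero    (suc y) = rel? τ u y
rel? (dn τ u) (suc x) zero    = no id
rel? (dn τ u) (suc x) (suc y) = rel? τ x y

rank : Tree m → Fin m → Fin m
rank •        x       = x
rank (up τ u) zero    = fromℕ _
rank (up τ u) (suc x) = inject₁ (rank τ x)
rank (dn τ u) zero    = zero
rank (dn τ u) (suc x) = suc (rank τ x)

-- Ranks double as colour classes, so this is what makes the embedded tree rainbow.
rank-injective : (τ : Tree m) → ∀ x y → rank τ x ≡ rank τ y → x ≡ y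
rank-injective •        x       y       e = e
rank-injective (up τ u) zero    zero    e = refl
rank-injective (up τ u) zero    (suc y) e = contradiction e Fin.fromℕ≢inject₁
rank-injective (up τ u) (suc x) zero    e = contradiction (sym e) Fin.fromℕ≢inject₁
rank-injective (up τ u) (suc x) (suc y) e = cong suc (rank-injective τ x y (Fin.inject₁-injective e))
rank-injective (dn τ u) zero    zero    e = refl
rank-injective (dn τ u) (suc x) (suc y) e = cong suc (rank-injective τ x y (Fin.suc-injective e))

-- One inequality per Hasse edge. The target `Fin t` is arbitrary because the induction removes
-- leaves while the length t of the windows stays fixed: a subtree carries the restricted ranks of
-- the whole tree, not its own.
Increasing : Tree m → (Fin m → Fin t) → Set
Increasing •        ρ = ⊤
Increasing (up τ u) ρ = toℕ (ρ (suc u)) < toℕ (ρ zero) × Increasing τ (ρ ∘ suc)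
Increasing (dn τ u) ρ = toℕ (ρ zero) < toℕ (ρ (suc u)) × Increasing τ (ρ ∘ suc)

increasing-∘ : (τ : Tree m) (ρ : Fin m → Fin t) {t' : ℕ} (f : Fin t → Fin t') →
  (∀ {i j} → toℕ i < toℕ j → toℕ (f i) < toℕ (f j)) → Increasing τ ρ → Increasing τ (f ∘ ρ)
increasing-∘ •        ρ f mono _         = tt
increasing-∘ (up τ u) ρ f mono (lt , is) = mono lt , increasing-∘ τ (ρ ∘ suc) f mono is
increasing-∘ (dn τ u) ρ f mono (lt , is) = mono lt , increasing-∘ τ (ρ ∘ suc) f mono is

rank-increasing : (τ : Tree m) → Increasing τ (rank τ)
rank-increasing • = tt
rank-increasing (up {m} τ u) = subst₂ _<_ (sym (Fin.toℕ-inject₁ (rank τ u))) (sym (Fin.toℕ-fromℕ m)) (toℕ<n (rank τ u)) ,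
  increasing-∘ τ (rank τ) inject₁ (λ {i} {j} → subst₂ _<_ (sym (Fin.toℕ-inject₁ i)) (sym (Fin.toℕ-inject₁ j))) (rank-increasing τ)
rank-increasing (dn τ u) = s≤s z≤n , increasing-∘ τ (rank τ) suc s≤s (rank-increasing τ)

-- Embedding a tree into the windows of full chains

module Windows {n : ℕ} (F : List (Subset n)) (F! : Unique F) where

  open import Data.List.Membership.DecPropositional (_≟ˢ_ {n = n}) using () renaming (_∈?_ to _∈ˡ?_)

  full : Chain n → List (Subset n)
  full c = List.applyUpTo (lvl c) (suc n)

  trace : Chain n → List (Subset n)
  trace c = filter (_∈ˡ? F) (full c)

  full-ordered : ∀ c → AllPairs (λ A B → ∣ A ∣ < ∣ B ∣) (full c)
  full-ordered c = AllPairs⁺.applyUpTo⁺₁ (lvl c) (suc n) λ {i} {j} i<j j<1+n →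
    subst₂ _<_ (sym (lvl-size c (≤-trans (<⇒≤ i<j) (s≤s⁻¹ j<1+n)))) (sym (lvl-size c (s≤s⁻¹ j<1+n))) i<j

  full-unique : ∀ c → Unique (full c)
  full-unique c = AllPairs.map (λ lt e → <⇒≢ lt (cong ∣_∣ e)) (full-ordered c)

  trace-ordered : ∀ c → AllPairs (λ A B → ∣ A ∣ < ∣ B ∣) (trace c)
  trace-ordered c = AllPairs⁺.filter⁺ (_∈ˡ? F) (full-ordered c)

  ∈-full⁻ : ∀ c {A} → A ∈ˡ full c → lvl c ∣ A ∣ ≡ A
  ∈-full⁻ c A∈ with ∈-applyUpTo⁻ (lvl c) A∈
  ... | k , k<1+n , refl = cong (lvl c) (lvl-size c (s≤s⁻¹ k<1+n))

  ∈-full⁺ : ∀ c {A} → lvl c ∣ A ∣ ≡ A → A ∈ˡ full c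
  ∈-full⁺ c {A} e = subst (_∈ˡ full c) e (∈-applyUpTo⁺ (lvl c) (s≤s (∣p∣≤n A)))

  ∈-trace : ∀ c {A} → A ∈ˡ trace c → A ∈ˡ F × lvl c ∣ A ∣ ≡ A
  ∈-trace c A∈ with ∈-filter⁻ (_∈ˡ? F) {xs = full c} A∈
  ... | A∈full , A∈F = A∈F , ∈-full⁻ c A∈full

  -- Double counting of the incidences between chains and members of F.
  ∑-trace : (g : Chain n → Subset n → ℕ) →
    ∑[ c ← chains n ] ∑[ A ← trace c ] g c A ≡ ∑[ A ← F ] ∑[ c ← chains n ] (through A c * g c A)
  ∑-trace g = begin
    ∑[ c ← chains n ] ∑[ A ← trace c ] g c A
      ≡⟨ ∑-cong (chains n) (λ {c} _ → trans (∑-filter (_∈ˡ? F) (full c) (g c)) (∑-∩ _≟ˢ_ (full-unique c) F! (g c))) ⟩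
    ∑[ c ← chains n ] ∑[ A ← F ] (⟦ A ∈ˡ? full c ⟧ * g c A)
      ≡⟨ ∑-cong (chains n) (λ {c} _ → ∑-cong F (λ {A} _ → cong (_* g c A) (⟦⟧-cong (A ∈ˡ? full c) (lvl c ∣ A ∣ ≟ˢ A) (∈-full⁻ c) (∈-full⁺ c)))) ⟩
    ∑[ c ← chains n ] ∑[ A ← F ] (through A c * g c A)
      ≡⟨ ∑-swap (chains n) F _ ⟩
    ∑[ A ← F ] ∑[ c ← chains n ] (through A c * g c A) ∎
    where open ≡-Reasoning

  -- `n !` times the expected number of members of F on a random full chain.
  mass : ℕ
  mass = ∑ F #through

  ∑-length-trace : ∑[ c ← chains n ] length (trace c) ≡ mass
  ∑-length-trace = trans (∑-cong (chains n) (λ {c} _ → sym (∑-length (trace c)))) (trans (∑-trace (λ _ _ → 1))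
    (∑-cong F (λ {A} _ → ∑-cong (chains n) (λ {c} _ → *-identityʳ (through A c)))))

  module _ (t : ℕ) where

    Item : Set
    Item = Chain n × Vec (Subset n) t

    mark : Fin t → Item → Subset n
    mark r (_ , w) = lookup w r

    items : List Item
    items = concatMap (λ c → map (c ,_) (windows t (trace c))) (chains n)

    ∑-items : (g : Item → ℕ) → ∑ items g ≡ ∑[ c ← chains n ] ∑[ w ← windows t (trace c) ] g (c , w)
    ∑-items g = trans (∑-concatMap _ (chains n) g) (∑-cong (chains n) (λ {c} _ → ∑-map (c ,_) (windows t (trace c)) g))

    ∑-items-mark : (r : Fin t) (g : Chain n → Subset n → ℕ) →
      ∑[ i ← items ] g (proj₁ i) (mark r i) ≤ ∑[ A ← F ] ∑[ c ← chains n ] (through A c * g c A)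
    ∑-items-mark r g = begin
      ∑[ i ← items ] g (proj₁ i) (mark r i)                                ≡⟨ ∑-items _ ⟩
      ∑[ c ← chains n ] ∑[ w ← windows t (trace c) ] g c (lookup w r)      ≤⟨ ∑-mono (chains n) (λ {c} _ → ∑-windows (trace c) (g c) r) ⟩
      ∑[ c ← chains n ] ∑[ A ← trace c ] g c A                             ≡⟨ ∑-trace g ⟩
      ∑[ A ← F ] ∑[ c ← chains n ] (through A c * g c A)                   ∎
      where open ≤-Reasoning

    ∈-items : ∀ {i} → i ∈ˡ items → proj₂ i ∈ˡ windows t (trace (proj₁ i))
    ∈-items {i} i∈ = go (chains n) i∈
      where
      go : ∀ cs → i ∈ˡ concatMap (λ c → map (c ,_) (windows t (trace c))) cs → proj₂ i ∈ˡ windows t (trace (proj₁ i))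
      go (c ∷ cs) i∈ with ∈-++⁻ (map (c ,_) (windows t (trace c))) i∈
      ... | inj₂ q = go cs q
      ... | inj₁ p with ∈-map⁻ (c ,_) p
      ...   | w , w∈ , refl = w∈

    mark∈F : ∀ {i} → i ∈ˡ items → ∀ r → mark r i ∈ˡ F
    mark∈F {c , w} i∈ r = proj₁ (∈-trace c (∈-windows (trace c) (∈-items i∈) r))

    mark-lvl : ∀ {i} → i ∈ˡ items → ∀ r → lvl (proj₁ i) ∣ mark r i ∣ ≡ mark r i
    mark-lvl {c , w} i∈ r = proj₂ (∈-trace c (∈-windows (trace c) (∈-items i∈) r))

    mark-< : ∀ {i} → i ∈ˡ items → ∀ r s → toℕ r < toℕ s → ∣ mark r i ∣ < ∣ mark s i ∣
    mark-< {c , w} i∈ = windows-ordered (trace-ordered c) (∈-items i∈)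

    -- `∑-sub` says that multiplicities do not grow, which membership alone would not give; it
    -- bounds counts over the list by counts over all windows.
    record SubItems : Set where
      field
        list : List Item
        sub  : ∀ {i} → i ∈ˡ list → i ∈ˡ items
        ∑-sub : ∀ g → ∑ list g ≤ ∑ items g

    open SubItems

    allItems : SubItems
    allItems = record { list = items ; sub = id ; ∑-sub = λ g → ≤-refl }

    keep : {P : Item → Set} → (∀ i → Dec (P i)) → SubItems → SubItems
    keep P? L = record
      { list  = filter P? (list L)
      ; sub   = λ i∈ → sub L (proj₁ (∈-filter⁻ P? {xs = list L} i∈))
      ; ∑-sub = λ g → ≤-trans (≤-trans (≤-reflexive (∑-filter P? (list L) g))
                  (∑-mono (list L) (λ {i} _ → ≤-trans (*-monoˡ-≤ (g i) (⟦⟧≤1 (P? i))) (≤-reflexive (*-identityˡ (g i)))))) (∑-sub L g)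
      }

    module _ (Clash : Subset n → Subset n → Chain n → Set) (clash? : ∀ A W c → Dec (Clash A W c))
             (Q : ℕ) (rare : ∀ {A W} → A ∈ˡ F → W ∈ˡ F → Q * (∑[ c ← chains n ] (through A c * ⟦ clash? A W c ⟧)) ≤ 2 * #through A) where

      Blocked : Item → Fin t → Vec (Subset n) m → Set
      Blocked i r Os = ∃[ j ] Clash (mark r i) (lookup Os j) (proj₁ i)

      -- One tuple of obstacles has to block all windows of L with A in position r. Since it does
      -- not depend on the window, the union bound over obstacles has only m terms.
      Bottleneck : SubItems → Fin t → ℕ → Subset n → Set
      Bottleneck L r m A = ∃[ Os ] ((∀ (j : Fin m) → lookup Os j ∈ˡ F) × All (λ i → ¬ (mark r i ≡ A) ⊎ Blocked i r Os) (list L))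

      bottleneck? : ∀ L r m A → Dec (Bottleneck L r m A)
      bottleneck? L r m A = anyVec? Sub.anySubset? λ Os → Fin.all? (λ j → lookup Os j ∈ˡ? F) ×-dec
        All.all? (λ i → ¬? (mark r i ≟ˢ A) ⊎-dec Fin.any? (λ j → clash? (mark r i) (lookup Os j) (proj₁ i))) (list L)

      clean : SubItems → Fin t → ℕ → SubItems
      clean L r m = keep (λ i → ¬? (bottleneck? L r m (mark r i))) L

      -- The windows removed because of A clash with one of the m obstacles fixed for A, which by
      -- `rare` happens on at most a share 2m / Q of the chains through A. Each incidence is counted
      -- once, as a window is determined by its chain and its r-th member.
      clean-loss : ∀ L r m → Q * length (list L) ≤ Q * length (list (clean L r m)) + 2 * m * mass
      clean-loss L r m = begin
        Q * length (list L)
          ≡⟨ cong (Q *_) (trans (sym (∑-length (list L))) (∑-cong (list L) (λ {i} _ → sym (⟦⟧-¬ (b? i))))) ⟩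
        Q * (∑[ i ← list L ] (⟦ ¬? (b? i) ⟧ + ⟦ b? i ⟧))
          ≡⟨ cong (Q *_) (∑-+ (list L) _ _) ⟩
        Q * (∑[ i ← list L ] ⟦ ¬? (b? i) ⟧ + ∑[ i ← list L ] ⟦ b? i ⟧)
          ≡⟨ *-distribˡ-+ Q _ _ ⟩
        Q * (∑[ i ← list L ] ⟦ ¬? (b? i) ⟧) + Q * (∑[ i ← list L ] ⟦ b? i ⟧)
          ≤⟨ +-mono-≤ (≤-reflexive (cong (Q *_) kept)) lost ⟩
        Q * length (list (clean L r m)) + 2 * m * mass ∎
        where
        open ≤-Reasoning
        b? : ∀ i → Dec (Bottleneck L r m (mark r i))
        b? i = bottleneck? L r m (mark r i)
        ⟦⟧-¬ : {P : Set} (d : Dec P) → ⟦ ¬? d ⟧ + ⟦ d ⟧ ≡ 1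
        ⟦⟧-¬ (yes p) = cong₂ _+_ (⟦⟧-no (¬? (yes p)) (λ ¬p → ¬p p)) (⟦⟧-yes (yes p) p)
        ⟦⟧-¬ (no ¬p) = cong₂ _+_ (⟦⟧-yes (¬? (no ¬p)) ¬p) (⟦⟧-no (no ¬p) ¬p)
        kept : ∑[ i ← list L ] ⟦ ¬? (b? i) ⟧ ≡ length (list (clean L r m))
        kept = trans (∑-cong (list L) (λ _ → sym (*-identityʳ _))) (trans (sym (∑-filter (λ i → ¬? (b? i)) (list L) (λ _ → 1))) (∑-length _))
        obstructed : ∀ {A} → Dec (Bottleneck L r m A) → Chain n → ℕ
        obstructed {A} (yes (Os , _)) c = ∑[ j ← allFin m ] ⟦ clash? A (lookup Os j) c ⟧
        obstructed     (no _)         c = 0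
        g : Chain n → Subset n → ℕ
        g c A = obstructed (bottleneck? L r m A) c
        covered : ∀ {i} → i ∈ˡ list L → (d : Dec (Bottleneck L r m (mark r i))) → ⟦ d ⟧ ≤ obstructed d (proj₁ i)
        covered i∈ (no ¬b) = ≤-reflexive (⟦⟧-no (no ¬b) ¬b)
        covered {i} i∈ (yes (Os , Os∈ , all)) with All.lookup all i∈
        ... | inj₁ ≢ = contradiction refl ≢
        ... | inj₂ blocked = ≤-trans (≤-trans (⟦⟧≤1 _) (≤-reflexive (sym (⟦⟧-yes (Fin.any? (λ j → clash? (mark r i) (lookup Os j) (proj₁ i))) blocked))))
                               (any-∑ (λ j → clash? (mark r i) (lookup Os j) (proj₁ i)))
        rare' : ∀ {A} → A ∈ˡ F → (d : Dec (Bottleneck L r m A)) → Q * (∑[ c ← chains n ] (through A c * obstructed d c)) ≤ 2 * m * #through A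
        rare' {A} A∈ (no _) = ≤-trans (≤-reflexive (trans (cong (Q *_) (∑-zero (chains n) (λ {c} _ → *-zeroʳ (through A c)))) (*-zeroʳ Q))) z≤n
        rare' {A} A∈ (yes (Os , Os∈ , _)) = begin
          Q * (∑[ c ← chains n ] (through A c * (∑[ j ← allFin m ] ⟦ clash? A (lookup Os j) c ⟧)))
            ≡⟨ cong (Q *_) (trans (∑-cong (chains n) (λ {c} _ → sym (∑-*ˡ (allFin m) (through A c) _))) (∑-swap (chains n) (allFin m) _)) ⟩
          Q * (∑[ j ← allFin m ] ∑[ c ← chains n ] (through A c * ⟦ clash? A (lookup Os j) c ⟧))
            ≡⟨ ∑-*ˡ (allFin m) Q _ ⟨
          ∑[ j ← allFin m ] (Q * (∑[ c ← chains n ] (through A c * ⟦ clash? A (lookup Os j) c ⟧)))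
            ≤⟨ ∑-mono (allFin m) (λ {j} _ → rare A∈ (Os∈ j)) ⟩
          ∑[ j ← allFin m ] (2 * #through A)
            ≡⟨ trans (∑-const (allFin m) (2 * #through A)) (cong (_* (2 * #through A)) (List.length-tabulate {n = m} id)) ⟩
          m * (2 * #through A)
            ≡⟨ lemma m (#through A) ⟩
          2 * m * #through A ∎
          where lemma : ∀ m x → m * (2 * x) ≡ 2 * m * x
                lemma = solve-∀
        lost : Q * (∑[ i ← list L ] ⟦ b? i ⟧) ≤ 2 * m * mass
        lost = begin
          Q * (∑[ i ← list L ] ⟦ b? i ⟧)                             ≤⟨ *-monoʳ-≤ Q (∑-mono (list L) (λ {i} i∈ → covered i∈ (b? i))) ⟩
          Q * (∑[ i ← list L ] g (proj₁ i) (mark r i))               ≤⟨ *-monoʳ-≤ Q (∑-sub L (λ i → g (proj₁ i) (mark r i))) ⟩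
          Q * (∑[ i ← items ] g (proj₁ i) (mark r i))                ≤⟨ *-monoʳ-≤ Q (∑-items-mark r g) ⟩
          Q * (∑[ A ← F ] ∑[ c ← chains n ] (through A c * g c A))   ≡⟨ ∑-*ˡ F Q _ ⟨
          ∑[ A ← F ] (Q * (∑[ c ← chains n ] (through A c * g c A))) ≤⟨ ∑-mono F (λ {A} A∈ → rare' A∈ (bottleneck? L r m A)) ⟩
          ∑[ A ← F ] (2 * m * #through A)                            ≡⟨ ∑-*ˡ F (2 * m) _ ⟩
          2 * m * mass                                               ∎

      -- Otherwise the values of `ψ`, read as a tuple of obstacles, would make the r-th member of i
      -- a bottleneck, and i would have been removed.
      escape : ∀ L r {i} → i ∈ˡ list (clean L r m) → (ψ : Fin m → Subset n) → (∀ x → ψ x ∈ˡ F) →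
        ∃[ i' ] (i' ∈ˡ list L × mark r i' ≡ mark r i × ∀ x → ¬ Clash (mark r i) (ψ x) (proj₁ i'))
      escape {m} L r {i} i∈ ψ ψ∈F with Any.any? (λ i' → (mark r i' ≟ˢ mark r i) ×-dec Fin.all? (λ x → ¬? (clash? (mark r i) (ψ x) (proj₁ i')))) (list L)
      ... | yes found = let (i' , i'∈ , e , ok) = find found in i' , i'∈ , e , ok
      ... | no none = contradiction (tabulate ψ , (λ j → subst (_∈ˡ F) (sym (lookup∘tabulate ψ j)) (ψ∈F j)) , All.tabulate blocked)
                        (proj₂ (∈-filter⁻ (λ i → ¬? (bottleneck? L r m (mark r i))) {xs = list L} i∈))
        where
        blocked : ∀ {i'} → i' ∈ˡ list L → ¬ (mark r i' ≡ mark r i) ⊎ Blocked i' r (tabulate ψ)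
        blocked {i'} i'∈ with mark r i' ≟ˢ mark r i
        ... | no ≢  = inj₁ ≢
        ... | yes e with Fin.any? (λ x → clash? (mark r i) (ψ x) (proj₁ i'))
        ...   | yes (x , cl) = inj₂ (x , subst₂ (λ A W → Clash A W (proj₁ i')) (sym e) (sym (lookup∘tabulate ψ x)) cl)
        ...   | no ¬cl       = contradiction (lose i'∈ (e , λ x cl → ¬cl (x , cl))) none

module _ {n : ℕ} (F : List (Subset n)) (F! : Unique F) (lo hi Q : ℕ)
  (0<lo : 0 < lo) (lo≤n∸hi : lo ≤ n ∸ hi) (Q-small : Q * (hi ∸ lo) ≤ lo)
  (mid : ∀ {A} → A ∈ˡ F → lo ≤ ∣ A ∣ × ∣ A ∣ ≤ hi) (t : ℕ) where

  open Windows F F!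
  open SubItems

  private
    hi<n : hi < n
    hi<n = ≰⇒> (λ n≤hi → n>0⇒n≢0 (≤-trans 0<lo lo≤n∸hi) (m≤n⇒m∸n≡0 n≤hi))

    rescale : ∀ {d e S N} → 0 < d → d * S ≤ 2 * (e * N) → Q * e ≤ d → Q * S ≤ 2 * N
    rescale {d} {e} {S} {N} 0<d le Qe≤d = *-cancelˡ-≤ d (begin
      d * (Q * S)         ≡⟨ l₁ d Q S ⟩
      Q * (d * S)         ≤⟨ *-monoʳ-≤ Q le ⟩
      Q * (2 * (e * N))   ≡⟨ l₂ Q e N ⟩
      Q * e * (2 * N)     ≤⟨ *-monoˡ-≤ (2 * N) Qe≤d ⟩
      d * (2 * N)         ∎)
      where
      open ≤-Reasoning
      instance _ = >-nonZero 0<d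
      l₁ : ∀ d Q S → d * (Q * S) ≡ Q * (d * S)
      l₁ = solve-∀
      l₂ : ∀ Q e N → Q * (2 * (e * N)) ≡ Q * e * (2 * N)
      l₂ = solve-∀

    -- As ∣A∣ lies between lo and hi and lo ≤ n - hi, the ratio (hi - ∣A∣) / (n - ∣A∣) is at most
    -- (hi - lo) / lo, which `Q-small` controls.
    rare↑ : ∀ {A W} → A ∈ˡ F → W ∈ˡ F → Q * (∑[ c ← chains n ] (through A c * ⟦ clash↑? hi A W c ⟧)) ≤ 2 * #through A
    rare↑ {A} {W} A∈ W∈ = rescale (m<n⇒0<n∸m (≤-<-trans (proj₂ (mid A∈)) hi<n))
      (#clash↑ A W (proj₂ (mid A∈)) (proj₂ (mid W∈)) hi<n)
      (≤-trans (*-monoʳ-≤ Q (∸-monoʳ-≤ hi (proj₁ (mid A∈)))) (≤-trans Q-small (≤-trans lo≤n∸hi (∸-monoʳ-≤ n (proj₂ (mid A∈))))))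

    rare↓ : ∀ {A W} → A ∈ˡ F → W ∈ˡ F → Q * (∑[ c ← chains n ] (through A c * ⟦ clash↓? lo A W c ⟧)) ≤ 2 * #through A
    rare↓ {A} {W} A∈ W∈ = rescale (≤-trans 0<lo (proj₁ (mid A∈)))
      (#clash↓ A W (proj₁ (mid A∈)) (proj₁ (mid W∈)) 0<lo)
      (≤-trans (*-monoʳ-≤ Q (∸-monoˡ-≤ lo (proj₂ (mid A∈)))) (≤-trans Q-small (proj₁ (mid A∈))))

    mk⊆ : {P : Set} (A B : Subset n) → (P → ∀ {x} → x ∈ A → x ∈ B) → (A ⊆ B → P) → P ⇔ (A ⊆ B)
    mk⊆ A B f g = record { to = f ; from = g ; to-cong = λ { refl → refl } ; from-cong = λ { refl → refl } }

    -- Removing a leaf lowers the requirement by (4m + 2) · mass, more than the 2m · mass lost in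
    -- cleaning.
    budget : ∀ m x y → 2 * (suc m * suc m) * mass < x → x ≤ y + 2 * m * mass → 2 * (m * m) * mass < y
    budget m x y lt le = +-cancelʳ-< (2 * m * mass) _ _ (begin-strict
      2 * (m * m) * mass + 2 * m * mass                              ≤⟨ m≤m+n _ (2 * (m + 1) * mass) ⟩
      2 * (m * m) * mass + 2 * m * mass + 2 * (m + 1) * mass         ≡⟨ lemma m mass ⟩
      2 * (suc m * suc m) * mass                                     <⟨ lt ⟩
      x                                                              ≤⟨ le ⟩
      y + 2 * m * mass                                               ∎)
      where
      open ≤-Reasoning
      lemma : ∀ m E → 2 * (m * m) * E + 2 * m * E + 2 * (m + 1) * E ≡ 2 * (suc m * suc m) * E
      lemma = solve-∀

  -- Different vertices may be witnessed by different windows. What matters is that the image of x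
  -- stands at position `ρ x`, from which its colour class is read off later.
  Embedding : Tree m → (Fin m → Fin t) → SubItems t → Set
  Embedding {m} τ ρ L = Σ (Fin m → Subset n) λ ψ → (∀ x → ∃[ i ] (i ∈ˡ list L × mark t (ρ x) i ≡ ψ x)) × (∀ x y → Rel τ x y ⇔ (ψ x ⊆ ψ y))

  extend : Subset n → (Fin m → Subset n) → Fin (suc m) → Subset n
  extend B ψ zero    = B
  extend B ψ (suc x) = ψ x

  private
    clean↑ clean↓ : ℕ → Fin t → SubItems t → SubItems t
    clean↑ m r L = clean t (Clash↑ hi) (clash↑? hi) Q rare↑ L r m
    clean↓ m r L = clean t (Clash↓ lo) (clash↓? lo) Q rare↓ L r m

    image∈F : ∀ {ρ : Fin m → Fin t} (L : SubItems t) {ψ : Fin m → Subset n} →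
      (∀ x → ∃[ i ] (i ∈ˡ list L × mark t (ρ x) i ≡ ψ x)) → ∀ x → ψ x ∈ˡ F
    image∈F {ρ = ρ} L marks x = let (i , i∈ , e) = marks x in subst (_∈ˡ F) e (mark∈F t (sub L i∈) (ρ x))

    add-mark : ∀ {P : Item t → Set} (P? : ∀ i → Dec (P i)) {ρ : Fin (suc m) → Fin t} (L : SubItems t) {ψ : Fin m → Subset n} →
      (∀ x → ∃[ i ] (i ∈ˡ list (keep t P? L) × mark t (ρ (suc x)) i ≡ ψ x)) → ∀ {i} → i ∈ˡ list L →
      ∀ x → ∃[ j ] (j ∈ˡ list L × mark t (ρ x) j ≡ extend (mark t (ρ zero) i) ψ x)
    add-mark P? L marks {i} i∈ zero    = i , i∈ , refl
    add-mark P? L marks {i} i∈ (suc x) = let (j , j∈ , e) = marks x in j , proj₁ (∈-filter⁻ P? {xs = list L} j∈) , e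

    module _ {c : Chain n} {A B : Subset n} (A≡ : lvl c ∣ A ∣ ≡ A) (B≡ : lvl c ∣ B ∣ ≡ B) (B∈ : B ∈ˡ F)
             (τ : Tree m) (u : Fin m) (ψ : Fin m → Subset n) (rel : ∀ x y → Rel τ x y ⇔ (ψ x ⊆ ψ y)) (ψu≡ : ψ u ≡ A) where

      private
        to-u : ∀ x → Rel τ x u → ψ x ⊆ A
        to-u x r {z} z∈ = subst (z ∈_) ψu≡ (Equivalence.to (rel x u) r z∈)
        from-u : ∀ x → ψ x ⊆ A → Rel τ x u
        from-u x s = Equivalence.from (rel x u) (λ {z} z∈ → subst (z ∈_) (sym ψu≡) (s z∈))
        to-u' : ∀ x → Rel τ u x → A ⊆ ψ x
        to-u' x r {z} z∈ = Equivalence.to (rel u x) r (subst (z ∈_) (sym ψu≡) z∈)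
        from-u' : ∀ x → A ⊆ ψ x → Rel τ u x
        from-u' x s = Equivalence.from (rel u x) (λ {z} z∈ → s (subst (z ∈_) ψu≡ z∈))

      rel-up : ∣ A ∣ < ∣ B ∣ → (∀ x → ¬ Clash↑ hi A (ψ x) c) →
        ∀ x y → Rel (up τ u) x y ⇔ (extend B ψ x ⊆ extend B ψ y)
      rel-up A<B free = go
        where
        next⊆B : lvl c (suc ∣ A ∣) ⊆ B
        next⊆B {x} x∈ = subst (x ∈_) B≡ (lvl-mono c A<B x∈)
        A⊆B : A ⊆ B
        A⊆B {x} x∈ = next⊆B (lvl-mono c (n≤1+n ∣ A ∣) (subst (x ∈_) (sym A≡) x∈))
        B⊆hi : B ⊆ lvl c hi
        B⊆hi {x} x∈ = lvl-mono c (proj₂ (mid B∈)) (subst (x ∈_) (sym B≡) x∈)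
        go : ∀ x y → Rel (up τ u) x y ⇔ (extend B ψ x ⊆ extend B ψ y)
        go zero    zero    = mk⊆ B B (λ _ x∈ → x∈) (λ _ → tt)
        go zero    (suc y) = mk⊆ B (ψ y) (λ ()) (λ B⊆W → free y (inj₂ ((λ x∈ → B⊆W (A⊆B x∈)) , (λ x∈ → B⊆W (next⊆B x∈)))))
        go (suc x) zero    = mk⊆ (ψ x) B (λ r z∈ → A⊆B (to-u x r z∈))
          (λ W⊆B → from-u x (decidable-stable (ψ x ⊆? A) (λ W⊈A → free x (inj₁ (W⊈A , (λ z∈ → B⊆hi (W⊆B z∈)))))))
        go (suc x) (suc y) = rel x y

      rel-dn : ∣ B ∣ < ∣ A ∣ → (∀ x → ¬ Clash↓ lo A (ψ x) c) →
        ∀ x y → Rel (dn τ u) x y ⇔ (extend B ψ x ⊆ extend B ψ y)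
      rel-dn B<A free = go
        where
        B⊆prev : B ⊆ lvl c (pred ∣ A ∣)
        B⊆prev {x} x∈ = lvl-mono c (pred-mono-≤ B<A) (subst (x ∈_) (sym B≡) x∈)
        B⊆A : B ⊆ A
        B⊆A {x} x∈ = subst (x ∈_) A≡ (lvl-mono c (pred[n]≤n {∣ A ∣}) (B⊆prev x∈))
        lo⊆B : lvl c lo ⊆ B
        lo⊆B {x} x∈ = subst (x ∈_) B≡ (lvl-mono c (proj₁ (mid B∈)) x∈)
        go : ∀ x y → Rel (dn τ u) x y ⇔ (extend B ψ x ⊆ extend B ψ y)
        go zero    zero    = mk⊆ B B (λ _ x∈ → x∈) (λ _ → tt)
        go (suc x) zero    = mk⊆ (ψ x) B (λ ()) (λ W⊆B → free x (inj₂ ((λ z∈ → B⊆A (W⊆B z∈)) , (λ z∈ → B⊆prev (W⊆B z∈)))))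
        go zero    (suc y) = mk⊆ B (ψ y) (λ r z∈ → to-u' y r (B⊆A z∈))
          (λ B⊆W → from-u' y (decidable-stable (A ⊆? ψ y) (λ A⊈W → free y (inj₁ (A⊈W , (λ z∈ → B⊆W (lo⊆B z∈)))))))
        go (suc x) (suc y) = rel x y

    grow↑ : (τ : Tree m) (u : Fin m) (ρ : Fin (suc m) → Fin t) → toℕ (ρ (suc u)) < toℕ (ρ zero) → (L : SubItems t) →
      Embedding τ (ρ ∘ suc) (clean↑ m (ρ (suc u)) L) → Embedding (up τ u) ρ L
    grow↑ {m} τ u ρ lt L (ψ , marks , rel) =
      let (i , i∈ , e) = marks u
          (i' , i'∈ , e' , free) = escape t (Clash↑ hi) (clash↑? hi) Q rare↑ L (ρ (suc u)) i∈ ψ (image∈F (clean↑ m (ρ (suc u)) L) marks)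
          i'∈items = sub L i'∈
      in extend (mark t (ρ zero) i') ψ , add-mark _ L marks i'∈ ,
         rel-up {c = proj₁ i'} (subst (λ A → lvl (proj₁ i') ∣ A ∣ ≡ A) e' (mark-lvl t i'∈items (ρ (suc u)))) (mark-lvl t i'∈items (ρ zero)) (mark∈F t i'∈items (ρ zero))
           τ u ψ rel (sym e) (subst (λ A → ∣ A ∣ < ∣ mark t (ρ zero) i' ∣) e' (mark-< t i'∈items (ρ (suc u)) (ρ zero) lt)) free

    grow↓ : (τ : Tree m) (u : Fin m) (ρ : Fin (suc m) → Fin t) → toℕ (ρ zero) < toℕ (ρ (suc u)) → (L : SubItems t) →
      Embedding τ (ρ ∘ suc) (clean↓ m (ρ (suc u)) L) → Embedding (dn τ u) ρ L
    grow↓ {m} τ u ρ lt L (ψ , marks , rel) =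
      let (i , i∈ , e) = marks u
          (i' , i'∈ , e' , free) = escape t (Clash↓ lo) (clash↓? lo) Q rare↓ L (ρ (suc u)) i∈ ψ (image∈F (clean↓ m (ρ (suc u)) L) marks)
          i'∈items = sub L i'∈
      in extend (mark t (ρ zero) i') ψ , add-mark _ L marks i'∈ ,
         rel-dn {c = proj₁ i'} (subst (λ A → lvl (proj₁ i') ∣ A ∣ ≡ A) e' (mark-lvl t i'∈items (ρ (suc u)))) (mark-lvl t i'∈items (ρ zero)) (mark∈F t i'∈items (ρ zero))
           τ u ψ rel (sym e) (subst (λ A → ∣ mark t (ρ zero) i' ∣ < ∣ A ∣) e' (mark-< t i'∈items (ρ zero) (ρ (suc u)) lt)) free

    grow• : (ρ : Fin 1 → Fin t) (L : SubItems t) (is : List (Item t)) → list L ≡ is → 0 < length is → Embedding • ρ L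
    grow• ρ L (i ∷ is) eq _ = (λ _ → A) , (λ { zero → i , subst (i ∈ˡ_) (sym eq) (here refl) , refl }) , (λ _ _ → mk⊆ A A (λ _ x∈ → x∈) (λ _ → tt))
      where A = mark t (ρ zero) i

  -- The induction peels off the leaf attached last and cleans L for it before embedding the rest.
  -- The quadratic bound pays for all cleanings and still leaves a window for the single vertex.
  embed : (τ : Tree m) (ρ : Fin m → Fin t) → Increasing τ ρ → (L : SubItems t) →
    2 * (m * m) * mass < Q * length (list L) → Embedding τ ρ L
  embed • ρ _ L big = grow• ρ L (list L) refl (n≢0⇒n>0 (λ z → n≮0 (<-≤-trans big (≤-reflexive (trans (cong (Q *_) z) (*-zeroʳ Q))))))
  embed (up {m} τ u) ρ (lt , inc) L big = grow↑ τ u ρ lt L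
    (embed τ (ρ ∘ suc) inc (clean↑ m (ρ (suc u)) L) (budget m _ _ big (clean-loss t (Clash↑ hi) (clash↑? hi) Q rare↑ L (ρ (suc u)) m)))
  embed (dn {m} τ u) ρ (lt , inc) L big = grow↓ τ u ρ lt L
    (embed τ (ρ ∘ suc) inc (clean↓ m (ρ (suc u)) L) (budget m _ _ big (clean-loss t (Clash↓ lo) (clash↓? lo) Q rare↓ L (ρ (suc u)) m)))

-- The upper bound for trees

nCk>0 : ∀ {n k} → k ≤ n → 0 < n C k
nCk>0 {n} {k} k≤n = n≢0⇒n>0 λ z → n>0⇒n≢0 (n!>0 n) (trans (sym (nCk*k!*[n∸k]!≡n! k≤n)) (cong (_* (k ! * (n ∸ k) !)) z))
  where
  n!>0 : ∀ n → 0 < n !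
  n!>0 n = n≢0⇒n>0 (≢-nonZero⁻¹ (n !) {{n !≢0}})

module _ {n : ℕ} (𝓕 : Family n) (𝓕! : Unique 𝓕) (lo : ℕ) where

  mid? : (A : Subset n) → Dec (lo ≤ ∣ A ∣ × ∣ A ∣ ≤ n ∸ lo)
  mid? A = (lo ≤? ∣ A ∣) ×-dec (∣ A ∣ ≤? n ∸ lo)

  middle : Family n
  middle = filter mid? 𝓕

  length-middle : lo ≤ n → length 𝓕 ≤ length middle + 2 * ∑C< n lo
  length-middle lo≤n = begin
    length 𝓕
      ≡⟨ ∑-length 𝓕 ⟨
    ∑[ _ ← 𝓕 ] 1
      ≤⟨ ∑-mono 𝓕 (λ {A} _ → cases A) ⟩
    ∑[ A ← 𝓕 ] (⟦ mid? A ⟧ * 1 + (⟦ ∣ A ∣ <? lo ⟧ + ⟦ n ∸ lo <? ∣ A ∣ ⟧))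
      ≡⟨ trans (∑-+ 𝓕 _ _) (cong₂ _+_ (trans (sym (∑-filter mid? 𝓕 (λ _ → 1))) (∑-length middle)) (∑-+ 𝓕 _ _)) ⟩
    length middle + (∑[ A ← 𝓕 ] ⟦ ∣ A ∣ <? lo ⟧ + ∑[ A ← 𝓕 ] ⟦ n ∸ lo <? ∣ A ∣ ⟧)
      ≤⟨ +-monoʳ-≤ (length middle) (+-mono-≤ (all (λ A → ⟦ ∣ A ∣ <? lo ⟧)) (all (λ A → ⟦ n ∸ lo <? ∣ A ∣ ⟧))) ⟩
    length middle + (∑[ A ← subsets n ] ⟦ ∣ A ∣ <? lo ⟧ + ∑[ A ← subsets n ] ⟦ n ∸ lo <? ∣ A ∣ ⟧)
      ≡⟨ cong (length middle +_) (cong₂ _+_ (#size< n lo) (trans (#size> n lo lo≤n) (sym (+-identityʳ _)))) ⟩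
    length middle + 2 * ∑C< n lo ∎
    where
    open ≤-Reasoning
    open import Data.List.Membership.DecPropositional (_≟ˢ_ {n = n}) using () renaming (_∈?_ to _∈ˡ?_)
    cases : ∀ A → 1 ≤ ⟦ mid? A ⟧ * 1 + (⟦ ∣ A ∣ <? lo ⟧ + ⟦ n ∸ lo <? ∣ A ∣ ⟧)
    cases A with <-≤-connex ∣ A ∣ lo
    ... | inj₁ a<lo = ≤-trans (≤-reflexive (sym (⟦⟧-yes (∣ A ∣ <? lo) a<lo))) (≤-trans (m≤m+n _ _) (m≤n+m _ (⟦ mid? A ⟧ * 1)))
    ... | inj₂ lo≤a with ≤-<-connex ∣ A ∣ (n ∸ lo)
    ...   | inj₁ a≤hi = ≤-trans (≤-reflexive (sym (cong (_* 1) (⟦⟧-yes (mid? A) (lo≤a , a≤hi))))) (m≤m+n _ _)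
    ...   | inj₂ hi<a = ≤-trans (≤-reflexive (sym (⟦⟧-yes (n ∸ lo <? ∣ A ∣) hi<a))) (≤-trans (m≤n+m _ ⟦ ∣ A ∣ <? lo ⟧) (m≤n+m _ (⟦ mid? A ⟧ * 1)))
    all : ∀ f → ∑ 𝓕 f ≤ ∑ (subsets n) f
    all f = begin
      ∑ 𝓕 f                                              ≡⟨ ∑-cong 𝓕 (λ {A} _ → sym (trans (cong (_* f A) (⟦⟧-yes (A ∈ˡ? subsets n) (∈-subsets A))) (*-identityˡ (f A)))) ⟩
      ∑[ A ← 𝓕 ] (⟦ A ∈ˡ? subsets n ⟧ * f A)             ≡⟨ ∑-∩ _≟ˢ_ 𝓕! (subsets-unique n) f ⟩
      ∑[ A ← subsets n ] (⟦ A ∈ˡ? 𝓕 ⟧ * f A)             ≤⟨ ∑-mono (subsets n) (λ {A} _ → ≤-trans (*-monoˡ-≤ (f A) (⟦⟧≤1 (A ∈ˡ? 𝓕))) (≤-reflexive (*-identityˡ (f A)))) ⟩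
      ∑ (subsets n) f                                    ∎

module _ {n : ℕ} (F : Family n) (F! : Unique F) (s : ℕ) where

  open Windows F F!
  private ℓ = suc s

  mass-lower : length F * n ! ≤ (n C (n / 2)) * mass
  mass-lower = begin
    length F * n !                               ≡⟨ ∑-const F (n !) ⟨
    ∑[ _ ← F ] (n !)                             ≤⟨ ∑-mono F (λ {A} _ → #through-lower A) ⟩
    ∑[ A ← F ] ((n C (n / 2)) * #through A)      ≡⟨ ∑-*ˡ F (n C (n / 2)) #through ⟩
    (n C (n / 2)) * mass                         ∎
    where open ≤-Reasoning

  mass≤windows : mass ≤ length (items ℓ) + s * n !
  mass≤windows = begin
    mass
      ≡⟨ ∑-length-trace ⟨
    ∑[ c ← chains n ] length (trace c)
      ≤⟨ ∑-mono (chains n) (λ {c} _ → length-windows s (trace c)) ⟩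
    ∑[ c ← chains n ] (length (windows ℓ (trace c)) + s)
      ≡⟨ trans (∑-+ (chains n) _ _) (cong₂ _+_ (trans (∑-cong (chains n) (λ {c} _ → sym (∑-length (windows ℓ (trace c))))) (sym (∑-items ℓ (λ _ → 1))))
                                               (trans (∑-const (chains n) s) (trans (cong (_* s) (length-chains n)) (*-comm (n !) s)))) ⟩
    ∑[ _ ← items ℓ ] 1 + s * n !
      ≡⟨ cong (_+ s * n !) (∑-length (items ℓ)) ⟩
    length (items ℓ) + s * n ! ∎
    where open ≤-Reasoning

  -- Density gives E[X] ≥ s + 1 / (2k), and the expected number of windows is at least E[X] - s. The
  -- share 1 - s / E[X] is smallest at E[X] = s + 1 / (2k), where it equals 1 / (2ks + 1).
  many-windows : ∀ k → (2 * k * s + 1) * (n C (n / 2)) ≤ 2 * k * length F → 0 < mass × mass ≤ (2 * k * s + 1) * length (items ℓ)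
  many-windows k dense = 0<mass , +-cancelʳ-≤ (2 * k * s * mass) _ _ (begin
    mass + 2 * k * s * mass                         ≡⟨ l₁ (2 * k * s) mass ⟩
    K * mass                                        ≤⟨ *-monoʳ-≤ K mass≤windows ⟩
    K * (length (items ℓ) + s * n !)                ≡⟨ l₂ K (length (items ℓ)) s (n !) ⟩
    K * length (items ℓ) + s * (K * n !)            ≤⟨ +-monoʳ-≤ (K * length (items ℓ)) (*-monoʳ-≤ s Kn!≤) ⟩
    K * length (items ℓ) + s * (2 * k * mass)       ≡⟨ l₃ (K * length (items ℓ)) s (2 * k) mass ⟩
    K * length (items ℓ) + 2 * k * s * mass         ∎)
    where
    open ≤-Reasoning
    K = 2 * k * s + 1
    M = n C (n / 2)
    h≤n : n / 2 ≤ n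
    h≤n = ≤-trans (m≤n*m (n / 2) 2) (2*[n/2]≤n n)
    instance _ = >-nonZero (nCk>0 h≤n)
    Kn!≤ : K * n ! ≤ 2 * k * mass
    Kn!≤ = *-cancelˡ-≤ M (begin
      M * (K * n !)                ≡⟨ l M K (n !) ⟩
      K * M * n !                  ≤⟨ *-monoˡ-≤ (n !) dense ⟩
      2 * k * length F * n !       ≡⟨ *-assoc (2 * k) (length F) (n !) ⟩
      2 * k * (length F * n !)     ≤⟨ *-monoʳ-≤ (2 * k) mass-lower ⟩
      2 * k * (M * mass)           ≡⟨ l' (2 * k) M mass ⟩
      M * (2 * k * mass)           ∎)
      where
      l : ∀ M K x → M * (K * x) ≡ K * M * x
      l = solve-∀
      l' : ∀ a b c → a * (b * c) ≡ b * (a * c)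
      l' = solve-∀
    0<mass : 0 < mass
    0<mass = n≢0⇒n>0 λ z → n≮0 (<-≤-trans (*-mono-< (m≤n+m 1 (2 * k * s)) (n≢0⇒n>0 (≢-nonZero⁻¹ (n !) {{n !≢0}})))
                                 (≤-trans Kn!≤ (≤-reflexive (trans (cong (2 * k *_) z) (*-zeroʳ (2 * k))))))
    l₁ : ∀ a m → m + a * m ≡ (a + 1) * m
    l₁ = solve-∀
    l₂ : ∀ K w s x → K * (w + s * x) ≡ K * w + s * (K * x)
    l₂ = solve-∀
    l₃ : ∀ a s k m → a + s * (k * m) ≡ a + k * s * m
    l₃ = solve-∀

  module _ (c : Coloring n) (proper : Proper F c) where

    private
      col : Item ℓ → Fin ℓ → ℕ
      col i r = c (mark ℓ r i)

      <⇒≢ᶜ : ∀ {i} → i ∈ˡ items ℓ → ∀ r q → toℕ r < toℕ q → col i r ≢ col i q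
      <⇒≢ᶜ {i} i∈ r q r<q = proper (mark∈F ℓ i∈ r) (mark∈F ℓ i∈ q) (sub , let (x , x∈ , x∉) = ⊈-witness {A = A} {W = B} (λ B⊆A → <⇒≱ A<B (p⊆q⇒∣p∣≤∣q∣ B⊆A)) in x , x∈ , x∉)
        where
        A = mark ℓ r i
        B = mark ℓ q i
        A<B = mark-< ℓ i∈ r q r<q
        sub : A ⊆ B
        sub {x} x∈ = subst (x ∈_) (mark-lvl ℓ i∈ q) (lvl-mono (proj₁ i) (<⇒≤ A<B) (subst (x ∈_) (sym (mark-lvl ℓ i∈ r)) x∈))

      col-injective : ∀ {i} → i ∈ˡ items ℓ → ∀ r q → col i r ≡ col i q → r ≡ q
      col-injective i∈ r q e with <-cmp (toℕ r) (toℕ q)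
      ... | tri< r<q _ _ = contradiction e (<⇒≢ᶜ i∈ r q r<q)
      ... | tri≈ _ r≡q _ = toℕ-injective r≡q
      ... | tri> _ _ q<r = contradiction (sym e) (<⇒≢ᶜ i∈ q r q<r)

    rainbow-tree : (τ : Tree ℓ) (k lo hi : ℕ) → 0 < lo → lo ≤ n ∸ hi →
      suc (2 * (ℓ * ℓ) * ((2 * k * s + 1) * ℓ ^ ℓ)) * (hi ∸ lo) ≤ lo →
      (∀ {A} → A ∈ˡ F → lo ≤ ∣ A ∣ × ∣ A ∣ ≤ hi) →
      (2 * k * s + 1) * (n C (n / 2)) ≤ 2 * k * length F →
      Σ (Fin ℓ → Subset n) λ ψ → (∀ x → ψ x ∈ˡ F) × (∀ x y → Rel τ x y ⇔ (ψ x ⊆ ψ y)) × (∀ x y → c (ψ x) ≡ c (ψ y) → x ≡ y)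
    rainbow-tree τ k lo hi 0<lo lo≤n∸hi Q-small mid dense = ψ , ψ∈F , rel , rainbow
      where
      K = 2 * k * s + 1
      -- `embed` asks for 2ℓ² · mass < Q · ∣L∣, and mass is at most K · ℓ ^ ℓ · ∣L∣; the extra 1
      -- makes the inequality strict.
      Q = suc (2 * (ℓ * ℓ) * (K * ℓ ^ ℓ))
      -- `suc (∑ F c)` exceeds every colour that occurs on F.
      merge = classes ℓ (s≤s z≤n) (items ℓ) col (suc (∑ F c)) col-injective (λ i∈ r → s≤s (∑-∈ F c (mark∈F ℓ i∈ r)))
      π = proj₁ merge
      match? : ∀ i → Dec (∀ r → π (col i r) ≡ r)
      match? i = Fin.all? (λ r → π (col i r) Fin.≟ r)
      L = keep ℓ match? (allItems ℓ)
      ∣L∣ = length (SubItems.list L)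
      L≡ : ∑[ i ← items ℓ ] ⟦ match? i ⟧ ≡ ∣L∣
      L≡ = trans (∑-cong (items ℓ) (λ _ → sym (*-identityʳ _))) (trans (sym (∑-filter match? (items ℓ) (λ _ → 1))) (∑-length (SubItems.list L)))
      mass≤ : mass ≤ K * ℓ ^ ℓ * ∣L∣
      mass≤ = begin
        mass                            ≤⟨ proj₂ (many-windows k dense) ⟩
        K * length (items ℓ)            ≤⟨ *-monoʳ-≤ K (proj₂ merge) ⟩
        K * (ℓ ^ ℓ * (∑[ i ← items ℓ ] ⟦ match? i ⟧)) ≡⟨ cong (λ z → K * (ℓ ^ ℓ * z)) L≡ ⟩
        K * (ℓ ^ ℓ * ∣L∣)               ≡⟨ *-assoc K (ℓ ^ ℓ) ∣L∣ ⟨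
        K * ℓ ^ ℓ * ∣L∣                 ∎
        where open ≤-Reasoning
      0<L : 0 < ∣L∣
      0<L = n≢0⇒n>0 λ z → n≮0 (<-≤-trans (proj₁ (many-windows k dense)) (≤-trans mass≤ (≤-reflexive (trans (cong (K * ℓ ^ ℓ *_) z) (*-zeroʳ (K * ℓ ^ ℓ))))))
      big : 2 * (ℓ * ℓ) * mass < Q * ∣L∣
      big = begin-strict
        2 * (ℓ * ℓ) * mass                       ≤⟨ *-monoʳ-≤ (2 * (ℓ * ℓ)) mass≤ ⟩
        2 * (ℓ * ℓ) * (K * ℓ ^ ℓ * ∣L∣)          ≡⟨ *-assoc (2 * (ℓ * ℓ)) (K * ℓ ^ ℓ) ∣L∣ ⟨
        2 * (ℓ * ℓ) * (K * ℓ ^ ℓ) * ∣L∣          <⟨ m<n+m _ 0<L ⟩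
        ∣L∣ + 2 * (ℓ * ℓ) * (K * ℓ ^ ℓ) * ∣L∣    ∎
        where open ≤-Reasoning
      found = embed F F! lo hi Q 0<lo lo≤n∸hi Q-small mid ℓ τ (rank τ) (rank-increasing τ) L big
      ψ = proj₁ found
      marks = proj₁ (proj₂ found)
      rel = proj₂ (proj₂ found)
      ψ∈F : ∀ x → ψ x ∈ˡ F
      ψ∈F x = let (i , i∈ , e) = marks x in subst (_∈ˡ F) e (mark∈F ℓ (SubItems.sub L i∈) (rank τ x))
      class : ∀ x → π (c (ψ x)) ≡ rank τ x
      class x = let (i , i∈ , e) = marks x in trans (cong (π ∘ c) (sym e)) (proj₂ (∈-filter⁻ match? {xs = items ℓ} i∈) (rank τ x))
      rainbow : ∀ x y → c (ψ x) ≡ c (ψ y) → x ≡ y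
      rainbow x y e = rank-injective τ x y (trans (sym (class x)) (trans (cong π e) (class y)))

RainbowTree : ∀ {n s} → Tree s → Family n → Coloring n → Set
RainbowTree {n} {s} τ 𝓕 c =
  Σ (Fin s → Subset n) λ ψ → (∀ x → ψ x ∈ˡ 𝓕) × (∀ x y → Rel τ x y ⇔ (ψ x ⊆ ψ y)) × (∀ x y → c (ψ x) ≡ c (ψ y) → x ≡ y)

-- The middle levels used are those within 2g of n / 2, where g is a small constant fraction of n.
no-rainbow⇒small : ∀ {s} (τ : Tree (suc s)) (k Q d g n : ℕ) → Q ≡ suc (2 * (suc s * suc s) * ((2 * k * s + 1) * suc s ^ suc s)) →
  1 ≤ g → (5 * Q + 2) * g ≤ n / 2 → n / 2 ≤ 2 * (d * g) → 4 * k * (d * d) ≤ g →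
  (𝓕 : Family n) → Unique 𝓕 → (c : Coloring n) → Proper 𝓕 c → ¬ RainbowTree τ 𝓕 c → k * length 𝓕 ≤ (k * s + 1) * (n C (n / 2))
no-rainbow⇒small {s} τ k Q d g n Q≡ 1≤g Qg≤h h≤2dg 4kdd≤g 𝓕 𝓕! c proper ¬rainbow = ≮⇒≥ λ large →
  ¬rainbow (let (ψ , ψ∈ , rest) = found large in ψ , (λ x → proj₁ (∈-filter⁻ (mid? 𝓕 𝓕! lo) {xs = 𝓕} (ψ∈ x))) , rest)
  where
  open ≤-Reasoning
  h = n / 2
  M = n C h
  K = 2 * k * s + 1
  lo = h ∸ 2 * g
  F = middle 𝓕 𝓕! lo
  5Qg+2g≤h : 5 * Q * g + 2 * g ≤ h
  5Qg+2g≤h = subst (_≤ h) (*-distribʳ-+ g (5 * Q) 2) Qg≤h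
  2g≤h : 2 * g ≤ h
  2g≤h = ≤-trans (m≤n+m (2 * g) (5 * Q * g)) 5Qg+2g≤h
  5Qg≤lo : 5 * Q * g ≤ lo
  5Qg≤lo = m+n≤o⇒m≤o∸n (5 * Q * g) 5Qg+2g≤h
  1≤Q : 1 ≤ Q
  1≤Q = subst (1 ≤_) (sym Q≡) (s≤s z≤n)
  0<lo : 0 < lo
  0<lo = ≤-trans (*-mono-≤ (*-mono-≤ (s≤s (z≤n {4})) 1≤Q) 1≤g) 5Qg≤lo
  lo+2g≡h : lo + 2 * g ≡ h
  lo+2g≡h = m∸n+n≡m 2g≤h
  lo≤n : lo ≤ n
  lo≤n = ≤-trans (m∸n≤m h (2 * g)) (≤-trans (m≤n*m h 2) (2*[n/2]≤n n))
  -- The width is at most 1 + 4g, the 1 being due to odd n and absorbed by g ≥ 1. This is the 5 in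
  -- 5Q + 2; the 2 there pays for lo = h - 2g.
  gap : n ∸ lo ∸ lo ≤ 5 * g
  gap = m≤n+o⇒m∸n≤o (n ∸ lo) lo (m≤n+o⇒m∸n≤o n lo (begin
    n                           ≤⟨ n≤1+2*[n/2] n ⟩
    1 + 2 * h                   ≡⟨ cong (λ h → 1 + 2 * h) lo+2g≡h ⟨
    1 + 2 * (lo + 2 * g)        ≤⟨ +-monoˡ-≤ _ 1≤g ⟩
    g + 2 * (lo + 2 * g)        ≡⟨ l lo g ⟩
    lo + (lo + 5 * g)           ∎))
    where l : ∀ x g → g + 2 * (x + 2 * g) ≡ x + (x + 5 * g)
          l = solve-∀
  Q-small : Q * (n ∸ lo ∸ lo) ≤ lo
  Q-small = begin
    Q * (n ∸ lo ∸ lo)   ≤⟨ *-monoʳ-≤ Q gap ⟩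
    Q * (5 * g)         ≡⟨ l Q g ⟩
    5 * Q * g           ≤⟨ 5Qg≤lo ⟩
    lo                  ∎
    where l : ∀ Q g → Q * (5 * g) ≡ 5 * Q * g
          l = solve-∀
  tail : 4 * k * ∑C< n lo ≤ M
  tail = ∑C<-tail n g d (4 * k) 1≤g 2g≤h h≤2dg 4kdd≤g
  -- Both tails together have at most M / (2k) sets, half of the surplus M / k of 𝓕 over sM.
  dense : (k * s + 1) * M < k * length 𝓕 → K * M ≤ 2 * k * length F
  dense large = +-cancelʳ-≤ (4 * k * ∑C< n lo) _ _ (begin
    K * M + 4 * k * ∑C< n lo                          ≤⟨ +-monoʳ-≤ (K * M) tail ⟩
    K * M + M                                         ≡⟨ l₁ k s M ⟩
    2 * ((k * s + 1) * M)                             ≤⟨ *-monoʳ-≤ 2 (<⇒≤ large) ⟩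
    2 * (k * length 𝓕)                                ≤⟨ *-monoʳ-≤ 2 (*-monoʳ-≤ k (length-middle 𝓕 𝓕! lo lo≤n)) ⟩
    2 * (k * (length F + 2 * ∑C< n lo))               ≡⟨ l₂ k (length F) (∑C< n lo) ⟩
    2 * k * length F + 4 * k * ∑C< n lo               ∎)
    where
    l₁ : ∀ k s M → (2 * k * s + 1) * M + M ≡ 2 * ((k * s + 1) * M)
    l₁ = solve-∀
    l₂ : ∀ k f S → 2 * (k * (f + 2 * S)) ≡ 2 * k * f + 4 * k * S
    l₂ = solve-∀
  F! : Unique F
  F! = Unique.filter⁺ (mid? 𝓕 𝓕! lo) 𝓕!
  proper' : Proper F c
  proper' A∈ B∈ = proper (proj₁ (∈-filter⁻ (mid? 𝓕 𝓕! lo) {xs = 𝓕} A∈)) (proj₁ (∈-filter⁻ (mid? 𝓕 𝓕! lo) {xs = 𝓕} B∈))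
  found : (k * s + 1) * M < k * length 𝓕 → RainbowTree τ F c
  found large = rainbow-tree F F! s c proper' τ k lo (n ∸ lo) 0<lo (≤-reflexive (sym (m∸[m∸n]≡n lo≤n)))
    (subst (λ Q → Q * (n ∸ lo ∸ lo) ≤ lo) Q≡ Q-small)
    (λ A∈ → proj₂ (∈-filter⁻ (mid? 𝓕 𝓕! lo) {xs = 𝓕} A∈)) (dense large)

[n/2]/d-large : ∀ d .{{_ : NonZero d}} G n → G * d * 2 ≤ n → G ≤ n / 2 / d
[n/2]/d-large d G n le = subst (_≤ n / 2 / d) (m*n/n≡m G d) (/-monoˡ-≤ d (subst (_≤ n / 2) (m*n/n≡m (G * d) 2) (/-monoˡ-≤ 2 le)))

h≤2d[h/d] : ∀ d .{{_ : NonZero d}} h → 1 ≤ h / d → h ≤ 2 * (d * (h / d))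
h≤2d[h/d] d h 1≤g = begin
  h                         ≡⟨ m≡m%n+[m/n]*n h d ⟩
  h % d + h / d * d         ≤⟨ +-monoˡ-≤ (h / d * d) (<⇒≤ (m%n<n h d)) ⟩
  d + h / d * d             ≤⟨ +-monoˡ-≤ (h / d * d) (m≤n*m d (h / d) {{>-nonZero 1≤g}}) ⟩
  h / d * d + h / d * d     ≡⟨ l (h / d) d ⟩
  2 * (d * (h / d))         ∎
  where
  open ≤-Reasoning
  l : ∀ g d → g * d + g * d ≡ 2 * (d * g)
  l = solve-∀

-- With g = ⌊⌊n / 2⌋ / d⌋ and d = 5Q + 2, the product d · g is at most n / 2 and at least half of ⌊n
-- / 2⌋, while g exceeds the constant 4kd² once n is large.
upper-bound-at : ∀ {s} (τ : Tree (suc s)) (k Q d : ℕ) .{{_ : NonZero d}} →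
  Q ≡ suc (2 * (suc s * suc s) * ((2 * k * s + 1) * suc s ^ suc s)) → d ≡ 5 * Q + 2 →
  ∀ n → suc (4 * k * (d * d)) * d * 2 ≤ n → (𝓕 : Family n) → Unique 𝓕 → (c : Coloring n) → Proper 𝓕 c →
  ¬ RainbowTree τ 𝓕 c → k * length 𝓕 ≤ (k * s + 1) * (n C (n / 2))
upper-bound-at τ k Q d Q≡ d≡ n N≤n = no-rainbow⇒small τ k Q d g n Q≡ 1≤g
  (subst (λ d' → d' * g ≤ n / 2) d≡ (subst (_≤ n / 2) (*-comm g d) (m/n*n≤m (n / 2) d)))
  (h≤2d[h/d] d (n / 2) 1≤g) (≤-trans (n≤1+n _) G≤g)
  where
  g = n / 2 / d
  G≤g : suc (4 * k * (d * d)) ≤ g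
  G≤g = [n/2]/d-large d (suc (4 * k * (d * d))) n N≤n
  1≤g : 1 ≤ g
  1≤g = ≤-trans (s≤s z≤n) G≤g

upper-bound : ∀ {s} (τ : Tree (suc s)) (k : ℕ) → ∃[ N ] (∀ n → N ≤ n → (𝓕 : Family n) → Unique 𝓕 → (c : Coloring n) → Proper 𝓕 c →
  ¬ RainbowTree τ 𝓕 c → k * length 𝓕 ≤ (k * s + 1) * (n C (n / 2)))
upper-bound {s} τ k = _ , upper-bound-at τ k Q (5 * Q + 2) {{>-nonZero (≤-trans (s≤s z≤n) (m≤n+m 2 (5 * Q)))}} refl refl
  where Q = suc (2 * (suc s * suc s) * ((2 * k * s + 1) * suc s ^ suc s))

-- Tree posets are built by adding leaves

module TreePoset (T : FinPoset) where
  open FinPoset T using (size; _≼_)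
  open import Relation.Binary.Structures using (IsPartialOrder)
  open IsPartialOrder (FinPoset.isPartialOrder T) using () renaming (refl to ≼-refl; trans to ≼-trans; antisym to ≼-antisym)

  private
    V = Fin size
    E : V → V → Set
    E = HasseEdge T
    infix 4 _≺ᵀ_
    _≺ᵀ_ : V → V → Set
    _≺ᵀ_ = _≺_ T

  E-sym : ∀ {x y} → E x y → E y x
  E-sym (inj₁ p) = inj₂ p
  E-sym (inj₂ p) = inj₁ p

  -- The predicate on vertices expresses avoiding a vertex, staying in an interval, or staying in
  -- the part of T already built.
  data Walk[_] (S : V → Set) : V → V → Set where
    stop : ∀ {x} → S x → Walk[ S ] x x
    step : ∀ {x y z} → S x → E x y → Walk[ S ] y z → Walk[ S ] x z

  weaken : ∀ {S R : V → Set} {x y} → (∀ {z} → S z → R z) → Walk[ S ] x y → Walk[ R ] x y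
  weaken f (stop s)     = stop (f s)
  weaken f (step s e w) = step (f s) e (weaken f w)

  _◅◅_ : ∀ {S x y z} → Walk[ S ] x y → Walk[ S ] y z → Walk[ S ] x z
  stop _     ◅◅ w' = w'
  step s e w ◅◅ w' = step s e (w ◅◅ w')

  first : ∀ {S x y} → Walk[ S ] x y → S x
  first (stop s)     = s
  first (step s _ _) = s

  reverse : ∀ {S x y} → Walk[ S ] x y → Walk[ S ] y x
  reverse (stop s)     = stop s
  reverse (step s e w) = reverse w ◅◅ step (first w) (E-sym e) (stop s)

  record Path (S : V → Set) (x y : V) : Set where
    constructor path
    field
      rest   : List V
      linked : Linked E (x ∷ rest)
      ends   : List.last (x ∷ rest) ≡ just y
      unique : Unique (x ∷ rest)
      allS   : All S (x ∷ rest)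

  cut : ∀ {S : V → Set} {y} x v vs → x ∈ˡ (v ∷ vs) → Linked E (v ∷ vs) → List.last (v ∷ vs) ≡ just y → Unique (v ∷ vs) → All S (v ∷ vs) → Path S x y
  cut x .x vs        (here refl) l         e u       a       = path vs l e u a
  cut x v  (w ∷ vs)  (there p)   (_ ∷ l)   e (_ ∷ u) (_ ∷ a) = cut x w vs p l e u a

  -- Loop erasure: if x already occurs on the path found from its neighbour, the path is cut back to
  -- that occurrence.
  erase : ∀ {S x y} → Walk[ S ] x y → Path S x y
  erase (stop s) = path [] [-] refl ([] ∷ []) (s ∷ [])
  erase (step {x} {y} s e w) with erase w
  ... | path vs l end u a with Any.any? (x Fin.≟_) (y ∷ vs)
  ...   | yes x∈ = cut x y vs x∈ l end u a
  ...   | no x∉  = path (y ∷ vs) (e ∷ l) end (All.tabulate (λ z∈ x≡z → x∉ (subst (_∈ˡ (y ∷ vs)) (sym x≡z) z∈)) ∷ u) (s ∷ a)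

  -- Otherwise a path from a to b that avoids v is closed by v to a cycle; it has at least three
  -- vertices because a and b differ.
  unique-neighbour : Acyclic T → ∀ {v a b} → E v a → E v b → Walk[ _≢ v ] a b → a ≡ b
  unique-neighbour acyclic {v} {a} {b} va vb w with erase w
  ... | path [] l refl u av = refl
  ... | path (x ∷ vs) l end u av = contradiction
    (s≤s (s≤s (s≤s z≤n)) , All.map (λ z≢v v≡z → z≢v (sym v≡z)) av ∷ u , va ∷ l , v , b , refl , end , E-sym vb)
    (acyclic (v ∷ a ∷ x ∷ vs))

  -- p is the vertex just before the first visit to v, so the walk up to p avoids v.
  last-step : ∀ {S x v} → Walk[ S ] x v → x ≢ v → ∃[ p ] (E p v × S p × Walk[ _≢ v ] x p)
  last-step (stop _) x≢v = contradiction refl x≢v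
  last-step {v = v} (step {x} {y} s e w) x≢v with y Fin.≟ v
  ... | yes refl = x , e , s , stop x≢v
  ... | no y≢v   = let (p , pv , sp , w') = last-step w y≢v in p , pv , sp , step x≢v e w'

  exit : ∀ {S : V → Set} (P? : ∀ x → Dec (S x)) {x y} → Walk[ (λ _ → ⊤) ] x y → S x → ¬ S y → ∃[ a ] ∃[ b ] (S a × ¬ S b × E a b)
  exit P? (stop _) sx ¬sy = contradiction sx ¬sy
  exit P? (step {x} {y} _ e w) sx ¬sz with P? y
  ... | yes sy = exit P? w sy ¬sz
  ... | no ¬sy = x , y , sx , ¬sy , e

  from-Walk : ∀ {x y} vs → Walk T x y vs → Walk[ (λ _ → ⊤) ] x y
  from-Walk (v ∷ [])     (refl , refl , _)     = stop tt
  from-Walk (v ∷ w ∷ vs) (refl , end , e ∷ l)  = step tt e (from-Walk (w ∷ vs) (refl , end , l))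

  Interval : V → V → V → Set
  Interval x y z = x ≼ z × z ≼ y

  -- The order is not assumed to be decidable, so a saturated chain exists only up to double negation.
  saturated : ∀ m (zs : List V) → length zs ≤ m → ∀ {x y} → (∀ z → x ≺ᵀ z → z ≺ᵀ y → z ∈ˡ zs) → x ≼ y → ¬ ¬ Walk[ Interval x y ] x y
  saturated m zs ≤m {x} {y} between x≼y k with x Fin.≟ y
  ... | yes refl = k (stop (≼-refl , ≼-refl))
  -- Since `k` refutes all walks, no z can lie strictly between x and y: walks from x to z and from
  -- z to y, found among fewer candidates, would compose. Hence y covers x, and this single edge is
  -- a walk after all.
  ... | no x≢y   = k (step (≼-refl , x≼y) (inj₂ ((x≼y , x≢y) , λ z (x≺z , z≺y) → split m zs ≤m between z x≺z z≺y)) (stop (x≼y , ≼-refl)))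
    where
    split : ∀ m (zs : List V) → length zs ≤ m → (∀ z → x ≺ᵀ z → z ≺ᵀ y → z ∈ˡ zs) → ∀ z → x ≺ᵀ z → z ≺ᵀ y → ⊥
    split zero    []  _  between z x≺z z≺y = contradiction (between z x≺z z≺y) λ ()
    split (suc m) zs ≤m between z x≺z z≺y =
      saturated m zs' ≤m' (λ a x≺a a≺z → keep-a (between a x≺a (≼-trans (proj₁ a≺z) (proj₁ z≺y) , λ { refl → proj₂ a≺z (≼-antisym (proj₁ a≺z) (proj₁ z≺y)) })) (proj₂ a≺z)) (proj₁ x≺z) λ w₁ →
      saturated m zs' ≤m' (λ a z≺a a≺y → keep-a (between a (≼-trans (proj₁ x≺z) (proj₁ z≺a) , λ { refl → proj₂ x≺z (≼-antisym (proj₁ x≺z) (proj₁ z≺a)) }) a≺y) (λ a≡z → proj₂ z≺a (sym a≡z))) (proj₁ z≺y) λ w₂ →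
      k (weaken (λ (p , q) → p , ≼-trans q (proj₁ z≺y)) w₁ ◅◅ weaken (λ (p , q) → ≼-trans (proj₁ x≺z) p , q) w₂)
      where
      zs' = filter (λ a → ¬? (a Fin.≟ z)) zs
      ≤m' : length zs' ≤ m
      ≤m' = s≤s⁻¹ (≤-trans (List.filter-notAll (λ a → ¬? (a Fin.≟ z)) zs (lose (between z x≺z z≺y) (λ z≢z → z≢z refl))) ≤m)
      keep-a : ∀ {a} → a ∈ˡ zs → a ≢ z → a ∈ˡ zs'
      keep-a a∈ a≢z = ∈-filter⁺ (λ a → ¬? (a Fin.≟ z)) a∈ a≢z

  ascend : ∀ {x y} → x ≼ y → ¬ ¬ Walk[ Interval x y ] x y
  ascend = saturated (length (allFin size)) (allFin size) ≤-refl (λ z _ _ → ∈-allFin z)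

  -- A part of T rebuilt as a `Tree`, with the induced order. It is connected inside its own image,
  -- so its walks avoid every vertex not yet reached.
  record Partial (m : ℕ) : Set where
    field
      tree      : Tree m
      at        : Fin m → V
      injective : ∀ x y → at x ≡ at y → x ≡ y
      rel       : ∀ x y → (at x ≼ at y) ⇔ Rel tree x y
      connected : ∀ x y → Walk[ (λ z → ∃[ i ] at i ≡ z) ] (at x) (at y)

  module _ (acyclic : Acyclic T) {m : ℕ} (P : Partial m) (u : Fin m) (v : V) (v∉ : ¬ (∃[ i ] Partial.at P i ≡ v)) (uv : E (Partial.at P u) v) where
    open Partial P

    private
      at' : Fin (suc m) → V
      at' zero    = v
      at' (suc x) = at x

      injective' : ∀ x y → at' x ≡ at' y → x ≡ y
      injective' zero    zero    _ = refl
      injective' zero    (suc y) e = contradiction (y , sym e) v∉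
      injective' (suc x) zero    e = contradiction (x , e) v∉
      injective' (suc x) (suc y) e = cong suc (injective x y e)

      within : ∀ x y → Walk[ (λ z → ∃[ i ] at' i ≡ z) ] (at x) (at y)
      within x y = weaken (λ (i , e) → suc i , e) (connected x y)

      connected' : ∀ x y → Walk[ (λ z → ∃[ i ] at' i ≡ z) ] (at' x) (at' y)
      connected' zero    zero    = stop (zero , refl)
      connected' zero    (suc y) = step (zero , refl) (E-sym uv) (within u y)
      connected' (suc x) zero    = within x u ◅◅ step (suc u , refl) uv (stop (zero , refl))
      connected' (suc x) (suc y) = within x y

      avoiding : ∀ x y → Walk[ _≢ v ] (at x) (at y)
      avoiding x y = weaken (λ { (i , e) z≡v → v∉ (i , trans e z≡v) }) (connected x y)

      -- A walk from at x to v enters v through at u: otherwise it would close a cycle.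
      enters-at-u : ∀ {S x} → Walk[ S ] (at x) v → S (at u)
      enters-at-u {S} {x} w =
        let (p , pv , sp , w') = last-step w (λ e → v∉ (x , e))
        in subst S (sym (unique-neighbour acyclic (E-sym uv) (E-sym pv) (avoiding u x ◅◅ w'))) sp

      -- The relation is realised by Hasse edges inside the interval from `at x` to v. Such a walk
      -- enters v through `at u`, so `at u` lies in the interval.
      below-v : ∀ x → at x ≼ v → ¬ ¬ (at x ≼ at u × at u ≼ v)
      below-v x x≼v k = ascend x≼v (λ w → k (enters-at-u w))

      above-v : ∀ x → v ≼ at x → ¬ ¬ (v ≼ at u × at u ≼ at x)
      above-v x v≼x k = ascend v≼x (λ w → k (enters-at-u (reverse w)))

    attach : Partial (suc m)
    attach = go uv
      where
      go : E (at u) v → Partial (suc m)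
      go (inj₂ ((u≼v , u≢v) , _)) = record { tree = up tree u ; at = at' ; injective = injective' ; rel = rel' ; connected = connected' }
        where
        rel' : ∀ x y → (at' x ≼ at' y) ⇔ Rel (up tree u) x y
        rel' zero    zero    = mk⇔ (λ _ → tt) (λ _ → ≼-refl)
        rel' zero    (suc y) = mk⇔ (λ v≼y → above-v y v≼y (λ (v≼u , _) → u≢v (≼-antisym u≼v v≼u))) (λ ())
        rel' (suc x) zero    = mk⇔ (λ x≼v → decidable-stable (rel? tree x u) (λ ¬r → below-v x x≼v (λ (x≼u , _) → ¬r (Equivalence.to (rel x u) x≼u))))
                                   (λ r → ≼-trans (Equivalence.from (rel x u) r) u≼v)
        rel' (suc x) (suc y) = rel x y
      go (inj₁ ((v≼u , v≢u) , _)) = record { tree = dn tree u ; at = at' ; injective = injective' ; rel = rel' ; connected = connected' }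
        where
        rel' : ∀ x y → (at' x ≼ at' y) ⇔ Rel (dn tree u) x y
        rel' zero    zero    = mk⇔ (λ _ → tt) (λ _ → ≼-refl)
        rel' (suc x) zero    = mk⇔ (λ x≼v → below-v x x≼v (λ (_ , u≼v) → v≢u (≼-antisym v≼u u≼v))) (λ ())
        rel' zero    (suc y) = mk⇔ (λ v≼y → decidable-stable (rel? tree u y) (λ ¬r → above-v y v≼y (λ (_ , u≼y) → ¬r (Equivalence.to (rel u y) u≼y))))
                                   (λ r → ≼-trans v≼u (Equivalence.from (rel u y) r))
        rel' (suc x) (suc y) = rel x y

  record Presentation : Set where
    field
      {s}     : ℕ
      partial : Partial (suc s)
      index   : V → Fin (suc s)
      at∘index : ∀ x → Partial.at partial (index x) ≡ x

  -- While a vertex is missing, connectedness gives an edge leaving the part already built. Each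
  -- round adds a vertex and `at` stays injective, so the fuel `size` suffices.
  present : IsTreePoset T → Presentation
  present (0<size , conn , acyclic) = grow size start (m≤n+m size 1)
    where
    start : Partial 1
    start = record
      { tree = • ; at = λ _ → Fin.fromℕ< 0<size ; injective = λ { zero zero _ → refl }
      ; rel = λ _ _ → mk⇔ (λ _ → tt) (λ _ → ≼-refl) ; connected = λ _ _ → stop (zero , refl) }
    grow : ∀ fuel {s} → Partial (suc s) → size ≤ suc s + fuel → Presentation
    grow fuel {s} P size≤ with Fin.any? (λ v → ¬? (Fin.any? (λ i → Partial.at P i Fin.≟ v)))
    ... | no none = record { partial = P ; index = proj₁ ∘ hit ; at∘index = proj₂ ∘ hit }
      where
      hit : ∀ v → ∃[ i ] Partial.at P i ≡ v
      hit v = decidable-stable (Fin.any? (λ i → Partial.at P i Fin.≟ v)) (λ miss → none (v , miss))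
    ... | yes (v , v∉) with exit (λ x → Fin.any? (λ i → Partial.at P i Fin.≟ x)) (let (vs , w) = conn (Partial.at P zero) v in from-Walk vs w) (zero , refl) v∉
    ...   | _ , b , (u , refl) , b∉ , ub with fuel
    ...     | suc fuel' = grow fuel' (attach acyclic P u b b∉ ub) (≤-trans size≤ (≤-reflexive (+-suc (suc s) fuel')))
    ...     | zero = contradiction (≤-trans (Fin.injective⇒≤ (λ {x} {y} → Partial.injective (attach acyclic P u b b∉ ub) x y)) (≤-trans size≤ (≤-reflexive (+-identityʳ (suc s))))) 1+n≰n

-- Good families of every size are decidable

-- `IsLaStar` asks for an attained maximum, so it has to be decided for which sizes good families
-- exist. The search needs a decidable order, which `Rel` is and that of T need not be.
TreeGood : ∀ {s} n → Tree s → Family n → Set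
TreeGood n τ 𝓕 = Unique 𝓕 × Σ (Coloring n) λ c → Proper 𝓕 c × ¬ RainbowTree τ 𝓕 c

least : ∀ {l} {P : Fin l → Set} → (∀ i → Dec (P i)) → ∃ P → ∃[ i ] (P i × ∀ j → P j → toℕ i ≤ toℕ j)
least {l} {P} P? (i₀ , p₀) with Fin.¬∀⟶∃¬-smallest l (¬_ ∘ P) (¬? ∘ P?) (λ none → none i₀ p₀)
... | i , ¬¬p , below = i , decidable-stable (P? i) ¬¬p , λ j p → ≮⇒≥ λ j<i →
  below (Fin.fromℕ< j<i) (subst P (toℕ-injective (sym (trans (Fin.toℕ-inject _) (Fin.toℕ-fromℕ< j<i)))) p)

-- Each index is recoloured by the least index of the same colour. So a family of l sets needs only
-- l colours, and the search over colourings is finite.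
compress : ∀ {l} (f : Fin l → ℕ) → Σ (Fin l → Fin l) λ g → ∀ i j → (g i ≡ g j) ⇔ (f i ≡ f j)
compress {l} f = g , λ i j → mk⇔ (to i j) (from i j)
  where
  first : ∀ i → ∃[ k ] (f k ≡ f i × ∀ j → f j ≡ f i → toℕ k ≤ toℕ j)
  first i = least (λ k → f k ≟ f i) (i , refl)
  g : Fin l → Fin l
  g i = proj₁ (first i)
  to : ∀ i j → g i ≡ g j → f i ≡ f j
  to i j e = trans (sym (proj₁ (proj₂ (first i)))) (trans (cong f e) (proj₁ (proj₂ (first j))))
  from : ∀ i j → f i ≡ f j → g i ≡ g j
  from i j e = toℕ-injective (≤-antisym (proj₂ (proj₂ (first i)) (g j) (trans (proj₁ (proj₂ (first j))) (sym e)))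
                                        (proj₂ (proj₂ (first j)) (g i) (trans (proj₁ (proj₂ (first i))) e)))

Unique⇒lookup-injective : ∀ {A : Set} {xs : List A} → Unique xs → ∀ i j → List.lookup xs i ≡ List.lookup xs j → i ≡ j
Unique⇒lookup-injective (x∉ ∷ u) zero    zero    e = refl
Unique⇒lookup-injective (x∉ ∷ u) zero    (suc j) e = contradiction e (All.lookup x∉ (∈-lookup j))
Unique⇒lookup-injective (x∉ ∷ u) (suc i) zero    e = contradiction (sym e) (All.lookup x∉ (∈-lookup i))
Unique⇒lookup-injective (x∉ ∷ u) (suc i) (suc j) e = cong suc (Unique⇒lookup-injective u i j e)

module _ {n s : ℕ} (τ : Tree s) where

  module _ {l : ℕ} (v : Fin l → Subset n) (col : Fin l → Fin l) where

    Bad : Vec (Fin l) s → Set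
    Bad φ = (∀ x y → (Rel τ x y → v (lookup φ x) ⊆ v (lookup φ y)) × (v (lookup φ x) ⊆ v (lookup φ y) → Rel τ x y))
          × (∀ x y → col (lookup φ x) ≡ col (lookup φ y) → x ≡ y)

    Encoded : Set
    Encoded = (∀ i j → v i ≡ v j → i ≡ j) × (∀ i j → v i ⊂ v j → col i ≢ col j) × ¬ ∃ Bad

    encoded? : Dec Encoded
    encoded? = Fin.all? (λ i → Fin.all? λ j → (v i ≟ˢ v j) →-dec (i Fin.≟ j))
         ×-dec Fin.all? (λ i → Fin.all? λ j → (v i Sub.⊂? v j) →-dec ¬? (col i Fin.≟ col j))
         ×-dec ¬? (anyVec? Fin.any? λ φ →
                 Fin.all? (λ x → Fin.all? λ y → (rel? τ x y →-dec (v (lookup φ x) ⊆? v (lookup φ y)))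
                                         ×-dec ((v (lookup φ x) ⊆? v (lookup φ y)) →-dec rel? τ x y))
           ×-dec Fin.all? (λ x → Fin.all? λ y → (col (lookup φ x) Fin.≟ col (lookup φ y)) →-dec (x Fin.≟ y)))

    decode : Encoded → ∃[ 𝓕 ] (TreeGood n τ 𝓕 × length 𝓕 ≡ l)
    decode (inj , proper , ¬bad) = 𝓕 , (Unique.tabulate⁺ (λ {i} {j} → inj i j) , c , proper' , ¬rainbow) , List.length-tabulate v
      where
      𝓕 = List.tabulate v
      look : ∀ {A} → Dec (∃[ i ] v i ≡ A) → ℕ
      look (yes (i , _)) = toℕ (col i)
      -- Sets outside the family get a default colour; properness and rainbow copies involve members
      -- only.
      look (no _)        = 0
      c : Coloring n
      c A = look (Fin.any? (λ i → v i ≟ˢ A))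
      look-v : ∀ i (d : Dec (∃[ j ] v j ≡ v i)) → look d ≡ toℕ (col i)
      look-v i (yes (j , e)) = cong (toℕ ∘ col) (inj j i e)
      look-v i (no none)     = contradiction (i , refl) none
      c-v : ∀ i → c (v i) ≡ toℕ (col i)
      c-v i = look-v i (Fin.any? (λ j → v j ≟ˢ v i))
      proper' : Proper 𝓕 c
      proper' F∈ F'∈ F⊂F' e with ∈-tabulate⁻ {f = v} F∈ | ∈-tabulate⁻ {f = v} F'∈
      ... | i , refl | j , refl = proper i j F⊂F' (toℕ-injective (trans (sym (c-v i)) (trans e (c-v j))))
      ¬rainbow : ¬ RainbowTree τ 𝓕 c
      ¬rainbow (ψ , ψ∈ , rel , rainbow) = ¬bad (tabulate idx , ok , ok')
        where
        idx : Fin s → Fin l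
        idx x = proj₁ (∈-tabulate⁻ {f = v} (ψ∈ x))
        v-idx : ∀ x → v (lookup (tabulate idx) x) ≡ ψ x
        v-idx x = trans (cong v (lookup∘tabulate idx x)) (sym (proj₂ (∈-tabulate⁻ {f = v} (ψ∈ x))))
        ok : ∀ x y → (Rel τ x y → v (lookup (tabulate idx) x) ⊆ v (lookup (tabulate idx) y)) × (v (lookup (tabulate idx) x) ⊆ v (lookup (tabulate idx) y) → Rel τ x y)
        ok x y = subst₂ (λ A B → (Rel τ x y → A ⊆ B) × (A ⊆ B → Rel τ x y)) (sym (v-idx x)) (sym (v-idx y)) (Equivalence.to (rel x y) , Equivalence.from (rel x y))
        ok' : ∀ x y → col (lookup (tabulate idx) x) ≡ col (lookup (tabulate idx) y) → x ≡ y
        ok' x y e = rainbow x y (trans (c-ψ x) (trans (cong toℕ e) (sym (c-ψ y))))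
          where
          c-ψ : ∀ x → c (ψ x) ≡ toℕ (col (lookup (tabulate idx) x))
          c-ψ x = trans (cong c (sym (v-idx x))) (c-v (lookup (tabulate idx) x))

  encode : (𝓕 : Family n) → TreeGood n τ 𝓕 → Σ (Fin (length 𝓕) → Fin (length 𝓕)) (Encoded (List.lookup 𝓕))
  encode 𝓕 (𝓕! , c , proper , ¬rainbow) = g , Unique⇒lookup-injective 𝓕! ,
    (λ i j v⊂v e → proper (∈-lookup i) (∈-lookup j) v⊂v (Equivalence.to (g⇔ i j) e)) ,
    λ (φ , rel , rainbow) → ¬rainbow ((List.lookup 𝓕 ∘ lookup φ) , (λ x → ∈-lookup (lookup φ x)) ,
      (λ x y → record { to = proj₁ (rel x y) ; from = proj₂ (rel x y) ; to-cong = λ { refl → refl } ; from-cong = λ { refl → refl } }) ,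
      λ x y e → rainbow x y (Equivalence.from (g⇔ _ _) e))
    where
    g  = proj₁ (compress (c ∘ List.lookup 𝓕))
    g⇔ = proj₂ (compress (c ∘ List.lookup 𝓕))

  encoded-cong : ∀ {l} {v v' : Fin l → Subset n} {col col' : Fin l → Fin l} → (∀ i → v i ≡ v' i) → (∀ i → col i ≡ col' i) → Encoded v col → Encoded v' col'
  encoded-cong {v = v} {v'} {col} {col'} v≡ col≡ (inj , proper , ¬bad) =
    (λ i j e → inj i j (trans (v≡ i) (trans e (sym (v≡ j))))) ,
    (λ i j v⊂v e → proper i j (subst₂ _⊂_ (sym (v≡ i)) (sym (v≡ j)) v⊂v) (trans (col≡ i) (trans e (sym (col≡ j))))) ,
    λ (φ , rel , rainbow) → ¬bad (φ ,
      (λ x y → subst₂ (λ A B → (Rel τ x y → A ⊆ B) × (A ⊆ B → Rel τ x y)) (sym (v≡ (lookup φ x))) (sym (v≡ (lookup φ y))) (rel x y)) ,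
      (λ x y e → rainbow x y (trans (sym (col≡ (lookup φ x))) (trans e (col≡ (lookup φ y))))))

  good-size? : ∀ l → Dec (∃[ 𝓕 ] (TreeGood n τ 𝓕 × length 𝓕 ≡ l))
  good-size? l = map′ (λ (v , col , enc) → decode (lookup v) (lookup col) enc) to
    (anyVec? Sub.anySubset? {l} λ v → anyVec? Fin.any? {l} λ col → encoded? (lookup v) (lookup col))
    where
    to : ∃[ 𝓕 ] (TreeGood n τ 𝓕 × length 𝓕 ≡ l) → Σ (Vec (Subset n) l) λ v → Σ (Vec (Fin l) l) λ col → Encoded (lookup v) (lookup col)
    to (𝓕 , good , refl) = let (g , enc) = encode 𝓕 good in
      tabulate (List.lookup 𝓕) , tabulate g ,
      encoded-cong (λ i → sym (lookup∘tabulate (List.lookup 𝓕) i)) (λ i → sym (lookup∘tabulate g i)) enc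

greatest : {P : ℕ → Set} → (∀ l → Dec (P l)) → ∀ B → ∃[ l ] (P l × l ≤ B) → ∃[ m ] (P m × ∀ l → P l → l ≤ B → l ≤ m)
greatest P? zero    (.0 , p , z≤n) = 0 , p , λ _ _ l≤0 → l≤0
greatest {P} P? (suc B) (l , p , l≤) with P? (suc B)
... | yes q = suc B , q , λ _ _ l≤ → l≤
... | no ¬q = let (m , pm , max) = greatest P? B (l , p , shrink p l≤) in m , pm , λ l p l≤ → max l p (shrink p l≤)
  where
  shrink : ∀ {l} → P l → l ≤ suc B → l ≤ B
  shrink p l≤ = s≤s⁻¹ (≤∧≢⇒< l≤ (λ { refl → ¬q p }))

module _ (T : FinPoset) (pres : TreePoset.Presentation T) {n : ℕ} (𝓕 : Family n) where
  open TreePoset T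
  open Presentation pres
  open Partial partial

  Good⇒TreeGood : Good n T 𝓕 → TreeGood n tree 𝓕
  Good⇒TreeGood (u , c , proper , ¬copy) = u , c , proper , λ (ψ , ψ∈ , rel' , rainbow) →
    let same : ∀ x y → c (ψ (index x)) ≡ c (ψ (index y)) → x ≡ y
        same x y e = trans (sym (at∘index x)) (trans (cong at (rainbow _ _ e)) (at∘index y))
    in ¬copy (record
      { φ = ψ ∘ index ; inside = ψ∈ ∘ index
      -- A rainbow map is injective, since equal images have equal colours.
      ; inj = λ x y e → same x y (cong c e)
      ; order = λ x y → record
          { to = λ x≼y → Equivalence.to (rel' _ _) (Equivalence.to (rel _ _) (subst₂ (FinPoset._≼_ T) (sym (at∘index x)) (sym (at∘index y)) x≼y))
          ; from = λ s → subst₂ (FinPoset._≼_ T) (at∘index x) (at∘index y) (Equivalence.from (rel _ _) (Equivalence.from (rel' _ _) s))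
          ; to-cong = λ { refl → refl } ; from-cong = λ { refl → refl } } }) same

  TreeGood⇒Good : TreeGood n tree 𝓕 → Good n T 𝓕
  TreeGood⇒Good (u , c , proper , ¬rainbow) = u , c , proper , λ C rb →
    let open Copy C using (φ; order) in ¬rainbow (φ ∘ at , Copy.inside C ∘ at ,
      (λ x y → record { to = λ r → Equivalence.to (order _ _) (Equivalence.from (rel x y) r)
                      ; from = λ s → Equivalence.to (rel x y) (Equivalence.from (order _ _) s)
                      ; to-cong = λ { refl → refl } ; from-cong = λ { refl → refl } }) ,
      λ x y e → injective x y (rb _ _ e))

-- Consecutive levels coloured by size

module _ (n s : ℕ) where

  private h = n / 2

  -- The levels go up from h only. For fixed r each of them is asymptotically as large as the middle
  -- one, so a symmetric choice would gain nothing to first order.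
  inLevels? : ∀ r (A : Subset n) → Dec (h ≤ ∣ A ∣ × ∣ A ∣ < h + r)
  inLevels? r A = (h ≤? ∣ A ∣) ×-dec (∣ A ∣ <? h + r)

  levels : Family n
  levels = filter (inLevels? s) (subsets n)

  -- A rainbow copy would have s + 1 different sizes, but only s sizes occur.
  levels-good : (τ : Tree (suc s)) → TreeGood n τ levels
  levels-good τ = Unique.filter⁺ (inLevels? s) (subsets-unique n) , ∣_∣ , (λ _ _ F⊂F' → <⇒≢ (p⊂q⇒∣p∣<∣q∣ F⊂F')) , ¬rainbow
    where
    ¬rainbow : ¬ RainbowTree τ levels ∣_∣
    ¬rainbow (ψ , ψ∈ , _ , rainbow) = 1+n≰n (Fin.injective⇒≤ {f = f} f-injective)
      where
      bounds : ∀ x → h ≤ ∣ ψ x ∣ × ∣ ψ x ∣ < h + s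
      bounds x = proj₂ (∈-filter⁻ (inLevels? s) {xs = subsets n} (ψ∈ x))
      offset<s : ∀ x → ∣ ψ x ∣ ∸ h < s
      offset<s x = subst (∣ ψ x ∣ ∸ h <_) (m+n∸m≡n h s) (∸-monoˡ-< (proj₂ (bounds x)) (proj₁ (bounds x)))
      f : Fin (suc s) → Fin s
      f x = Fin.fromℕ< (offset<s x)
      f-injective : ∀ {x y} → f x ≡ f y → x ≡ y
      f-injective {x} {y} e = rainbow x y (∸-cancelʳ-≡ (proj₁ (bounds x)) (proj₁ (bounds y))
        (trans (sym (Fin.toℕ-fromℕ< (offset<s x))) (trans (cong toℕ e) (Fin.toℕ-fromℕ< (offset<s y)))))

  #levels : ℕ → ℕ
  #levels r = ∑[ A ← subsets n ] ⟦ inLevels? r A ⟧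

  #levels-suc : ∀ r → #levels (suc r) ≡ #levels r + n C (h + r)
  #levels-suc r = trans (∑-cong (subsets n) (λ {A} _ → split A)) (trans (∑-+ (subsets n) _ _) (cong (#levels r +_) (#size≡ n (h + r))))
    where
    split : ∀ A → ⟦ inLevels? (suc r) A ⟧ ≡ ⟦ inLevels? r A ⟧ + ⟦ ∣ A ∣ ≟ h + r ⟧
    split A with <-cmp ∣ A ∣ (h + r)
    ... | tri< a<h+r a≢h+r _ = trans
      (⟦⟧-cong (inLevels? (suc r) A) (inLevels? r A) (λ (p , _) → p , a<h+r) (λ (p , q) → p , <-≤-trans q (+-monoʳ-≤ h (n≤1+n r))))
      (trans (sym (+-identityʳ _)) (cong (⟦ inLevels? r A ⟧ +_) (sym (⟦⟧-no (∣ A ∣ ≟ h + r) a≢h+r))))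
    ... | tri≈ a≮h+r a≡h+r _ = trans
      (⟦⟧-yes (inLevels? (suc r) A) (≤-trans (m≤m+n h r) (≤-reflexive (sym a≡h+r)) , subst (_< h + suc r) (sym a≡h+r) (+-monoʳ-< h (n<1+n r))))
      (sym (cong₂ _+_ (⟦⟧-no (inLevels? r A) (a≮h+r ∘ proj₂)) (⟦⟧-yes (∣ A ∣ ≟ h + r) a≡h+r)))
    ... | tri> a≮h+r a≢h+r a>h+r = trans
      (⟦⟧-no (inLevels? (suc r) A) (λ (_ , q) → <⇒≱ q (subst (_≤ ∣ A ∣) (sym (+-suc h r)) a>h+r)))
      (sym (cong₂ _+_ (⟦⟧-no (inLevels? r A) (a≮h+r ∘ proj₂)) (⟦⟧-no (∣ A ∣ ≟ h + r) a≢h+r)))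

  length-levels : length levels ≡ #levels s
  length-levels = trans (sym (∑-length levels)) (trans (∑-filter (inLevels? s) (subsets n) (λ _ → 1)) (∑-cong (subsets n) (λ _ → *-identityʳ _)))

  -- By `central-flat` with q = ks, each of the s levels falls short of M by at most M / (ks), hence
  -- all together by at most M / k.
  levels-large : ∀ k → 1 ≤ h → k * s * (s * s) ≤ h → k * s * (n C h) ≤ k * length levels + n C h
  levels-large k 1≤h ksss≤h = subst (λ l → k * s * M ≤ k * l + M) (sym length-levels) (cancel s refl)
    where
    open ≤-Reasoning
    M = n C h
    sum : ∀ r → r ≤ s → k * s * (r * M) ≤ k * s * #levels r + r * M
    sum zero    _   = ≤-trans (≤-reflexive (*-zeroʳ (k * s))) z≤n
    sum (suc r) r<s = begin
      k * s * (M + r * M)                                                ≡⟨ *-distribˡ-+ (k * s) M (r * M) ⟩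
      k * s * M + k * s * (r * M)                                        ≤⟨ +-mono-≤ (central-flat n (k * s) r 1≤h (≤-trans (*-monoʳ-≤ (k * s) (*-mono-≤ (<⇒≤ r<s) (<⇒≤ r<s))) ksss≤h)) (sum r (<⇒≤ r<s)) ⟩
      k * s * (n C (h + r)) + M + (k * s * #levels r + r * M)            ≡⟨ l (k * s) (n C (h + r)) M (#levels r) (r * M) ⟩
      k * s * (#levels r + n C (h + r)) + (M + r * M)                    ≡⟨ cong (λ z → k * s * z + (M + r * M)) (#levels-suc r) ⟨
      k * s * #levels (suc r) + (M + r * M)                              ∎
      where l : ∀ q c M L R → q * c + M + (q * L + R) ≡ q * (L + c) + (M + R)
            l = solve-∀
    -- `sum` at s carries an extra factor s; the case s = 0 is separate because 0 cannot be
    -- cancelled.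
    cancel : ∀ r → r ≡ s → k * s * M ≤ k * #levels s + M
    cancel zero    refl = ≤-trans (≤-reflexive (cong (_* M) (*-zeroʳ k))) z≤n
    cancel (suc r) refl = *-cancelˡ-≤ (suc r) (begin
      suc r * (k * suc r * M)                              ≡⟨ l₁ (suc r) (k * suc r) M ⟩
      k * suc r * (suc r * M)                              ≤⟨ sum (suc r) ≤-refl ⟩
      k * suc r * #levels (suc r) + suc r * M              ≡⟨ l₂ k (suc r) (#levels (suc r)) M ⟩
      suc r * (k * #levels (suc r) + M)                    ∎)
      where
      l₁ : ∀ x y z → x * (y * z) ≡ y * (x * z)
      l₁ = solve-∀
      l₂ : ∀ k r L M → k * r * L + r * M ≡ r * (k * L + M)
      l₂ = solve-∀

-- Existence of the maximum, and both bounds for it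

laStar : (T : FinPoset) (pres : TreePoset.Presentation T) → let s = TreePoset.Presentation.s pres in (k : ℕ) → 1 ≤ k →
  ∃[ N ] (∀ n → N ≤ n → ∃[ m ] (IsLaStar n T m
    × (k * s * (n C (n / 2)) ≤ k * m + n C (n / 2))
    × (k * m ≤ (k * s + 1) * (n C (n / 2)))))
laStar T pres k 1≤k = N , bound
  where
  open TreePoset.Presentation pres
  τ : Tree (suc s)
  τ = TreePoset.Partial.tree partial
  upper = upper-bound τ k
  N₀ = proj₁ upper
  H = suc (k * s * (s * s))
  N = N₀ ⊔ H * 2
  bound : ∀ n → N ≤ n → ∃[ m ] (IsLaStar n T m × (k * s * (n C (n / 2)) ≤ k * m + n C (n / 2)) × (k * m ≤ (k * s + 1) * (n C (n / 2))))
  bound n N≤n = proj₁ largest ,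
    ((𝓕 , TreeGood⇒Good T pres 𝓕 (proj₁ (proj₂ witness)) , proj₂ (proj₂ witness)) ,
     λ 𝓖 good → maximal (length 𝓖) (𝓖 , Good⇒TreeGood T pres 𝓖 good , refl) (small 𝓖 (Good⇒TreeGood T pres 𝓖 good))) ,
    ≤-trans (levels-large n s k (≤-trans (s≤s z≤n) H≤h) (≤-trans (n≤1+n _) H≤h))
            (+-monoˡ-≤ (n C (n / 2)) (*-monoʳ-≤ k (maximal _ (levels n s , levels-good n s τ , refl) (small _ (levels-good n s τ))))) ,
    subst (λ m → k * m ≤ B) (proj₂ (proj₂ witness)) (sparse 𝓕 (proj₁ (proj₂ witness)))
    where
    B = (k * s + 1) * (n C (n / 2))
    H≤h : H ≤ n / 2
    H≤h = subst (_≤ n / 2) (m*n/n≡m H 2) (/-monoˡ-≤ 2 (≤-trans (m≤n⊔m N₀ (H * 2)) N≤n))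
    sparse : ∀ 𝓖 → TreeGood n τ 𝓖 → k * length 𝓖 ≤ B
    sparse 𝓖 (u , c , proper , ¬rainbow) = proj₂ upper n (≤-trans (m≤m⊔n N₀ (H * 2)) N≤n) 𝓖 u c proper ¬rainbow
    small : ∀ 𝓖 → TreeGood n τ 𝓖 → length 𝓖 ≤ B
    small 𝓖 good = ≤-trans (m≤n*m (length 𝓖) k {{>-nonZero 1≤k}}) (sparse 𝓖 good)
    -- As k ≥ 1, `B` bounds the size of every good family, so the search is finite; the family of
    -- levels shows that some size occurs.
    largest = greatest (good-size? τ) B (length (levels n s) , (levels n s , levels-good n s τ , refl) , small _ (levels-good n s τ))
    witness = proj₁ (proj₂ largest)
    𝓕 = proj₁ witness
    maximal = proj₂ (proj₂ largest)

theorem1p6 : (T : FinPoset) → IsTreePoset T →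
    (k : ℕ) → 1 ≤ k →
    ∃ λ N → ∀ n → N ≤ n → ∃ λ m → IsLaStar n T m
    × (k * (∣ T ∣ₚ ∸ 1) * (n C (n / 2)) ≤ k * m + n C (n / 2))
    × (k * m ≤ (k * (∣ T ∣ₚ ∸ 1) + 1) * (n C (n / 2)))
theorem1p6 T tree k 1≤k = subst (λ s → ∃ λ N → ∀ n → N ≤ n → ∃ λ m → IsLaStar n T m
    × (k * s * (n C (n / 2)) ≤ k * m + n C (n / 2))
    × (k * m ≤ (k * s + 1) * (n C (n / 2)))) (cong pred size≡) (laStar T pres k 1≤k)
  where
  pres = TreePoset.present T tree
  open TreePoset.Presentation pres
  open TreePoset.Partial partial using (at; injective)
  size≡ : suc s ≡ ∣ T ∣ₚ
  size≡ = ≤-antisym (Fin.injective⇒≤ {f = at} (λ {x} {y} → injective x y))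
    (Fin.injective⇒≤ {f = index} (λ {x} {y} e → trans (sym (at∘index x)) (trans (cong at e) (at∘index y))))
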